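{- For every integer $n\ge 1$, the sixth factorial moment of the area statistic on parking functions of length $n$ is $$\mathbb{E}\Big[\prod_{j=0}^{5}(\mathrm{Area}-j)\Big]=\frac{82825}{576576}n^{9}+\frac{373340075}{110702592}n^{8}+\frac{9401544029}{332107776}n^{7}+\frac{14473244813}{127733760}n^{6}+\frac{414139396709}{1660538880}n^{5}$$ $$+\frac{88215445651}{332107776}n^{4}-\frac{18783816473}{332107776}n^{3}-\frac{643359542029}{1660538880}n^{2}-\frac{358936540409}{1660538880}n$$ $$+\Big(-\frac{3955}{2048}n^{7}-\frac{186349}{6144}n^{6}-\frac{259283273}{1161216}n^{5}-\frac{119912501}{129024}n^{4}-\frac{149860633081}{63866880}n^{3}$$ $$-\frac{601794266581}{166053888}n^{2}-\frac{864000570107}{276756480}n-\frac{921390308389}{830269440}\Big)E_1(n),$$ and asymptotically it equals $\frac{82825}{576576}n^{9}+O(n^{17/2})$ as $n\to\infty$.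
   Context: A parking function of length $n$ is a vector $(p_1,\dots,p_n)$ of positive integers such that its weakly increasing rearrangement $p_{(1)}\le p_{(2)}\le\dots\le p_{(n)}$ satisfies $p_{(i)}\le i$ for all $1\le i\le n$. There are $(n+1)^{n-1}$ of them. The area statistic is $\mathrm{Area}(p)=\frac{n(n+1)}{2}-\sum_{i=1}^n p_i$. Expectations are taken with respect to the uniform distribution on the set of parking functions of length $n$; the $k$-th factorial moment is $\mathbb{E}[\mathrm{Area}(\mathrm{Area}-1)\cdots(\mathrm{Area}-k+1)]$. Here $E_1(n)$ denotes $$E_1(n)= -\frac{n}{2}+\frac{1}{2}\,\frac{(n+1)!}{(n+1)^{n}}\sum_{k=0}^{n-1}\frac{(n+1)^k}{k!},$$ which is the expectation of the area statistic on parking functions of length $n$. -}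

module Defs where

open import Data.Bool using (Bool; true; false; _∧_; _≟_)
open import Data.Nat as ℕ using (ℕ; zero; suc; _≤ᵇ_)
open import Data.Nat.Properties using (≤-decTotalOrder)
open import Data.Nat using (_!)
open import Data.Integer using (+_)
open import Data.List using (List; []; _∷_; map; concatMap; filter; upTo; length; foldr)
open import Data.Nat.ListAction using () renaming (sum to sumℕ)
open import Data.Vec using (Vec; []; _∷_; toList)
open import Data.Rational using (ℚ; _+_; _*_; _-_; _/_; 0ℚ; 1ℚ)
open import Data.List.Sort ≤-decTotalOrder using (sort)
open import Relation.Nullary.Decidable using (Dec; _because_)
open import Relation.Binary.PropositionalEquality using (_≡_)

ι : ℕ → ℚ
ι n = (+ n) / 1

-- q / m for a natural m (convention: q / 0 = 0; only used with m ≥ 1)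
_/ℕ_ : ℚ → ℕ → ℚ
q /ℕ zero = 0ℚ
q /ℕ suc m = q * ((+ 1) / suc m)

_^ℚ_ : ℚ → ℕ → ℚ
q ^ℚ zero = 1ℚ
q ^ℚ suc k = q * (q ^ℚ k)

sumℚ : List ℚ → ℚ
sumℚ = foldr _+_ 0ℚ

Σ< : ℕ → (ℕ → ℚ) → ℚ
Σ< m f = sumℚ (map f (upTo m))

allVecs : (n m : ℕ) → List (Vec ℕ n)
allVecs zero m = [] ∷ []
allVecs (suc n) m = concatMap (λ x → map (x ∷_) (allVecs n m)) (map suc (upTo m))

boundedFrom : ℕ → List ℕ → Bool
boundedFrom i [] = true
boundedFrom i (x ∷ xs) = (x ≤ᵇ i) ∧ boundedFrom (suc i) xs

-- p is a parking function: its weakly increasing rearrangement p₍ᵢ₎ satisfies p₍ᵢ₎ ≤ i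
-- (entries are positive by construction of allVecs)
isParking : {n : ℕ} → Vec ℕ n → Bool
isParking p = boundedFrom 1 (sort (toList p))

-- the list of all parking functions of length n
-- (every parking function has entries in {1,…,n}, so enumerating those vectors suffices)
parkingFunctions : (n : ℕ) → List (Vec ℕ n)
parkingFunctions n = filter (λ p → isParking p ≟ true) (allVecs n n)

area : (n : ℕ) → Vec ℕ n → ℚ
area n p = ((+ (n ℕ.* suc n)) / 2) - ι (sumℕ (toList p))


falling : ℚ → ℕ → ℚ
falling x zero = 1ℚ
falling x (suc k) = falling x k * (x - ι k)

expect : (n : ℕ) → (Vec ℕ n → ℚ) → ℚ
expect n f = sumℚ (map f (parkingFunctions n)) /ℕ length (parkingFunctions n)

factorialMoment : ℕ → ℕ → ℚ
factorialMoment k n = expect n (λ p → falling (area n p) k)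

E₁ : ℕ → ℚ
E₁ n = (0ℚ - (ι n /ℕ 2))
     + ((ι (suc n !) /ℕ (suc n ℕ.^ n)) /ℕ 2) * Σ< n (λ k → ι (suc n ℕ.^ k) /ℕ (k !))

-- Let P_n(q) be the sum of q^area over the parking functions of length n, and A(x) = Σ q^(n(n-1)/2) x^n/n!. Splitting a
-- parking function by its letters 1 gives Σ (q-1)^n P_n(q) x^n/n! = A(q x)/A(x). Since q ∂A/∂q = (θ² - θ)A/2 for
-- θ = x d/dx, the logarithmic derivative θA/A satisfies a Burgers equation in q; expanding it at q = 1 gives Wright's
-- recurrence for the generating functions V_k(z) of the k-th binomial moments of the area. With the tree function
-- T = z e^T and X = 1/(1 - T), each V_k is a Laurent polynomial in X, determined recursively. The coefficients of the
-- powers of X reduce by θX = X³ - X² to those of X, which are n^n/n!, and of X², which are Σ_{k≤n} n^k/k! and hence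
-- linear in E₁. The growth rate follows from E₁(n)² = O(n³).

module Submission where

open import Defs
open import Algebra using (CommutativeRing)
import Algebra.Construct.Pointwise as Pointwise
import Algebra.Properties.CommutativeSemigroup as CommutativeSemigroupProperties
import Algebra.Properties.CommutativeSemiring.Exp as Exp
import Algebra.Properties.Ring as RingProperties
import Algebra.Solver.Ring as RingSolver
open import Algebra.Solver.Ring.AlmostCommutativeRing using (fromCommutativeRing; -raw-almostCommutative⟶; _-Raw-AlmostCommutative⟶_)
open import Data.Bool as Bool using (Bool; true; false; if_then_else_; _∧_)
open import Data.Empty using (⊥-elim)
open import Data.Integer as ℤ using (+_; -[1+_])
import Data.Integer.Properties as ℤP
open import Data.List using (List; []; _∷_; _++_; applyUpTo; concatMap; filter; length; map; replicate; take)
import Data.List.Properties as ListP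
open import Data.List.Relation.Binary.Permutation.Propositional using (_↭_; ↭-sym; ↭-trans; ↭⇒↭ₛ; prep)
import Data.List.Relation.Binary.Permutation.Propositional.Properties as ↭P
open import Data.List.Relation.Binary.Pointwise using (Pointwise-≡⇒≡)
open import Data.List.Relation.Unary.All as All using (All; []; _∷_)
import Data.List.Relation.Unary.All.Properties as AllP
open import Data.List.Relation.Unary.Linked using ([]; [-]; _∷_)
import Data.List.Relation.Unary.Sorted.TotalOrder.Properties as SortedP
import Data.Maybe as Maybe
open import Data.Nat as ℕ using (ℕ; zero; suc; _!; _∸_; _≤ᵇ_; z≤n; s≤s)
import Data.Nat.Properties as ℕP
open import Data.List.Relation.Unary.Sorted.TotalOrder ℕP.≤-totalOrder using (Sorted)
open import Data.List.Sort ℕP.≤-decTotalOrder using (sort; sort-↭; sort-↗)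
open import Data.Nat.ListAction using (sum)
open import Data.Nat.ListAction.Properties using (sum-↭)
open import Data.Nat.Tactic.RingSolver using (solve-∀)
open import Data.Product using (Σ; _×_; _,_; proj₁; proj₂; ∃-syntax)
open import Data.Rational as ℚ using (ℚ; 0ℚ; 1ℚ; ½; ∣_∣; _/_)
import Data.Rational.Properties as ℚP
open import Data.Rational.Unnormalised as ℚᵘ using (mkℚᵘ; *≡*)
import Data.Rational.Unnormalised.Properties as ℚᵘP
open import Data.Sum using (inj₁; inj₂)
open import Data.Vec using (Vec; toList) renaming (_∷_ to _∷ᵛ_)
import Data.Vec.Properties as VecP
open import Level using (0ℓ)
open import Relation.Binary.PropositionalEquality as ≡ using (_≡_; _≢_; cong; cong₂; subst)
import Relation.Binary.Reasoning.Setoid as SetoidReasoning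
open import Relation.Nullary using (yes; no)
open import Relation.Nullary.Decidable using (dec⇒maybe; ⌊_⌋)

-- Rational algebras and formal power series

-- Two divisions shape the argument. The polynomial P_n occurs only with the factor (q - 1)^n, so
-- nothing can be read off at q = 1 directly. Hence y = q - 1 is a formal variable, x-series have
-- y-series as coefficients, and the Burgers equation is divided by y^n in degree n before its
-- y-coefficients are compared. The second is the quotient A(q x)/A(x). The letter splitting does
-- not close on parking functions alone, so all quotients A(q^i x)/A(x) are treated at once, with
-- words below the staircase i, i + 1, ... . This family also replaces Lagrange inversion: rescaled
-- and taken at q = 1 it becomes the powers exp(i T), whose product law is the telescoping of the
-- quotients and whose coefficients come from the same splitting. The Laurent polynomials in X are
-- not derived inside the proof. They are written down and checked against the recurrence, which has
-- a unique solution once the constant terms are known.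

toℚᵘ-ι : ∀ n → ℚ.toℚᵘ (ι n) ℚᵘ.≃ mkℚᵘ (+ n) 0
toℚᵘ-ι n = ℚP.toℚᵘ-fromℚᵘ (mkℚᵘ (+ n) 0)

ι-+ : ∀ m n → ι (m ℕ.+ n) ≡ ι m ℚ.+ ι n
ι-+ m n = ℚP.toℚᵘ-injective (begin
  ℚ.toℚᵘ (ι (m ℕ.+ n))               ≈⟨ toℚᵘ-ι (m ℕ.+ n) ⟩
  mkℚᵘ (+ (m ℕ.+ n)) 0               ≈⟨ *≡* (cong (ℤ._* + 1) (cong₂ ℤ._+_ (≡.sym (ℤP.*-identityʳ (+ m))) (≡.sym (ℤP.*-identityʳ (+ n))))) ⟩
  mkℚᵘ (+ m) 0 ℚᵘ.+ mkℚᵘ (+ n) 0     ≈⟨ ℚᵘP.+-cong (toℚᵘ-ι m) (toℚᵘ-ι n) ⟨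
  ℚ.toℚᵘ (ι m) ℚᵘ.+ ℚ.toℚᵘ (ι n)     ≈⟨ ℚP.toℚᵘ-homo-+ (ι m) (ι n) ⟨
  ℚ.toℚᵘ (ι m ℚ.+ ι n)               ∎)
  where open SetoidReasoning ℚᵘP.≃-setoid

ι-* : ∀ m n → ι (m ℕ.* n) ≡ ι m ℚ.* ι n
ι-* m n = ℚP.toℚᵘ-injective (begin
  ℚ.toℚᵘ (ι (m ℕ.* n))               ≈⟨ toℚᵘ-ι (m ℕ.* n) ⟩
  mkℚᵘ (+ (m ℕ.* n)) 0               ≈⟨ *≡* (cong (ℤ._* + 1) (ℤP.pos-* m n)) ⟩
  mkℚᵘ (+ m) 0 ℚᵘ.* mkℚᵘ (+ n) 0     ≈⟨ ℚᵘP.*-cong (toℚᵘ-ι m) (toℚᵘ-ι n) ⟨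
  ℚ.toℚᵘ (ι m) ℚᵘ.* ℚ.toℚᵘ (ι n)     ≈⟨ ℚP.toℚᵘ-homo-* (ι m) (ι n) ⟨
  ℚ.toℚᵘ (ι m ℚ.* ι n)               ∎)
  where open SetoidReasoning ℚᵘP.≃-setoid

1/suc : ℕ → ℚ
1/suc n = (+ 1) ℚ./ suc n

ι-suc-*-/ : ∀ k m → ι (suc k) ℚ.* ((+ m) ℚ./ suc k) ≡ ι m
ι-suc-*-/ k m = ℚP.toℚᵘ-injective (begin
  ℚ.toℚᵘ (ι (suc k) ℚ.* ((+ m) ℚ./ suc k))              ≈⟨ ℚP.toℚᵘ-homo-* (ι (suc k)) ((+ m) ℚ./ suc k) ⟩
  ℚ.toℚᵘ (ι (suc k)) ℚᵘ.* ℚ.toℚᵘ ((+ m) ℚ./ suc k)      ≈⟨ ℚᵘP.*-cong (toℚᵘ-ι (suc k)) (ℚP.toℚᵘ-fromℚᵘ (mkℚᵘ (+ m) k)) ⟩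
  mkℚᵘ (+ suc k) 0 ℚᵘ.* mkℚᵘ (+ m) k                    ≈⟨ *≡* (≡.trans (ℤP.*-identityʳ _) (≡.trans (ℤP.*-comm (+ suc k) (+ m)) (cong (λ l → + m ℤ.* + suc l) (≡.sym (ℕP.+-identityʳ k))))) ⟩
  mkℚᵘ (+ m) 0                                          ≈⟨ toℚᵘ-ι m ⟨
  ℚ.toℚᵘ (ι m)                                          ∎)
  where open SetoidReasoning ℚᵘP.≃-setoid

ι-suc-* : ∀ n → ι (suc n) ℚ.* 1/suc n ≡ 1ℚ
ι-suc-* n = ι-suc-*-/ n 1

ι-cancel : ∀ n {x y} → ι (suc n) ℚ.* x ≡ ι (suc n) ℚ.* y → x ≡ y
ι-cancel n {x} {y} eq = ≡.trans (≡.sym (undo x)) (≡.trans (cong (1/suc n ℚ.*_) eq) (undo y))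
  where
  undo : ∀ z → 1/suc n ℚ.* (ι (suc n) ℚ.* z) ≡ z
  undo z = ≡.trans (≡.sym (ℚP.*-assoc (1/suc n) (ι (suc n)) z))
    (≡.trans (cong (ℚ._* z) (≡.trans (ℚP.*-comm (1/suc n) (ι (suc n))) (ι-suc-* n))) (ℚP.*-identityˡ z))

invFact : ℕ → ℚ
invFact zero    = 1ℚ
invFact (suc n) = invFact n ℚ.* 1/suc n

ι-suc-*-invFact : ∀ n → ι (suc n) ℚ.* invFact (suc n) ≡ invFact n
ι-suc-*-invFact n = begin
  ι (suc n) ℚ.* (invFact n ℚ.* 1/suc n)   ≡⟨ cong (ι (suc n) ℚ.*_) (ℚP.*-comm (invFact n) (1/suc n)) ⟩
  ι (suc n) ℚ.* (1/suc n ℚ.* invFact n)   ≡⟨ ℚP.*-assoc (ι (suc n)) (1/suc n) (invFact n) ⟨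
  ι (suc n) ℚ.* 1/suc n ℚ.* invFact n     ≡⟨ cong (ℚ._* invFact n) (ι-suc-* n) ⟩
  1ℚ ℚ.* invFact n                        ≡⟨ ℚP.*-identityˡ (invFact n) ⟩
  invFact n                               ∎
  where open ≡.≡-Reasoning

ι-!-*-invFact : ∀ n → ι (n !) ℚ.* invFact n ≡ 1ℚ
ι-!-*-invFact zero    = ≡.refl
ι-!-*-invFact (suc n) = begin
  ι (suc n ℕ.* n !) ℚ.* invFact (suc n)             ≡⟨ cong (ℚ._* invFact (suc n)) (≡.trans (cong ι (ℕP.*-comm (suc n) (n !))) (ι-* (n !) (suc n))) ⟩
  ι (n !) ℚ.* ι (suc n) ℚ.* invFact (suc n)         ≡⟨ ℚP.*-assoc (ι (n !)) (ι (suc n)) (invFact (suc n)) ⟩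
  ι (n !) ℚ.* (ι (suc n) ℚ.* invFact (suc n))       ≡⟨ cong (ι (n !) ℚ.*_) (ι-suc-*-invFact n) ⟩
  ι (n !) ℚ.* invFact n                             ≡⟨ ι-!-*-invFact n ⟩
  1ℚ                                                ∎
  where open ≡.≡-Reasoning

-- Scalars occur at three depths: `A`, power series in y over `A`, and power series in x over those.
-- One interface with a structure map from ℚ lets the sum lemmas, the operators and a ring solver
-- with rational coefficients serve every depth.
record ℚ-Algebra : Set₁ where
  field
    commutativeRing : CommutativeRing 0ℓ 0ℓ
    structureMap    : CommutativeRing.rawRing ℚP.+-*-commutativeRing
                        -Raw-AlmostCommutative⟶ fromCommutativeRing commutativeRing

  open CommutativeRing commutativeRing public
  open _-Raw-AlmostCommutative⟶_ structureMap public
    renaming (⟦_⟧ to fromℚ; +-homo to fromℚ-+; *-homo to fromℚ-*; -‿homo to fromℚ-neg; 0-homo to fromℚ-0; 1-homo to fromℚ-1)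
  open Exp commutativeSemiring public
  open RingProperties ring public using (-0#≈0#)

  fromℚ-cong : ∀ {x y} → x ≡ y → fromℚ x ≈ fromℚ y
  fromℚ-cong ≡.refl = refl

  open RingSolver (CommutativeRing.rawRing ℚP.+-*-commutativeRing) (fromCommutativeRing commutativeRing) structureMap
    (λ x y → Maybe.map fromℚ-cong (dec⇒maybe (x ℚP.≟ y)))
    public using (solve; _:=_; _:+_; _:*_; _:-_; :-_; _:^_; con)

  nat : ℕ → Carrier
  nat n = fromℚ (ι n)

  nat-+ : ∀ m n → nat (m ℕ.+ n) ≈ nat m + nat n
  nat-+ m n = trans (fromℚ-cong (ι-+ m n)) (fromℚ-+ (ι m) (ι n))

  e : ℕ → Carrier
  e n = fromℚ (invFact n)

  nat-suc-*-e : ∀ n → nat (suc n) * e (suc n) ≈ e n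
  nat-suc-*-e n = trans (sym (fromℚ-* _ _)) (fromℚ-cong (ι-suc-*-invFact n))

  nat-cancel : ∀ n {x y} → nat (suc n) * x ≈ nat (suc n) * y → x ≈ y
  nat-cancel n {x} {y} eq = trans (sym (undo x)) (trans (*-congˡ eq) (undo y))
    where
    undo : ∀ z → fromℚ (1/suc n) * (nat (suc n) * z) ≈ z
    undo z = trans (sym (*-assoc _ _ z)) (trans (*-congʳ (trans (sym (fromℚ-* _ _))
      (trans (fromℚ-cong (≡.trans (ℚP.*-comm (1/suc n) (ι (suc n))) (ι-suc-* n))) fromℚ-1))) (*-identityˡ z))

ℚ-algebra : ℚ-Algebra
ℚ-algebra = record
  { commutativeRing = ℚP.+-*-commutativeRing
  ; structureMap    = -raw-almostCommutative⟶ (fromCommutativeRing ℚP.+-*-commutativeRing)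
  }

module Antidiagonal (A : ℚ-Algebra) where
  open ℚ-Algebra A
  open SetoidReasoning setoid
  open CommutativeSemigroupProperties +-commutativeSemigroup using (interchange)

  ∑₊ : ℕ → (ℕ → ℕ → Carrier) → Carrier
  ∑₊ zero    h = h 0 0
  ∑₊ (suc n) h = h 0 (suc n) + ∑₊ n (λ i j → h (suc i) j)

  ∑₊-cong′ : ∀ n {h k : ℕ → ℕ → Carrier} → (∀ i j → i ℕ.+ j ≡ n → h i j ≈ k i j) → ∑₊ n h ≈ ∑₊ n k
  ∑₊-cong′ zero    eq = eq 0 0 ≡.refl
  ∑₊-cong′ (suc n) eq = +-cong (eq 0 (suc n) ≡.refl) (∑₊-cong′ n λ i j p → eq (suc i) j (cong suc p))

  ∑₊-cong : ∀ n {h k : ℕ → ℕ → Carrier} → (∀ i j → h i j ≈ k i j) → ∑₊ n h ≈ ∑₊ n k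
  ∑₊-cong n eq = ∑₊-cong′ n λ i j _ → eq i j

  ∑₊-+ : ∀ n h k → ∑₊ n (λ i j → h i j + k i j) ≈ ∑₊ n h + ∑₊ n k
  ∑₊-+ zero    h k = refl
  ∑₊-+ (suc n) h k = trans (+-congˡ (∑₊-+ n _ _)) (interchange _ _ _ _)

  ∑₊-*ˡ : ∀ n c (h : ℕ → ℕ → Carrier) → ∑₊ n (λ i j → c * h i j) ≈ c * ∑₊ n h
  ∑₊-*ˡ zero    c h = refl
  ∑₊-*ˡ (suc n) c h = trans (+-congˡ (∑₊-*ˡ n c _)) (sym (distribˡ c _ _))

  ∑₊-*ʳ : ∀ n c (h : ℕ → ℕ → Carrier) → ∑₊ n (λ i j → h i j * c) ≈ ∑₊ n h * c
  ∑₊-*ʳ n c h = trans (∑₊-cong n λ i j → *-comm _ c) (trans (∑₊-*ˡ n c h) (*-comm c _))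

  ∑₊-0 : ∀ n → ∑₊ n (λ _ _ → 0#) ≈ 0#
  ∑₊-0 zero    = refl
  ∑₊-0 (suc n) = trans (+-identityˡ _) (∑₊-0 n)

  ∑₊-last : ∀ n h → ∑₊ (suc n) h ≈ ∑₊ n (λ i j → h i (suc j)) + h (suc n) 0
  ∑₊-last zero    h = refl
  ∑₊-last (suc n) h = trans (+-congˡ (∑₊-last n λ i j → h (suc i) j)) (sym (+-assoc _ _ _))

  ∑₊-swap : ∀ n h → ∑₊ n h ≈ ∑₊ n (λ i j → h j i)
  ∑₊-swap zero    h = refl
  ∑₊-swap (suc n) h = begin
    h 0 (suc n) + ∑₊ n (λ i j → h (suc i) j)   ≈⟨ +-comm _ _ ⟩
    ∑₊ n (λ i j → h (suc i) j) + h 0 (suc n)   ≈⟨ +-congʳ (∑₊-swap n _) ⟩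
    ∑₊ n (λ i j → h (suc j) i) + h 0 (suc n)   ≈⟨ ∑₊-last n (λ i j → h j i) ⟨
    ∑₊ (suc n) (λ i j → h j i)                 ∎

  ∑₊-assoc : ∀ n (f : ℕ → ℕ → ℕ → Carrier) →
    ∑₊ n (λ m r → ∑₊ m (λ j l → f j l r)) ≈ ∑₊ n (λ j t → ∑₊ t (λ l r → f j l r))
  ∑₊-assoc zero    f = refl
  ∑₊-assoc (suc n) f = begin
    f 0 0 (suc n) + ∑₊ n (λ m r → f 0 (suc m) r + ∑₊ m (λ j l → f (suc j) l r))                        ≈⟨ +-congˡ (∑₊-+ n _ _) ⟩
    f 0 0 (suc n) + (∑₊ n (λ m r → f 0 (suc m) r) + ∑₊ n (λ m r → ∑₊ m (λ j l → f (suc j) l r)))       ≈⟨ +-assoc _ _ _ ⟨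
    f 0 0 (suc n) + ∑₊ n (λ m r → f 0 (suc m) r) + ∑₊ n (λ m r → ∑₊ m (λ j l → f (suc j) l r))         ≈⟨ +-congˡ (∑₊-assoc n (λ j → f (suc j))) ⟩
    f 0 0 (suc n) + ∑₊ n (λ m r → f 0 (suc m) r) + ∑₊ n (λ j t → ∑₊ t (λ l r → f (suc j) l r))         ∎

  ∑₊-comm : ∀ n k (f : ℕ → ℕ → ℕ → ℕ → Carrier) →
    ∑₊ n (λ i j → ∑₊ k (f i j)) ≈ ∑₊ k (λ a b → ∑₊ n (λ i j → f i j a b))
  ∑₊-comm zero    k f = refl
  ∑₊-comm (suc n) k f = trans (+-congˡ (∑₊-comm n k _)) (sym (∑₊-+ k _ _))

  -- Leibniz rule in coefficient form: on the antidiagonal n = i + j, so the weight n distributes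
  -- over the two factors. It drives the word splitting, the binomial theorem and the product rule
  -- for θ.
  nat-*-∑₊ : ∀ n (h : ℕ → ℕ → Carrier) → nat n * ∑₊ n h ≈ ∑₊ n (λ i j → nat i * h i j) + ∑₊ n (λ i j → nat j * h i j)
  nat-*-∑₊ n h = begin
    nat n * ∑₊ n h                                                ≈⟨ ∑₊-*ˡ n (nat n) h ⟨
    ∑₊ n (λ i j → nat n * h i j)                                  ≈⟨ ∑₊-cong′ n (λ i j p → trans (*-congʳ (trans (fromℚ-cong (cong ι (≡.sym p))) (nat-+ i j))) (distribʳ _ _ _)) ⟩
    ∑₊ n (λ i j → nat i * h i j + nat j * h i j)                  ≈⟨ ∑₊-+ n _ _ ⟩
    ∑₊ n (λ i j → nat i * h i j) + ∑₊ n (λ i j → nat j * h i j)   ∎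

  nat-0-* : ∀ x → nat 0 * x ≈ 0#
  nat-0-* x = trans (*-congʳ fromℚ-0) (zeroˡ x)

  ∑₊-natˡ : ∀ n (h : ℕ → ℕ → Carrier) → ∑₊ (suc n) (λ i j → nat i * h i j) ≈ ∑₊ n (λ i j → nat (suc i) * h (suc i) j)
  ∑₊-natˡ n h = trans (+-congʳ (nat-0-* (h 0 (suc n)))) (+-identityˡ _)

  ∑₊-natʳ : ∀ n (h : ℕ → ℕ → Carrier) → ∑₊ (suc n) (λ i j → nat j * h i j) ≈ ∑₊ n (λ i j → nat (suc j) * h i (suc j))
  ∑₊-natʳ n h = trans (∑₊-last n (λ i j → nat j * h i j)) (trans (+-congˡ (nat-0-* (h (suc n) 0))) (+-identityʳ _))

module PowerSeries (A : ℚ-Algebra) where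
  private module A = ℚ-Algebra A
  open Antidiagonal A
  open SetoidReasoning A.setoid

  Series : Set
  Series = ℕ → A.Carrier

  infix  4 _≈_
  infixl 7 _*_
  infixl 6 _+_

  _≈_ : Series → Series → Set
  f ≈ g = ∀ n → f n A.≈ g n

  _+_ _*_ : Series → Series → Series
  (f + g) n = f n A.+ g n
  (f * g) n = ∑₊ n (λ i j → f i A.* g j)

  const : A.Carrier → Series
  const c zero    = c
  const c (suc n) = A.0#

  const-* : ∀ c f n → (const c * f) n A.≈ c A.* f n
  const-* c f zero    = A.refl
  const-* c f (suc n) = A.trans (A.+-congˡ (A.trans (∑₊-cong n λ i j → A.zeroˡ _) (∑₊-0 n))) (A.+-identityʳ _)

  *-comm : ∀ f g → f * g ≈ g * f
  *-comm f g n = A.trans (∑₊-swap n _) (∑₊-cong n λ i j → A.*-comm _ _)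

  *-assoc : ∀ f g h → (f * g) * h ≈ f * (g * h)
  *-assoc f g h n = begin
    ∑₊ n (λ m r → ∑₊ m (λ j l → f j A.* g l) A.* h r)     ≈⟨ ∑₊-cong n (λ m r → ∑₊-*ʳ m (h r) _) ⟨
    ∑₊ n (λ m r → ∑₊ m (λ j l → f j A.* g l A.* h r))     ≈⟨ ∑₊-assoc n (λ j l r → f j A.* g l A.* h r) ⟩
    ∑₊ n (λ j t → ∑₊ t (λ l r → f j A.* g l A.* h r))     ≈⟨ ∑₊-cong n (λ j t → A.trans (∑₊-cong t λ l r → A.*-assoc _ _ _) (∑₊-*ˡ t (f j) _)) ⟩
    ∑₊ n (λ j t → f j A.* ∑₊ t (λ l r → g l A.* h r))     ∎

  *-identityˡ : ∀ f → const A.1# * f ≈ f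
  *-identityˡ f n = A.trans (const-* A.1# f n) (A.*-identityˡ _)

  *-distribˡ : ∀ f g h → f * (g + h) ≈ f * g + f * h
  *-distribˡ f g h n = A.trans (∑₊-cong n λ i j → A.distribˡ _ _ _) (∑₊-+ n _ _)

  seriesRing : CommutativeRing 0ℓ 0ℓ
  seriesRing = record
    { Carrier = Series
    ; _≈_ = _≈_
    ; _+_ = _+_
    ; _*_ = _*_
    ; -_  = λ f n → A.- f n
    ; 0#  = λ _ → A.0#
    ; 1#  = const A.1#
    ; isCommutativeRing = record
      { isRing = record
        { +-isAbelianGroup = Pointwise.isAbelianGroup ℕ A.+-isAbelianGroup
        ; *-cong     = λ p q n → ∑₊-cong n λ i j → A.*-cong (p i) (q j)
        ; *-assoc    = *-assoc
        ; *-identity = *-identityˡ , λ f n → A.trans (*-comm f (const A.1#) n) (*-identityˡ f n)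
        ; distrib    = *-distribˡ , λ f g h n → A.trans (*-comm (g + h) f n)
                         (A.trans (*-distribˡ f g h n) (A.+-cong (*-comm f g n) (*-comm f h n)))
        }
      ; *-comm = *-comm
      }
    }

  seriesAlgebra : ℚ-Algebra
  seriesAlgebra = record
    { commutativeRing = seriesRing
    ; structureMap = record
      { ⟦_⟧    = λ x → const (A.fromℚ x)
      ; +-homo = λ x y → λ { zero → A.fromℚ-+ x y ; (suc n) → A.sym (A.+-identityˡ _) }
      ; *-homo = λ x y n → A.sym (A.trans (const-* (A.fromℚ x) (const (A.fromℚ y)) n)
                   (lemma x y n))
      ; -‿homo = λ x → λ { zero → A.fromℚ-neg x ; (suc n) → A.sym A.-0#≈0# }
      ; 0-homo = λ { zero → A.fromℚ-0 ; (suc n) → A.refl }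
      ; 1-homo = λ { zero → A.fromℚ-1 ; (suc n) → A.refl }
      }
    }
    where
    lemma : ∀ x y n → A.fromℚ x A.* const (A.fromℚ y) n A.≈ const (A.fromℚ (x ℚ.* y)) n
    lemma x y zero    = A.sym (A.fromℚ-* x y)
    lemma x y (suc n) = A.zeroʳ _

-- Sums over words and parking functions

tri : ℕ → ℕ
tri zero    = 0
tri (suc n) = n ℕ.+ tri n

tri-+ : ∀ m n → tri (m ℕ.+ n) ≡ tri m ℕ.+ tri n ℕ.+ m ℕ.* n
tri-+ zero    n = ≡.sym (ℕP.+-identityʳ (tri n))
tri-+ (suc m) n = ≡.trans (cong (m ℕ.+ n ℕ.+_) (tri-+ m n)) (lemma m n (tri m) (tri n))
  where
  lemma : ∀ m n a b → m ℕ.+ n ℕ.+ (a ℕ.+ b ℕ.+ m ℕ.* n) ≡ m ℕ.+ a ℕ.+ b ℕ.+ (n ℕ.+ m ℕ.* n)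
  lemma = solve-∀

onesThen : ℕ → List ℕ → List ℕ
onesThen j w = replicate j 1 ++ map suc w

sorted-unique : ∀ {xs ys} → Sorted xs → Sorted ys → xs ↭ ys → xs ≡ ys
sorted-unique xs↗ ys↗ p = Pointwise-≡⇒≡ (SortedP.↗↭↗⇒≋ ℕP.≤-totalOrder xs↗ ys↗ (↭⇒↭ₛ p))

sort-cong-↭ : ∀ {xs ys} → xs ↭ ys → sort xs ≡ sort ys
sort-cong-↭ {xs} {ys} p = sorted-unique (sort-↗ xs) (sort-↗ ys)
  (↭-trans (sort-↭ xs) (↭-trans p (↭-sym (sort-↭ ys))))

sort-[] : sort [] ≡ []
sort-[] = ↭P.↭-empty-inv (sort-↭ [])

sort-positive : ∀ {w} → All (1 ℕ.≤_) w → All (1 ℕ.≤_) (sort w)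
sort-positive {w} = ↭P.All-resp-↭ (↭-sym (sort-↭ w))

sorted-∷ : ∀ {x xs} → All (x ℕ.≤_) xs → Sorted xs → Sorted (x ∷ xs)
sorted-∷ []      []  = [-]
sorted-∷ (p ∷ _) xs↗ = p ∷ xs↗

sort-onesThen : ∀ j w → sort (onesThen j w) ≡ onesThen j (sort w)
sort-onesThen j w = sorted-unique (sort-↗ (onesThen j w)) (sorted j)
  (↭-trans (sort-↭ (onesThen j w)) (↭P.++⁺ˡ (replicate j 1) (↭P.map⁺ suc (↭-sym (sort-↭ w)))))
  where
  positive : ∀ j → All (1 ℕ.≤_) (onesThen j (sort w))
  positive zero    = AllP.map⁺ (All.universal (λ _ → s≤s z≤n) (sort w))
  positive (suc j) = s≤s z≤n ∷ positive j

  sorted : ∀ j → Sorted (onesThen j (sort w))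
  sorted zero    = SortedP.map⁺ ℕP.≤-totalOrder ℕP.≤-totalOrder s≤s (sort-↗ w)
  sorted (suc j) = sorted-∷ (positive j) (sorted j)

≤ᵇ-suc : ∀ x i → (suc x ≤ᵇ suc i) ≡ (x ≤ᵇ i)
≤ᵇ-suc zero    i = ≡.refl
≤ᵇ-suc (suc x) i = ≡.refl

module WordSums (A : ℚ-Algebra) where
  open ℚ-Algebra A
  open Antidiagonal A
  open SetoidReasoning setoid

  ∑< : ℕ → (ℕ → Carrier) → Carrier
  ∑< zero    h = 0#
  ∑< (suc M) h = h 0 + ∑< M (λ x → h (suc x))

  ∑<-cong : ∀ M {h k : ℕ → Carrier} → (∀ x → h x ≈ k x) → ∑< M h ≈ ∑< M k
  ∑<-cong zero    eq = refl
  ∑<-cong (suc M) eq = +-cong (eq 0) (∑<-cong M λ x → eq (suc x))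

  ∑<-*ˡ : ∀ M c (h : ℕ → Carrier) → ∑< M (λ x → c * h x) ≈ c * ∑< M h
  ∑<-*ˡ zero    c h = sym (zeroʳ c)
  ∑<-*ˡ (suc M) c h = trans (+-congˡ (∑<-*ˡ M c _)) (sym (distribˡ c _ _))

  ∑<-0 : ∀ M → ∑< M (λ _ → 0#) ≈ 0#
  ∑<-0 zero    = refl
  ∑<-0 (suc M) = trans (+-identityˡ _) (∑<-0 M)

  ∑<-∑₊ : ∀ M n (h : ℕ → ℕ → ℕ → Carrier) → ∑< M (λ x → ∑₊ n (h x)) ≈ ∑₊ n (λ i j → ∑< M (λ x → h x i j))
  ∑<-∑₊ zero    n h = sym (∑₊-0 n)
  ∑<-∑₊ (suc M) n h = trans (+-congˡ (∑<-∑₊ M n _)) (sym (∑₊-+ n _ _))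

  ∑words : ℕ → ℕ → (List ℕ → Carrier) → Carrier
  ∑words zero    M f = f []
  ∑words (suc m) M f = ∑< M (λ x → ∑words m M (λ w → f (suc x ∷ w)))

  ∑words-cong⁺ : ∀ m M {f g : List ℕ → Carrier} → (∀ w → All (1 ℕ.≤_) w → f w ≈ g w) → ∑words m M f ≈ ∑words m M g
  ∑words-cong⁺ zero    M eq = eq [] []
  ∑words-cong⁺ (suc m) M eq = ∑<-cong M λ x → ∑words-cong⁺ m M λ w p → eq (suc x ∷ w) (s≤s z≤n ∷ p)

  ∑words-cong : ∀ m M {f g : List ℕ → Carrier} → (∀ w → f w ≈ g w) → ∑words m M f ≈ ∑words m M g
  ∑words-cong m M eq = ∑words-cong⁺ m M λ w _ → eq w

  ∑words-*ˡ : ∀ m M c (f : List ℕ → Carrier) → ∑words m M (λ w → c * f w) ≈ c * ∑words m M f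
  ∑words-*ˡ zero    M c f = refl
  ∑words-*ˡ (suc m) M c f = trans (∑<-cong M λ x → ∑words-*ˡ m M c _) (∑<-*ˡ M c _)

  ∑words-0 : ∀ m M → ∑words m M (λ _ → 0#) ≈ 0#
  ∑words-0 zero    M = refl
  ∑words-0 (suc m) M = trans (∑<-cong M λ _ → ∑words-0 m M) (∑<-0 M)

  Symmetric : (List ℕ → Carrier) → Set
  Symmetric f = ∀ {v w} → v ↭ w → f v ≈ f w

  splitTerm : ℕ → (List ℕ → Carrier) → ℕ → ℕ → Carrier
  splitTerm M f j l = e j * (e l * ∑words l M (λ w → f (onesThen j w)))

  -- A word of length m is a choice of the j places of the letter 1 and a word of length l = m - j in the other letters;
  -- the normalisation e m = 1/m! absorbs the binomial coefficient.
  ∑words-split : ∀ m M {f} → Symmetric f → e m * ∑words m (suc M) f ≈ ∑₊ m (splitTerm M f)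
  ∑words-split zero    M {f} f-sym = sym (trans (*-congʳ fromℚ-1) (*-identityˡ _))
  ∑words-split (suc m) M {f} f-sym = nat-cancel m (begin
    nat (suc m) * (e (suc m) * ∑words (suc m) (suc M) f)
      ≈⟨ *-assoc _ _ _ ⟨
    nat (suc m) * e (suc m) * ∑words (suc m) (suc M) f
      ≈⟨ *-congʳ (nat-suc-*-e m) ⟩
    e m * (∑words m (suc M) (λ w → f (1 ∷ w)) + ∑< M (λ x → ∑words m (suc M) (λ w → f (suc (suc x) ∷ w))))
      ≈⟨ distribˡ _ _ _ ⟩
    e m * ∑words m (suc M) (λ w → f (1 ∷ w)) + e m * ∑< M (λ x → ∑words m (suc M) (λ w → f (suc (suc x) ∷ w)))
      ≈⟨ +-cong (∑words-split m M λ p → f-sym (prep 1 p))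
           (trans (sym (∑<-*ˡ M (e m) _)) (∑<-cong M λ x → ∑words-split m M λ p → f-sym (prep (suc (suc x)) p))) ⟩
    ∑₊ m (splitTerm M (λ w → f (1 ∷ w))) + ∑< M (λ x → ∑₊ m (splitTerm M (λ w → f (suc (suc x) ∷ w))))
      ≈⟨ +-cong (∑₊-cong m first) (trans (∑<-∑₊ M m _) (∑₊-cong m rest)) ⟩
    ∑₊ m (λ j l → nat (suc j) * splitTerm M f (suc j) l) + ∑₊ m (λ j l → nat (suc l) * splitTerm M f j (suc l))
      ≈⟨ +-cong (∑₊-natˡ m (splitTerm M f)) (∑₊-natʳ m (splitTerm M f)) ⟨
    ∑₊ (suc m) (λ j l → nat j * splitTerm M f j l) + ∑₊ (suc m) (λ j l → nat l * splitTerm M f j l)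
      ≈⟨ nat-*-∑₊ (suc m) (splitTerm M f) ⟨
    nat (suc m) * ∑₊ (suc m) (splitTerm M f) ∎)
    where
    first : ∀ j l → splitTerm M (λ w → f (1 ∷ w)) j l ≈ nat (suc j) * splitTerm M f (suc j) l
    first j l = trans (*-congʳ (sym (nat-suc-*-e j))) (*-assoc _ _ _)

    rest : ∀ j l → ∑< M (λ x → splitTerm M (λ w → f (suc (suc x) ∷ w)) j l) ≈ nat (suc l) * splitTerm M f j (suc l)
    rest j l = begin
      ∑< M (λ x → e j * (e l * ∑words l M (λ w → f (suc (suc x) ∷ onesThen j w))))
        ≈⟨ trans (∑<-*ˡ M (e j) _) (*-congˡ (∑<-*ˡ M (e l) _)) ⟩
      e j * (e l * ∑< M (λ x → ∑words l M (λ w → f (suc (suc x) ∷ onesThen j w))))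
        -- Symmetry of `f` moves the leading letter past the ones, into the word over the other
        -- letters.
        ≈⟨ *-congˡ (*-cong (sym (nat-suc-*-e l)) (∑<-cong M λ x → ∑words-cong l M λ w →
             f-sym (↭-sym (↭P.shift (suc (suc x)) (replicate j 1) (map suc w))))) ⟩
      e j * (nat (suc l) * e (suc l) * ∑words (suc l) M (λ w → f (onesThen j w)))
        ≈⟨ solve 4 (λ a b c d → a :* (b :* c :* d) := b :* (a :* (c :* d))) refl _ _ _ _ ⟩
      nat (suc l) * (e j * (e (suc l) * ∑words (suc l) M (λ w → f (onesThen j w)))) ∎

module Exponential (A : ℚ-Algebra) where
  open ℚ-Algebra A
  open Antidiagonal A
  open SetoidReasoning setoid

  1^ : ∀ t → 1# ^ t ≈ 1#
  1^ zero    = refl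
  1^ (suc t) = trans (*-identityˡ _) (1^ t)

  expo : Carrier → ℕ → Carrier
  expo x n = e n * x ^ n

  nat-suc-*-expo : ∀ x n → nat (suc n) * expo x (suc n) ≈ x * expo x n
  nat-suc-*-expo x n = begin
    nat (suc n) * (e (suc n) * (x * x ^ n))   ≈⟨ solve 4 (λ a b c d → a :* (b :* (c :* d)) := c :* ((a :* b) :* d)) refl _ _ _ _ ⟩
    x * (nat (suc n) * e (suc n) * x ^ n)     ≈⟨ *-congˡ (*-congʳ (nat-suc-*-e n)) ⟩
    x * (e n * x ^ n)                         ∎

  -- Binomial theorem for divided powers: by the Leibniz rule both sides satisfy (n + 1) f (n + 1) =
  -- (x + z) f n.
  expo-+ : ∀ x z n → ∑₊ n (λ j t → expo x j * expo z t) ≈ expo (x + z) n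
  expo-+ x z zero    = trans (*-cong (trans (*-identityʳ _) fromℚ-1) (*-identityʳ _)) (trans (*-identityˡ _) (sym (*-identityʳ _)))
  expo-+ x z (suc n) = nat-cancel n (begin
    nat (suc n) * ∑₊ (suc n) h
      ≈⟨ nat-*-∑₊ (suc n) h ⟩
    ∑₊ (suc n) (λ j t → nat j * h j t) + ∑₊ (suc n) (λ j t → nat t * h j t)
      ≈⟨ +-cong (∑₊-natˡ n h) (∑₊-natʳ n h) ⟩
    ∑₊ n (λ j t → nat (suc j) * h (suc j) t) + ∑₊ n (λ j t → nat (suc t) * h j (suc t))
      ≈⟨ +-cong (∑₊-cong n λ j t → trans (sym (*-assoc _ _ _)) (trans (*-congʳ (nat-suc-*-expo x j)) (*-assoc _ _ _)))
                (∑₊-cong n λ j t → trans (solve 3 (λ a b c → a :* (b :* c) := b :* (a :* c)) refl _ _ _)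
                  (trans (*-congˡ (nat-suc-*-expo z t)) (solve 3 (λ a b c → b :* (a :* c) := a :* (b :* c)) refl _ _ _))) ⟩
    ∑₊ n (λ j t → x * h j t) + ∑₊ n (λ j t → z * h j t)
      ≈⟨ +-cong (∑₊-*ˡ n x h) (∑₊-*ˡ n z h) ⟩
    x * ∑₊ n h + z * ∑₊ n h
      ≈⟨ distribʳ _ x z ⟨
    (x + z) * ∑₊ n h
      ≈⟨ *-congˡ (expo-+ x z n) ⟩
    (x + z) * expo (x + z) n
      ≈⟨ nat-suc-*-expo (x + z) n ⟨
    nat (suc n) * expo (x + z) (suc n) ∎)
    where
    h : ℕ → ℕ → Carrier
    h j t = expo x j * expo z t

-- Words below a staircase, counted by area

module ParkingSeries (A : ℚ-Algebra) (q : ℚ-Algebra.Carrier A) where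
  open ℚ-Algebra A
  open Antidiagonal A
  open WordSums A
  open Exponential A
  open SetoidReasoning setoid

  -- For a sorted xs: q to the area between xs and the staircase i, i + 1, …, or 0 if xs exceeds the staircase.
  staircaseWeight : ℕ → List ℕ → Carrier
  staircaseWeight i []       = 1#
  staircaseWeight i (x ∷ xs) = if x ≤ᵇ i then q ^ (i ∸ x) * staircaseWeight (suc i) xs else 0#

  weight : ℕ → List ℕ → Carrier
  weight i w = staircaseWeight i (sort w)

  weight-sym : ∀ i → Symmetric (weight i)
  weight-sym i p = reflexive (cong (staircaseWeight i) (sort-cong-↭ p))

  staircaseWeight-map-suc : ∀ i xs → staircaseWeight (suc i) (map suc xs) ≈ staircaseWeight i xs
  staircaseWeight-map-suc i []       = refl
  staircaseWeight-map-suc i (x ∷ xs) rewrite ≤ᵇ-suc x i with x ≤ᵇ i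
  ... | true  = *-congˡ (staircaseWeight-map-suc (suc i) xs)
  ... | false = refl

  -- The j ones meet the heights i + 1, ..., i + j and leave the gaps i, ..., i + j - 1, whose sum
  -- is i j + `tri j`. The other letters, lowered by one together with their heights, then face the
  -- staircase starting at i + j.
  staircaseWeight-onesThen : ∀ i j xs →
    staircaseWeight (suc i) (onesThen j xs) ≈ q ^ (i ℕ.* j ℕ.+ tri j) * staircaseWeight (i ℕ.+ j) xs
  staircaseWeight-onesThen i zero xs = trans (staircaseWeight-map-suc i xs) (trans (sym (*-identityˡ _))
    (*-cong (^-congʳ q (≡.sym (≡.trans (ℕP.+-identityʳ _) (ℕP.*-zeroʳ i))))
      (reflexive (cong (λ k → staircaseWeight k xs) (≡.sym (ℕP.+-identityʳ i))))))
  staircaseWeight-onesThen i (suc j) xs = begin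
    q ^ i * staircaseWeight (suc (suc i)) (onesThen j xs)
      ≈⟨ *-congˡ (staircaseWeight-onesThen (suc i) j xs) ⟩
    q ^ i * (q ^ (suc i ℕ.* j ℕ.+ tri j) * staircaseWeight (suc i ℕ.+ j) xs)
      ≈⟨ *-assoc _ _ _ ⟨
    q ^ i * q ^ (suc i ℕ.* j ℕ.+ tri j) * staircaseWeight (suc i ℕ.+ j) xs
      ≈⟨ *-cong (trans (sym (^-homo-* q i _)) (^-congʳ q (exponent i j (tri j))))
                (reflexive (cong (λ k → staircaseWeight k xs) (≡.sym (ℕP.+-suc i j)))) ⟩
    q ^ (i ℕ.* suc j ℕ.+ tri (suc j)) * staircaseWeight (i ℕ.+ suc j) xs ∎
    where
    exponent : ∀ i j t → i ℕ.+ (suc i ℕ.* j ℕ.+ t) ≡ i ℕ.* suc j ℕ.+ (j ℕ.+ t)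
    exponent = solve-∀

  weight-onesThen : ∀ i j w → weight (suc i) (onesThen j w) ≈ q ^ (i ℕ.* j ℕ.+ tri j) * weight (i ℕ.+ j) w
  weight-onesThen i j w = trans (reflexive (cong (staircaseWeight (suc i)) (sort-onesThen j w)))
    (staircaseWeight-onesThen i j (sort w))

  weight-0 : ∀ x {w} → All (1 ℕ.≤_) w → weight 0 (suc x ∷ w) ≈ 0#
  weight-0 x {w} p with sort (suc x ∷ w) | sort-↭ (suc x ∷ w) | sort-positive (s≤s {n = x} z≤n ∷ p)
  ... | []          | eq | _       = ⊥-elim (↭P.¬x∷xs↭[] (↭-sym eq))
  ... | (zero ∷ s)  | _  | () ∷ _
  ... | (suc a ∷ s) | _  | _       = refl

  truncated : ℕ → ℕ → ℕ → Carrier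
  truncated M i m = e m * ∑words m M (weight i)

  truncated-split : ∀ M i m →
    truncated (suc M) (suc i) m ≈ ∑₊ m (λ j l → e j * (q ^ (i ℕ.* j ℕ.+ tri j) * truncated M (i ℕ.+ j) l))
  truncated-split M i m = trans (∑words-split m M (weight-sym (suc i))) (∑₊-cong m λ j l → *-congˡ (begin
    e l * ∑words l M (λ w → weight (suc i) (onesThen j w))
      ≈⟨ *-congˡ (trans (∑words-cong l M (weight-onesThen i j)) (∑words-*ˡ l M _ _)) ⟩
    e l * (q ^ (i ℕ.* j ℕ.+ tri j) * ∑words l M (weight (i ℕ.+ j)))
      ≈⟨ solve 3 (λ a b c → a :* (b :* c) := b :* (a :* c)) refl _ _ _ ⟩
    q ^ (i ℕ.* j ℕ.+ tri j) * (e l * ∑words l M (weight (i ℕ.+ j))) ∎))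

  truncated-0 : ∀ M m → truncated M 0 (suc m) ≈ 0#
  truncated-0 M m = trans (*-congˡ (trans (∑<-cong M λ x → trans (∑words-cong⁺ m M λ w p → weight-0 x p) (∑words-0 m M)) (∑<-0 M))) (zeroʳ _)

  -- The last height is i + m - 1, so a further letter M + 1 ≥ i + m only adds words of weight zero.
  -- The induction runs through `truncated-split`, which lowers the alphabet and the bound together.
  truncated-stable : ∀ M i m → m ℕ.+ i ℕ.≤ suc M → truncated M i m ≈ truncated (suc M) i m
  truncated-stable M       i       zero    p = refl
  truncated-stable M       zero    (suc m) p = trans (truncated-0 M m) (sym (truncated-0 (suc M) m))
  truncated-stable zero    (suc i) (suc m) (s≤s p) = ⊥-elim (ℕP.<⇒≱ (ℕP.m≤n+m 1 m) (ℕP.≤-trans (ℕP.+-monoʳ-≤ m (s≤s z≤n)) p))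
  truncated-stable (suc M) (suc i) m@(suc _) p = begin
    truncated (suc M) (suc i) m         ≈⟨ truncated-split M i m ⟩
    ∑₊ m (term M)                       ≈⟨ ∑₊-cong′ m {term M} {term (suc M)} (λ j l eq → *-congˡ (*-congˡ (truncated-stable M (i ℕ.+ j) l (bound j l eq)))) ⟩
    ∑₊ m (term (suc M))                 ≈⟨ truncated-split (suc M) i m ⟨
    truncated (suc (suc M)) (suc i) m   ∎
    where
    term : ℕ → ℕ → ℕ → Carrier
    term M j l = e j * (q ^ (i ℕ.* j ℕ.+ tri j) * truncated M (i ℕ.+ j) l)

    bound : ∀ j l → j ℕ.+ l ≡ m → l ℕ.+ (i ℕ.+ j) ℕ.≤ suc M
    bound j l eq = ℕP.≤-pred (ℕP.≤-trans (ℕP.≤-reflexive (≡.trans (arith i j l) (cong (ℕ._+ suc i) eq))) p)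
      where
      arith : ∀ i j l → suc (l ℕ.+ (i ℕ.+ j)) ≡ j ℕ.+ l ℕ.+ suc i
      arith = solve-∀

  -- Letters above i + m - 1 never stay below the staircase, so M = i + m is a harmless bound.
  g : ℕ → ℕ → Carrier
  g i m = truncated (i ℕ.+ m) i m

  g-zeroʳ : ∀ i → g i 0 ≈ 1#
  g-zeroʳ i = trans (*-cong fromℚ-1 (reflexive (cong (staircaseWeight i) sort-[]))) (*-identityˡ 1#)

  g-zeroˡ : ∀ m → g 0 (suc m) ≈ 0#
  g-zeroˡ m = truncated-0 (suc m) m

  -- The bound i + m in `g` is chosen for this step: after the split the alphabet has i + m = (i +
  -- j) + l letters, exactly the one that `g (i + j) l` prescribes.
  g-split : ∀ i m → g (suc i) m ≈ ∑₊ m (λ j l → e j * (q ^ (i ℕ.* j ℕ.+ tri j) * g (i ℕ.+ j) l))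
  g-split i m = trans (truncated-split (i ℕ.+ m) i m) (∑₊-cong′ m λ j l eq → *-congˡ (*-congˡ (reflexive
    (cong (λ M → truncated M (i ℕ.+ j) l) (≡.trans (cong (i ℕ.+_) (≡.sym eq)) (≡.sym (ℕP.+-assoc i j l)))))))

  a : ℕ → Carrier
  a n = q ^ tri n * e n

  module _ (y : Carrier) (q≈1+y : q ≈ 1# + y) where

    -- Coefficientwise form of H_i(x) A(x) = A(q^i x), where A(x) = Σ q^(n(n-1)/2) x^n/n! and H_i has coefficients y^m g i m.
    g-convolution : ∀ i n → ∑₊ n (λ m r → y ^ m * g i m * a r) ≈ q ^ (i ℕ.* n) * a n
    g-convolution i n = go (i ℕ.+ n) i n ≡.refl
      where
      -- Splitting turns i + 1 into i + j, which may be larger, while n becomes t = n - j. The sum i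
      -- + n drops by one, so it carries the induction.
      go : ∀ N i n → i ℕ.+ n ≡ N → ∑₊ n (λ m r → y ^ m * g i m * a r) ≈ q ^ (i ℕ.* n) * a n
      go N zero zero eq = *-congʳ (trans (*-identityˡ _) (g-zeroʳ 0))
      go N zero (suc n) eq = begin
        y ^ 0 * g 0 0 * a (suc n) + ∑₊ n (λ m r → y ^ suc m * g 0 (suc m) * a r)
          ≈⟨ +-cong (*-congʳ (trans (*-identityˡ _) (g-zeroʳ 0)))
               (trans (∑₊-cong n λ m r → trans (*-congʳ (trans (*-congˡ (g-zeroˡ m)) (zeroʳ _))) (zeroˡ _)) (∑₊-0 n)) ⟩
        1# * a (suc n) + 0#
          ≈⟨ +-identityʳ _ ⟩
        1# * a (suc n) ∎
      go (suc N) (suc i) n eq = begin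
        ∑₊ n (λ m r → y ^ m * g (suc i) m * a r)
          ≈⟨ ∑₊-cong n (λ m r → expand m r) ⟩
        ∑₊ n (λ m r → ∑₊ m (λ j l → e j * y ^ j * q ^ (i ℕ.* j ℕ.+ tri j) * (y ^ l * g (i ℕ.+ j) l * a r)))
          ≈⟨ ∑₊-assoc n (λ j l r → e j * y ^ j * q ^ (i ℕ.* j ℕ.+ tri j) * (y ^ l * g (i ℕ.+ j) l * a r)) ⟩
        ∑₊ n (λ j t → ∑₊ t (λ l r → e j * y ^ j * q ^ (i ℕ.* j ℕ.+ tri j) * (y ^ l * g (i ℕ.+ j) l * a r)))
          ≈⟨ ∑₊-cong′ n (λ j t j+t≡n → trans (∑₊-*ˡ t _ _) (contract j t j+t≡n)) ⟩
        ∑₊ n (λ j t → q ^ (i ℕ.* n ℕ.+ tri n) * (expo y j * expo 1# t))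
          ≈⟨ ∑₊-*ˡ n _ _ ⟩
        -- Here q and y are linked: the sum is (y + 1)^n / n! = q^n / n!, and the new factor q^n
        -- raises q^(i n) to q^((i + 1) n).
        q ^ (i ℕ.* n ℕ.+ tri n) * ∑₊ n (λ j t → expo y j * expo 1# t)
          ≈⟨ *-cong (^-homo-* q (i ℕ.* n) (tri n)) (trans (expo-+ y 1# n) (*-congˡ (^-congˡ n (trans (+-comm _ _) (sym q≈1+y))))) ⟩
        q ^ (i ℕ.* n) * q ^ tri n * (e n * q ^ n)
          ≈⟨ solve 4 (λ b c d f → b :* c :* (d :* f) := f :* b :* (c :* d)) refl _ _ _ _ ⟩
        q ^ n * q ^ (i ℕ.* n) * a n
          ≈⟨ *-congʳ (sym (^-homo-* q n (i ℕ.* n))) ⟩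
        q ^ (suc i ℕ.* n) * a n ∎
        where
        expand : ∀ m r → y ^ m * g (suc i) m * a r ≈
          ∑₊ m (λ j l → e j * y ^ j * q ^ (i ℕ.* j ℕ.+ tri j) * (y ^ l * g (i ℕ.+ j) l * a r))
        expand m r = begin
          y ^ m * g (suc i) m * a r
            ≈⟨ *-congʳ (trans (*-congˡ (g-split i m)) (sym (∑₊-*ˡ m _ _))) ⟩
          ∑₊ m (λ j l → y ^ m * (e j * (q ^ (i ℕ.* j ℕ.+ tri j) * g (i ℕ.+ j) l))) * a r
            ≈⟨ ∑₊-*ʳ m (a r) _ ⟨
          ∑₊ m (λ j l → y ^ m * (e j * (q ^ (i ℕ.* j ℕ.+ tri j) * g (i ℕ.+ j) l)) * a r)
            ≈⟨ ∑₊-cong′ m (λ j l j+l≡m → trans (*-congʳ (*-congʳ (trans (^-congʳ y (≡.sym j+l≡m)) (^-homo-* y j l))))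
                 (solve 6 (λ b c d f h k → b :* c :* (d :* (f :* h)) :* k := d :* b :* f :* (c :* h :* k)) refl _ _ _ _ _ _)) ⟩
          ∑₊ m (λ j l → e j * y ^ j * q ^ (i ℕ.* j ℕ.+ tri j) * (y ^ l * g (i ℕ.+ j) l * a r)) ∎

        contract : ∀ j t → j ℕ.+ t ≡ n →
          e j * y ^ j * q ^ (i ℕ.* j ℕ.+ tri j) * ∑₊ t (λ l r → y ^ l * g (i ℕ.+ j) l * a r) ≈
          q ^ (i ℕ.* n ℕ.+ tri n) * (expo y j * expo 1# t)
        contract j t ≡.refl = begin
          e j * y ^ j * q ^ (i ℕ.* j ℕ.+ tri j) * ∑₊ t (λ l r → y ^ l * g (i ℕ.+ j) l * a r)
            ≈⟨ *-congˡ (go N (i ℕ.+ j) t (≡.trans (ℕP.+-assoc i j t) (ℕP.suc-injective eq))) ⟩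
          e j * y ^ j * q ^ (i ℕ.* j ℕ.+ tri j) * (q ^ ((i ℕ.+ j) ℕ.* t) * (q ^ tri t * e t))
            ≈⟨ solve 6 (λ b c d f h k → b :* c :* d :* (f :* (h :* k)) := d :* (f :* h) :* (b :* c :* k)) refl _ _ _ _ _ _ ⟩
          q ^ (i ℕ.* j ℕ.+ tri j) * (q ^ ((i ℕ.+ j) ℕ.* t) * q ^ tri t) * (expo y j * e t)
            ≈⟨ *-cong (trans (*-congˡ (sym (^-homo-* q ((i ℕ.+ j) ℕ.* t) (tri t)))) (trans (sym (^-homo-* q (i ℕ.* j ℕ.+ tri j) _))
                 (^-congʳ q (≡.trans (exponent i j t (tri j) (tri t)) (cong (i ℕ.* (j ℕ.+ t) ℕ.+_) (≡.sym (tri-+ j t)))))))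
                 (*-congˡ (sym (trans (*-congˡ (1^ t)) (*-identityʳ _)))) ⟩
          q ^ (i ℕ.* (j ℕ.+ t) ℕ.+ tri (j ℕ.+ t)) * (expo y j * expo 1# t) ∎
          where
          exponent : ∀ i j t b c → i ℕ.* j ℕ.+ b ℕ.+ ((i ℕ.+ j) ℕ.* t ℕ.+ c) ≡ i ℕ.* (j ℕ.+ t) ℕ.+ (b ℕ.+ c ℕ.+ j ℕ.* t)
          exponent = solve-∀

-- Derivations

record Derivation (A : ℚ-Algebra) : Set where
  open ℚ-Algebra A
  field
    D        : Carrier → Carrier
    D-cong   : ∀ {x y} → x ≈ y → D x ≈ D y
    D-+      : ∀ x y → D (x + y) ≈ D x + D y
    D-*      : ∀ x y → D (x * y) ≈ D x * y + x * D y
    D-fromℚ  : ∀ c → D (fromℚ c) ≈ 0#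

  D-scale : ∀ c x → D (fromℚ c * x) ≈ fromℚ c * D x
  D-scale c x = trans (D-* _ x) (trans (+-congʳ (trans (*-congʳ (D-fromℚ c)) (zeroˡ x))) (+-identityˡ _))

  D-neg : ∀ x → D (- x) ≈ - D x
  D-neg x = trans (D-cong (solve 1 (λ a → :- a := con (ℚ.- 1ℚ) :* a) refl x))
    (trans (D-scale (ℚ.- 1ℚ) x) (solve 1 (λ a → con (ℚ.- 1ℚ) :* a := :- a) refl (D x)))

  D-− : ∀ x y → D (x - y) ≈ D x - D y
  D-− x y = trans (D-+ x (- y)) (+-congˡ (D-neg y))

  D-1 : D 1# ≈ 0#
  D-1 = trans (D-cong (sym fromℚ-1)) (D-fromℚ 1ℚ)

  -- The logarithmic derivative `l` keeps the exponent n in place of n - 1. It is used with `l`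
  -- equal to y, to q and to X² - X.
  D-^ : ∀ {x l} → D x ≈ l * x → ∀ n → D (x ^ n) ≈ nat n * (l * x ^ n)
  D-^ {x} {l} eq zero    = trans D-1 (sym (trans (*-congʳ fromℚ-0) (zeroˡ _)))
  D-^ {x} {l} eq (suc n) = begin
    D (x * x ^ n)                              ≈⟨ D-* x (x ^ n) ⟩
    D x * x ^ n + x * D (x ^ n)                ≈⟨ +-cong (*-congʳ eq) (*-congˡ (D-^ eq n)) ⟩
    l * x * x ^ n + x * (nat n * (l * x ^ n))  ≈⟨ solve 4 (λ a b c d → a :* b :* c :+ b :* (d :* (a :* c)) := (con 1ℚ :+ d) :* (a :* (b :* c))) refl l x (x ^ n) (nat n) ⟩
    (fromℚ 1ℚ + nat n) * (l * (x * x ^ n))     ≈⟨ *-congʳ (nat-+ 1 n) ⟨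
    nat (suc n) * (l * (x * x ^ n))            ∎
    where open SetoidReasoning setoid

  scaled : Carrier → Derivation A
  scaled c = record
    { D       = λ x → c * D x
    ; D-cong  = λ p → *-congˡ (D-cong p)
    ; D-+     = λ x y → trans (*-congˡ (D-+ x y)) (distribˡ c _ _)
    ; D-*     = λ x y → trans (*-congˡ (D-* x y))
                  (solve 5 (λ c x y x′ y′ → c :* (x′ :* y :+ x :* y′) := c :* x′ :* y :+ x :* (c :* y′)) refl c x y (D x) (D y))
    ; D-fromℚ = λ r → trans (*-congˡ (D-fromℚ r)) (zeroʳ c)
    }

module SeriesOperators (A : ℚ-Algebra) where
  private module A = ℚ-Algebra A
  open Antidiagonal A
  open PowerSeries A using (Series; const; const-*; seriesAlgebra)
  open ℚ-Algebra seriesAlgebra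
  open SetoidReasoning A.setoid

  var : Series
  var zero    = A.0#
  var (suc n) = const A.1# n

  var-*-zero : ∀ f → (var * f) 0 A.≈ A.0#
  var-*-zero f = A.zeroˡ (f 0)

  var-*-suc : ∀ f n → (var * f) (suc n) A.≈ f n
  var-*-suc f n = A.trans (A.+-congʳ (A.zeroˡ _)) (A.trans (A.+-identityˡ _)
    (A.trans (const-* A.1# f n) (A.*-identityˡ _)))

  var-cancel : ∀ {f g} → var * f ≈ var * g → f ≈ g
  var-cancel {f} {g} eq n = A.trans (A.sym (var-*-suc f n)) (A.trans (eq (suc n)) (var-*-suc g n))

  -- The variable is not a zero divisor. Applied to y, this removes the factors (q - 1)^n although q
  -- - 1 is not invertible.
  var^-cancel : ∀ n {f g} → var ^ n * f ≈ var ^ n * g → f ≈ g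
  var^-cancel zero    {f} {g} eq = trans (sym (*-identityˡ f)) (trans eq (*-identityˡ g))
  var^-cancel (suc n) {f} {g} eq = var^-cancel n (var-cancel
    (trans (sym (*-assoc var (var ^ n) f)) (trans eq (*-assoc var (var ^ n) g))))

  fromℚ-*-coeff : ∀ c f n → (fromℚ c * f) n A.≈ A.fromℚ c A.* f n
  fromℚ-*-coeff c f n = const-* (A.fromℚ c) f n

  -- A unit constant term makes the system triangular: coefficient n of the product fixes `f n` once
  -- the lower ones agree. This stands in for division by A(x).
  cancelˡ : ∀ {a f g} → a 0 A.≈ A.1# → a * f ≈ a * g → f ≈ g
  cancelˡ {a} {f} {g} a₀≈1 eq n = upTo n n ℕP.≤-refl
    where
    extract : ∀ n d → a 0 A.* f n A.+ d A.≈ a 0 A.* g n A.+ d → f n A.≈ g n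
    extract n d p = begin
      f n                                          ≈⟨ A.solve 2 (λ x d → x A.:= A.con 1ℚ A.:* x A.:+ d A.:- d) A.refl (f n) d ⟩
      A.fromℚ 1ℚ A.* f n A.+ d A.- d               ≈⟨ A.+-congʳ (A.+-congʳ (A.*-congʳ 1≈a₀)) ⟩
      a 0 A.* f n A.+ d A.- d                      ≈⟨ A.+-congʳ p ⟩
      a 0 A.* g n A.+ d A.- d                      ≈⟨ A.+-congʳ (A.+-congʳ (A.*-congʳ 1≈a₀)) ⟨
      A.fromℚ 1ℚ A.* g n A.+ d A.- d               ≈⟨ A.solve 2 (λ x d → x A.:= A.con 1ℚ A.:* x A.:+ d A.:- d) A.refl (g n) d ⟨
      g n                                          ∎
      where
      1≈a₀ : A.fromℚ 1ℚ A.≈ a 0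
      1≈a₀ = A.trans A.fromℚ-1 (A.sym a₀≈1)

    upTo : ∀ n j → j ℕ.≤ n → f j A.≈ g j
    upTo zero    zero    _ = extract 0 A.0# (A.+-congʳ (eq 0))
    upTo (suc n) j p with ℕP.m≤n⇒m<n∨m≡n p
    ... | inj₁ (s≤s q) = upTo n j q
    ... | inj₂ ≡.refl  = extract (suc n) _ (A.trans (eq (suc n))
          (A.+-congˡ (∑₊-cong′ n λ i j p → A.*-congˡ (A.sym (upTo n j (ℕP.≤-trans (ℕP.m≤n+m j i) (ℕP.≤-reflexive p)))))))

  θ-derivation : Derivation seriesAlgebra
  θ-derivation = record
    { D       = λ f n → A.nat n A.* f n
    ; D-cong  = λ p n → A.*-congˡ (p n)
    ; D-+     = λ f g n → A.distribˡ _ _ _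
    ; D-*     = λ f g n → A.trans (nat-*-∑₊ n _) (A.+-cong
                  (∑₊-cong n λ i j → A.sym (A.*-assoc _ _ _))
                  (∑₊-cong n λ i j → A.solve 3 (λ a b c → a A.:* (b A.:* c) A.:= b A.:* (a A.:* c)) A.refl _ _ _))
    ; D-fromℚ = λ c → λ { zero → nat-0-* _ ; (suc n) → A.zeroʳ _ }
    }

  open Derivation θ-derivation public using ()
    renaming (D to θ; D-cong to θ-cong; D-+ to θ-+; D-* to θ-*; D-− to θ-−)

  θ-const : ∀ c → θ (const c) ≈ 0#
  θ-const c zero    = nat-0-* c
  θ-const c (suc n) = A.zeroʳ _

  θ-var : θ var ≈ var
  θ-var zero          = nat-0-* _
  θ-var (suc zero)    = A.trans (A.*-congʳ A.fromℚ-1) (A.*-identityˡ _)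
  θ-var (suc (suc n)) = A.zeroʳ _

  pointwise : Derivation A → Derivation seriesAlgebra
  pointwise d = record
    { D       = λ f n → D (f n)
    ; D-cong  = λ p n → D-cong (p n)
    ; D-+     = λ f g n → D-+ (f n) (g n)
    ; D-*     = λ f g n → A.trans (D-∑₊ n _) (A.trans (∑₊-cong n λ i j → D-* (f i) (g j)) (∑₊-+ n _ _))
    ; D-fromℚ = λ c → λ { zero → D-fromℚ c ; (suc n) → A.trans (D-cong (A.sym A.fromℚ-0)) (D-fromℚ 0ℚ) }
    }
    where
    open Derivation d
    D-∑₊ : ∀ n (h : ℕ → ℕ → A.Carrier) → D (∑₊ n h) A.≈ ∑₊ n (λ i j → D (h i j))
    D-∑₊ zero    h = A.refl
    D-∑₊ (suc n) h = A.trans (D-+ _ _) (A.+-congˡ (D-∑₊ n _))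

-- The Cole-Hopf transformation.
module LogarithmicDerivative (A : ℚ-Algebra) (θ δ : Derivation A) where
  open ℚ-Algebra A
  private
    module θ = Derivation θ
    module δ = Derivation δ
  open SetoidReasoning setoid

  burgers : ∀ {a u c} →
    (∀ {f g} → a * f ≈ a * g → f ≈ g) →
    (∀ f → δ.D (θ.D f) ≈ θ.D (δ.D f)) →
    θ.D c ≈ 0# →
    u * a ≈ θ.D a →
    δ.D a ≈ c * (fromℚ ½ * (θ.D (θ.D a) - θ.D a)) →
    δ.D u ≈ c * (fromℚ ½ * θ.D (θ.D u + u * u - u))
  burgers {a} {u} {c} cancel δθ θc≈0 ua≈θa heat = cancel (begin
    a * δ.D u
      ≈⟨ solve 4 (λ a u u′ b → a :* u′ := u′ :* a :+ u :* (b :* a) :- u :* b :* a) refl a u (δ.D u) b ⟩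
    δ.D u * a + u * (b * a) - u * b * a
      ≈⟨ +-congʳ (begin
           δ.D u * a + u * (b * a)   ≈⟨ +-congˡ (*-congˡ δa≈ba) ⟨
           δ.D u * a + u * δ.D a     ≈⟨ δ.D-* u a ⟨
           δ.D (u * a)               ≈⟨ δ.D-cong ua≈θa ⟩
           δ.D (θ.D a)               ≈⟨ δθ a ⟩
           θ.D (δ.D a)               ≈⟨ θ.D-cong δa≈ba ⟩
           θ.D (b * a)               ≈⟨ θ.D-* b a ⟩
           θ.D b * a + b * θ.D a     ≈⟨ +-cong (*-congʳ θb) (*-congˡ (sym ua≈θa)) ⟩
           c * (fromℚ ½ * θ.D w) * a + b * (u * a) ∎) ⟩
    c * (fromℚ ½ * θ.D w) * a + b * (u * a) - u * b * a
      ≈⟨ solve 4 (λ a u x b → x :* a :+ b :* (u :* a) :- u :* b :* a := a :* x) refl a u (c * (fromℚ ½ * θ.D w)) b ⟩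
    a * (c * (fromℚ ½ * θ.D w)) ∎)
    where
    w b : Carrier
    w = θ.D u + u * u - u
    b = c * (fromℚ ½ * w)

    θθa : θ.D (θ.D a) ≈ θ.D u * a + u * (u * a)
    θθa = trans (θ.D-cong (sym ua≈θa)) (trans (θ.D-* u a) (+-congˡ (*-congˡ (sym ua≈θa))))

    δa≈ba : δ.D a ≈ b * a
    δa≈ba = trans heat (trans (*-congˡ (*-congˡ (+-cong θθa (-‿cong (sym ua≈θa)))))
      (solve 4 (λ c u u′ a → c :* (con ½ :* (u′ :* a :+ u :* (u :* a) :- u :* a)) := c :* (con ½ :* (u′ :+ u :* u :- u)) :* a)
        refl c u (θ.D u) a))

    θb : θ.D b ≈ c * (fromℚ ½ * θ.D w)
    θb = trans (θ.D-* c _) (trans (+-cong (trans (*-congʳ θc≈0) (zeroˡ _)) (*-congˡ (θ.D-scale ½ w))) (+-identityˡ _))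

-- Wright's recurrence

tri-double : ∀ n → tri n ℕ.+ tri n ℕ.+ n ≡ n ℕ.* n
tri-double zero    = ≡.refl
tri-double (suc n) = ≡.trans (lemma n (tri n)) (≡.trans (cong (λ k → suc (n ℕ.+ n ℕ.+ k)) (tri-double n)) (lemma′ n))
  where
  lemma : ∀ n t → n ℕ.+ t ℕ.+ (n ℕ.+ t) ℕ.+ suc n ≡ suc (n ℕ.+ n ℕ.+ (t ℕ.+ t ℕ.+ n))
  lemma = solve-∀
  lemma′ : ∀ n → suc (n ℕ.+ n ℕ.+ n ℕ.* n) ≡ suc n ℕ.* suc n
  lemma′ = solve-∀

module ParkingArea (A : ℚ-Algebra) where
  private
    module A = ℚ-Algebra A
    module PA = PowerSeries A
    module OA = SeriesOperators A
    module ∑A = Antidiagonal A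

    R : ℚ-Algebra
    R = PA.seriesAlgebra
    module R = ℚ-Algebra R
    module PR = PowerSeries R
    module OR = SeriesOperators R
    module ∑R = Antidiagonal R

    S : ℚ-Algebra
    S = PR.seriesAlgebra
    module S = ℚ-Algebra S

  y q : R.Carrier
  y = OA.var
  q = R.1# R.+ y

  open ParkingSeries R q public using (g; g-split; g-zeroʳ; g-zeroˡ; g-convolution; a)

  -- The vector field q y ∂/∂y. The scaling by q makes both y and q eigenvectors up to a factor, δy
  -- = q y and δq = y q, so that powers of either are differentiated by `D-^`.
  δ : Derivation R
  δ = Derivation.scaled OA.θ-derivation q

  private
    module δ = Derivation δ
    module δ̂ = Derivation (OR.pointwise δ)

  δy : δ.D y R.≈ q R.* y
  δy = R.*-congˡ OA.θ-var

  δq : δ.D q R.≈ y R.* q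
  δq = R.trans (R.*-congˡ (R.trans (OA.θ-+ R.1# y) (R.+-cong (Derivation.D-1 OA.θ-derivation) OA.θ-var)))
    (R.trans (R.*-congˡ (R.+-identityˡ y)) (R.*-comm q y))

  δa : ∀ n → δ.D (a n) R.≈ y R.* (R.fromℚ ½ R.* (R.nat n R.* (R.nat n R.* a n) R.- R.nat n R.* a n))
  δa n = begin
    δ.D (q R.^ tri n R.* R.e n)
      ≈⟨ R.trans (δ.D-cong (R.*-comm _ _)) (R.trans (δ.D-scale _ _) (R.*-congˡ (δ.D-^ δq (tri n)))) ⟩
    R.e n R.* (R.nat (tri n) R.* (y R.* q R.^ tri n))
      ≈⟨ R.solve 4 (λ e t y p → e R.:* (t R.:* (y R.:* p)) R.:= y R.:* (R.con ½ R.:* ((t R.:+ t) R.:* (p R.:* e)))) R.refl _ _ _ _ ⟩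
    y R.* (R.fromℚ ½ R.* ((R.nat (tri n) R.+ R.nat (tri n)) R.* a n))
      ≈⟨ R.*-congˡ (R.*-congˡ (R.trans (R.solve 3 (λ t k p → (t R.:+ t) R.:* p R.:= (t R.:+ t R.:+ k) R.:* p R.:- k R.:* p) R.refl _ (R.nat n) _)
           (R.+-congʳ (R.trans (R.*-congʳ nat-tri) (R.*-assoc _ _ _))))) ⟩
    y R.* (R.fromℚ ½ R.* (R.nat n R.* (R.nat n R.* a n) R.- R.nat n R.* a n)) ∎
    where
    open SetoidReasoning R.setoid
    nat-tri : R.nat (tri n) R.+ R.nat (tri n) R.+ R.nat n R.≈ R.nat n R.* R.nat n
    nat-tri = begin
      R.nat (tri n) R.+ R.nat (tri n) R.+ R.nat n   ≈⟨ R.trans (R.nat-+ (tri n ℕ.+ tri n) n) (R.+-congʳ (R.nat-+ (tri n) (tri n))) ⟨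
      R.nat (tri n ℕ.+ tri n ℕ.+ n)                 ≈⟨ R.fromℚ-cong (cong ι (tri-double n)) ⟩
      R.nat (n ℕ.* n)                               ≈⟨ R.trans (R.fromℚ-cong (ι-* n n)) (R.fromℚ-* _ _) ⟩
      R.nat n R.* R.nat n                           ∎

  a-0 : a 0 R.≈ R.1#
  a-0 = R.trans (R.*-identityˡ _) R.fromℚ-1

  u v : S.Carrier
  u zero    = R.0#
  u (suc n) = y R.^ n R.* g 1 n
  v zero    = R.0#
  v (suc n) = g 1 n

  -- The derivative of A(x) is A(q x), hence θA/A = x A(q x)/A(x). This is the quotient of
  -- `g-convolution` for i = 1, shifted by one power of x.
  ua≈θa : u S.* a S.≈ OR.θ a
  ua≈θa zero    = R.trans (R.zeroˡ _) (R.sym (∑R.nat-0-* _))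
  ua≈θa (suc n) = begin
    R.0# R.* a (suc n) R.+ ∑R.∑₊ n (λ m r → y R.^ m R.* g 1 m R.* a r)
      ≈⟨ R.trans (R.+-congʳ (R.zeroˡ _)) (R.+-identityˡ _) ⟩
    ∑R.∑₊ n (λ m r → y R.^ m R.* g 1 m R.* a r)
      ≈⟨ g-convolution y R.refl 1 n ⟩
    q R.^ (1 ℕ.* n) R.* (q R.^ tri n R.* R.e n)
      ≈⟨ R.*-cong (R.^-congʳ q (ℕP.*-identityˡ n)) (R.*-congˡ (R.sym (R.nat-suc-*-e n))) ⟩
    q R.^ n R.* (q R.^ tri n R.* (R.nat (suc n) R.* R.e (suc n)))
      ≈⟨ R.solve 4 (λ a b c d → a R.:* (b R.:* (c R.:* d)) R.:= c R.:* (a R.:* b R.:* d)) R.refl _ _ _ _ ⟩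
    R.nat (suc n) R.* (q R.^ n R.* q R.^ tri n R.* R.e (suc n))
      ≈⟨ R.*-congˡ (R.*-congʳ (R.^-homo-* q n (tri n))) ⟨
    R.nat (suc n) R.* a (suc n) ∎
    where open SetoidReasoning R.setoid

  heat : δ̂.D a S.≈ PR.const y S.* (S.fromℚ ½ S.* (OR.θ (OR.θ a) S.- OR.θ a))
  heat n = R.trans (δa n) (R.sym (R.trans (PR.const-* y _ n) (R.*-congˡ (OR.fromℚ-*-coeff ½ _ n))))

  u-burgers : ∀ n → δ.D (u n) R.≈ y R.* (R.fromℚ ½ R.* (R.nat n R.* (R.nat n R.* u n R.+ (u S.* u) n R.- u n)))
  u-burgers n = R.trans
    (LogarithmicDerivative.burgers S OR.θ-derivation (OR.pointwise δ) {a = a} {u = u} {c = PR.const y}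
      (λ {f} {g} → OR.cancelˡ {a} {f} {g} a-0)
      (λ f n → δ.D-scale (ι n) (f n))
      (OR.θ-const y) ua≈θa heat n)
    (R.trans (PR.const-* y _ n) (R.*-congˡ (OR.fromℚ-*-coeff ½ _ n)))

  -- In degree n the series `u` is y^(n - 1) times `v`. The extra factor y keeps the exponent
  -- natural and includes n = 0.
  y*u : ∀ n → y R.* u n R.≈ y R.^ n R.* v n
  y*u zero    = R.trans (R.zeroʳ _) (R.sym (R.zeroʳ _))
  y*u (suc n) = R.sym (R.*-assoc _ _ _)

  y*y*uu : ∀ n → y R.* y R.* (u S.* u) n R.≈ y R.^ n R.* (v S.* v) n
  y*y*uu n = R.trans (R.sym (∑R.∑₊-*ˡ n _ _)) (R.trans (∑R.∑₊-cong′ n λ i j i+j≡n → begin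
    y R.* y R.* (u i R.* u j)                       ≈⟨ R.solve 3 (λ y a b → y R.:* y R.:* (a R.:* b) R.:= y R.:* a R.:* (y R.:* b)) R.refl _ _ _ ⟩
    y R.* u i R.* (y R.* u j)                       ≈⟨ R.*-cong (y*u i) (y*u j) ⟩
    y R.^ i R.* v i R.* (y R.^ j R.* v j)           ≈⟨ R.solve 4 (λ a b c d → a R.:* b R.:* (c R.:* d) R.:= a R.:* c R.:* (b R.:* d)) R.refl _ _ _ _ ⟩
    y R.^ i R.* y R.^ j R.* (v i R.* v j)           ≈⟨ R.*-congʳ (R.trans (R.sym (R.^-homo-* y i j)) (R.^-congʳ y i+j≡n)) ⟩
    y R.^ n R.* (v i R.* v j)                       ∎) (∑R.∑₊-*ˡ n _ _))
    where open SetoidReasoning R.setoid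

  -- Multiplied by y, every term of the Burgers equation in degree n contains y^n. Differentiating
  -- y^n along δ yields the additional term n q v, and after cancelling y^n the equation can be
  -- expanded at y = 0.
  v-burgers : ∀ n →
    q R.* (R.nat n R.* v n R.+ OA.θ (v n) R.- v n) R.≈
    R.fromℚ ½ R.* (R.nat n R.* (y R.* (R.nat n R.* v n) R.+ (v S.* v) n R.- y R.* v n))
  v-burgers n = OA.var^-cancel n (begin
    y R.^ n R.* (q R.* (R.nat n R.* v n R.+ OA.θ (v n) R.- v n))
      ≈⟨ R.solve 5 (λ p q k v v′ → p R.:* (q R.:* (k R.:* v R.:+ v′ R.:- v)) R.:= k R.:* (q R.:* p) R.:* v R.:+ p R.:* (q R.:* v′) R.:- q R.:* (p R.:* v))
           R.refl (y R.^ n) q (R.nat n) (v n) (OA.θ (v n)) ⟩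
    R.nat n R.* (q R.* y R.^ n) R.* v n R.+ y R.^ n R.* δ.D (v n) R.- q R.* (y R.^ n R.* v n)
      ≈⟨ R.+-cong (R.trans (R.+-congʳ (R.*-congʳ (R.sym (δ.D-^ δy n)))) (R.sym (δ.D-* _ _))) (R.-‿cong (R.*-congˡ (R.sym (y*u n)))) ⟩
    δ.D (y R.^ n R.* v n) R.- q R.* (y R.* u n)
      ≈⟨ R.+-congʳ (R.trans (δ.D-cong (R.sym (y*u n))) (R.trans (δ.D-* y (u n)) (R.+-congʳ (R.*-congʳ δy)))) ⟩
    q R.* y R.* u n R.+ y R.* δ.D (u n) R.- q R.* (y R.* u n)
      ≈⟨ R.solve 4 (λ q y u u′ → q R.:* y R.:* u R.:+ y R.:* u′ R.:- q R.:* (y R.:* u) R.:= y R.:* u′) R.refl q y (u n) (δ.D (u n)) ⟩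
    y R.* δ.D (u n)
      ≈⟨ R.*-congˡ (u-burgers n) ⟩
    y R.* (y R.* (R.fromℚ ½ R.* (R.nat n R.* (R.nat n R.* u n R.+ (u S.* u) n R.- u n))))
      ≈⟨ R.solve 4 (λ y k u w → y R.:* (y R.:* (R.con ½ R.:* (k R.:* (k R.:* u R.:+ w R.:- u)))) R.:=
                                R.con ½ R.:* (k R.:* (k R.:* y R.:* (y R.:* u) R.:+ y R.:* y R.:* w R.:- y R.:* (y R.:* u))))
           R.refl y (R.nat n) (u n) ((u S.* u) n) ⟩
    R.fromℚ ½ R.* (R.nat n R.* (R.nat n R.* y R.* (y R.* u n) R.+ y R.* y R.* (u S.* u) n R.- y R.* (y R.* u n)))
      ≈⟨ R.*-congˡ (R.*-congˡ (R.+-cong (R.+-cong (R.*-congˡ (y*u n)) (y*y*uu n)) (R.-‿cong (R.*-congˡ (y*u n))))) ⟩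
    R.fromℚ ½ R.* (R.nat n R.* (R.nat n R.* y R.* (y R.^ n R.* v n) R.+ y R.^ n R.* (v S.* v) n R.- y R.* (y R.^ n R.* v n)))
      ≈⟨ R.solve 5 (λ y k p v w → R.con ½ R.:* (k R.:* (k R.:* y R.:* (p R.:* v) R.:+ p R.:* w R.:- y R.:* (p R.:* v))) R.:=
                                  p R.:* (R.con ½ R.:* (k R.:* (y R.:* (k R.:* v) R.:+ w R.:- y R.:* v))))
           R.refl y (R.nat n) (y R.^ n) (v n) ((v S.* v) n) ⟩
    y R.^ n R.* (R.fromℚ ½ R.* (R.nat n R.* (y R.* (R.nat n R.* v n) R.+ (v S.* v) n R.- y R.* v n))) ∎)
    where open SetoidReasoning R.setoid

  V : ℕ → R.Carrier
  V k n = v n k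

  ∑₊-coeff : ∀ n (h : ℕ → ℕ → R.Carrier) k → ∑R.∑₊ n h k A.≈ ∑A.∑₊ n (λ i j → h i j k)
  ∑₊-coeff zero    h k = A.refl
  ∑₊-coeff (suc n) h k = A.+-congˡ (∑₊-coeff n _ k)

  -- n! V k (n + 1) sums the binomial coefficients (area choose k) over the parking functions of length n; it also counts
  -- the connected graphs with n + 1 vertices and n + k edges, and this is Wright's recurrence for them.
  wright : ∀ k n →
    (A.nat n A.* V (suc k) n A.+ A.nat (suc k) A.* V (suc k) n A.- V (suc k) n)
      A.+ (A.nat n A.* V k n A.+ A.nat k A.* V k n A.- V k n) A.≈
    A.fromℚ ½ A.* (A.nat n A.* (A.nat n A.* V k n A.+ ∑A.∑₊ (suc k) (λ b c → (V b R.* V c) n) A.- V k n))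
  wright k n = begin
    F (suc k) A.+ F k
      ≈⟨ A.+-cong (F≈ (suc k)) (A.trans (F≈ k) (A.sym (OA.var-*-suc F′ k))) ⟩
    F′ (suc k) A.+ (y R.* F′) (suc k)
      ≈⟨ A.+-congʳ (R.*-identityˡ F′ (suc k)) ⟨
    -- The factor q = 1 + y on the left of `v-burgers` couples the coefficients of y^(k + 1) and
    -- y^k.
    (R.1# R.* F′ R.+ y R.* F′) (suc k)
      ≈⟨ R.trans (R.sym (R.distribʳ F′ R.1# y)) (v-burgers n) (suc k) ⟩
    (R.fromℚ ½ R.* (R.nat n R.* (y R.* (R.nat n R.* v n) R.+ (v S.* v) n R.- y R.* v n))) (suc k)
      ≈⟨ A.trans (OA.fromℚ-*-coeff ½ _ (suc k)) (A.*-congˡ (OA.fromℚ-*-coeff (ι n) _ (suc k))) ⟩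
    A.fromℚ ½ A.* (A.nat n A.* ((y R.* (R.nat n R.* v n)) (suc k) A.+ (v S.* v) n (suc k) A.- (y R.* v n) (suc k)))
      ≈⟨ A.*-congˡ (A.*-congˡ (A.+-cong (A.+-cong
           (A.trans (OA.var-*-suc (R.nat n R.* v n) k) (OA.fromℚ-*-coeff (ι n) (v n) k))
           (A.trans (∑₊-coeff n (λ i j → v i R.* v j) (suc k)) (∑A.∑₊-comm n (suc k) (λ i j b c → v i b A.* v j c))))
           (A.-‿cong (OA.var-*-suc (v n) k)))) ⟩
    A.fromℚ ½ A.* (A.nat n A.* (A.nat n A.* V k n A.+ ∑A.∑₊ (suc k) (λ b c → (V b R.* V c) n) A.- V k n)) ∎
    where
    open SetoidReasoning A.setoid
    F F′ : R.Carrier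
    F k = A.nat n A.* V k n A.+ A.nat k A.* V k n A.- V k n
    F′ = R.nat n R.* v n R.+ OA.θ (v n) R.- v n

    F≈ : ∀ k → F k A.≈ F′ k
    F≈ k = A.+-congʳ (A.+-congʳ (A.sym (OA.fromℚ-*-coeff (ι n) (v n) k)))

  -- The specialisation q = 1: n! `K i n` is the number of words of length n whose sorted form stays
  -- below the staircase i, i + 1, ... .
  K : ℕ → R.Carrier
  K i n = g i n 0

  private
    H : ℕ → S.Carrier
    H i m = y R.^ m R.* g i m

    τ : ℕ → S.Carrier → S.Carrier
    τ i f n = q R.^ (i ℕ.* n) R.* f n

    τ-cong : ∀ i {f f′} → f S.≈ f′ → τ i f S.≈ τ i f′
    τ-cong i eq n = R.*-congˡ (eq n)

    τ-* : ∀ i f f′ → τ i (f S.* f′) S.≈ τ i f S.* τ i f′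
    τ-* i f f′ n = R.trans (R.sym (∑R.∑₊-*ˡ n _ _)) (∑R.∑₊-cong′ n λ j l j+l≡n → R.trans
      (R.*-congʳ (R.trans (R.^-congʳ q (≡.trans (cong (i ℕ.*_) (≡.sym j+l≡n)) (ℕP.*-distribˡ-+ i j l))) (R.^-homo-* q (i ℕ.* j) (i ℕ.* l))))
      (R.solve 4 (λ a b c d → a R.:* b R.:* (c R.:* d) R.:= a R.:* c R.:* (b R.:* d)) R.refl _ _ _ _))

    τ-+ : ∀ i j f → τ (i ℕ.+ j) f S.≈ τ j (τ i f)
    τ-+ i j f n = R.trans (R.*-congʳ (R.trans (R.^-congʳ q (≡.trans (ℕP.*-distribʳ-+ n i j) (ℕP.+-comm (i ℕ.* n) (j ℕ.* n)))) (R.^-homo-* q (j ℕ.* n) (i ℕ.* n))))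
      (R.*-assoc _ _ _)

    Ha : ∀ i → H i S.* a S.≈ τ i a
    Ha i n = g-convolution y R.refl i n

    -- The quotient A(q^(i + j) x)/A(x) telescopes through A(q^j x); `τ j` is the dilation x ↦ q^j
    -- x.
    H-+ : ∀ i j → H (i ℕ.+ j) S.≈ τ j (H i) S.* H j
    H-+ i j = OR.cancelˡ {a} {H (i ℕ.+ j)} {τ j (H i) S.* H j} a-0 (begin
      a S.* H (i ℕ.+ j)               ≈⟨ S.*-comm a (H (i ℕ.+ j)) ⟩
      H (i ℕ.+ j) S.* a               ≈⟨ Ha (i ℕ.+ j) ⟩
      τ (i ℕ.+ j) a                   ≈⟨ τ-+ i j a ⟩
      τ j (τ i a)                     ≈⟨ τ-cong j {H i S.* a} {τ i a} (Ha i) ⟨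
      τ j (H i S.* a)                 ≈⟨ τ-* j (H i) a ⟩
      τ j (H i) S.* τ j a             ≈⟨ S.*-congˡ {τ j (H i)} (Ha j) ⟨
      τ j (H i) S.* (H j S.* a)       ≈⟨ S.*-assoc (τ j (H i)) (H j) a ⟨
      τ j (H i) S.* H j S.* a         ≈⟨ S.*-comm (τ j (H i) S.* H j) a ⟩
      a S.* (τ j (H i) S.* H j)       ∎)
      where open SetoidReasoning S.setoid

    g-+ : ∀ i j n → g (i ℕ.+ j) n R.≈ ∑R.∑₊ n (λ m r → q R.^ (j ℕ.* m) R.* (g i m R.* g j r))
    g-+ i j n = OA.var^-cancel n (R.trans (H-+ i j n) (R.trans (∑R.∑₊-cong′ n λ m r m+r≡n → R.trans
      (R.solve 5 (λ q a b c d → q R.:* (a R.:* b) R.:* (c R.:* d) R.:= a R.:* c R.:* (q R.:* (b R.:* d))) R.refl _ _ _ _ _)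
      (R.*-congʳ (R.trans (R.sym (R.^-homo-* y m r)) (R.^-congʳ y m+r≡n)))) (∑R.∑₊-*ˡ n _ _)))

  q^-coeff-0 : ∀ n → (q R.^ n) 0 A.≈ A.1#
  q^-coeff-0 zero    = A.refl
  q^-coeff-0 (suc n) = A.trans (A.*-cong (A.+-identityʳ _) (q^-coeff-0 n)) (A.*-identityˡ _)

  -- At q = 1 the dilation is trivial, so the telescoping product becomes an exponential law in i.
  K-+ : ∀ i j → K (i ℕ.+ j) R.≈ K i R.* K j
  K-+ i j n = A.trans (g-+ i j n 0) (A.trans (∑₊-coeff n _ 0) (∑A.∑₊-cong n λ m r →
    A.trans (A.*-congʳ (q^-coeff-0 (j ℕ.* m))) (A.*-identityˡ _)))

  K-split : ∀ i m → K (suc i) m A.≈ ∑A.∑₊ m (λ j l → A.e j A.* K (i ℕ.+ j) l)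
  K-split i m = A.trans (g-split i m 0) (A.trans (∑₊-coeff m _ 0) (∑A.∑₊-cong m λ j l →
    A.*-congˡ (A.trans (A.*-congʳ (q^-coeff-0 (i ℕ.* j ℕ.+ tri j))) (A.*-identityˡ _))))

  K-zeroʳ : ∀ i → K i 0 A.≈ A.1#
  K-zeroʳ i = g-zeroʳ i 0

-- The tree function

module TreeSeries (A : ℚ-Algebra) where
  private module A = ℚ-Algebra A
  open Antidiagonal A
  open Exponential A
  open ParkingArea A using (K; K-+; K-split; K-zeroʳ; y; q; g-zeroˡ)
  open SeriesOperators A
  open PowerSeries A using (const; const-*; seriesAlgebra)
  open ℚ-Algebra seriesAlgebra
  private module ≈A = SetoidReasoning A.setoid

  nat-∸ : ∀ i j → A.nat i A.≈ A.nat (i ℕ.+ j) A.- A.nat j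
  nat-∸ i j = A.trans (A.solve 2 (λ a b → a A.:= a A.:+ b A.:- b) A.refl _ _) (A.+-congʳ (A.sym (A.nat-+ i j)))

  -- Abel's numbers i (i + n)^(n - 1) / n!, multiplied by i + n to avoid the exponent n - 1. Each
  -- letter splitting lowers the total i + n by one, so the induction is on this total.
  K-closed : ∀ i n → A.nat (i ℕ.+ n) A.* K i n A.≈ A.nat i A.* expo (A.nat (i ℕ.+ n)) n
  K-closed i n = go (i ℕ.+ n) i n ≡.refl
    where
    open ≈A
    go : ∀ N i n → i ℕ.+ n ≡ N → A.nat N A.* K i n A.≈ A.nat i A.* expo (A.nat N) n
    go zero    zero    zero    eq = A.trans (nat-0-* _) (A.sym (nat-0-* _))
    go (suc N) zero    (suc n) eq = A.trans (A.trans (A.*-congˡ (g-zeroˡ n 0)) (A.zeroʳ _)) (A.sym (nat-0-* _))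
    go (suc N) (suc i) zero    eq = A.*-cong (A.fromℚ-cong (cong ι (≡.trans (≡.sym eq) (ℕP.+-identityʳ _))))
      (A.trans (K-zeroʳ (suc i)) (A.sym (A.trans (A.*-identityʳ _) A.fromℚ-1)))
    go (suc N) (suc i) n@(suc m) eq = begin
      M A.* K (suc i) n
        ≈⟨ A.*-congˡ (A.nat-cancel (i ℕ.+ m) (A.trans (A.*-congʳ (A.sym N≈)) (A.trans N*K (A.*-congʳ N≈)))) ⟩
      M A.* (expo M n A.- expo M m)
        ≈⟨ A.solve 3 (λ M a b → M A.:* (a A.:- b) A.:= M A.:* a A.:- M A.:* b) A.refl _ _ _ ⟩
      M A.* expo M n A.- M A.* expo M m
        ≈⟨ A.+-congˡ (A.-‿cong (nat-suc-*-expo M m)) ⟨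
      M A.* expo M n A.- A.nat n A.* expo M n
        ≈⟨ A.solve 3 (λ M k a → M A.:* a A.:- k A.:* a A.:= (M A.:- k) A.:* a) A.refl _ _ _ ⟩
      (M A.- A.nat n) A.* expo M n
        ≈⟨ A.*-congʳ (A.trans (A.+-congʳ (A.fromℚ-cong (cong ι (≡.sym eq)))) (A.sym (nat-∸ (suc i) n))) ⟩
      A.nat (suc i) A.* expo M n ∎
      where
      M = A.nat (suc N)

      N≈ : A.nat N A.≈ A.nat (suc (i ℕ.+ m))
      N≈ = A.fromℚ-cong (cong ι (≡.trans (≡.sym (ℕP.suc-injective eq)) (ℕP.+-suc i m)))

      h : ℕ → ℕ → A.Carrier
      h j l = expo A.1# j A.* expo (A.nat N) l

      e≈expo-1 : ∀ j → A.e j A.≈ expo A.1# j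
      e≈expo-1 j = A.sym (A.trans (A.*-congˡ (1^ j)) (A.*-identityʳ _))

      expo-suc : ∀ m → expo (A.1# A.+ A.nat N) m A.≈ expo M m
      expo-suc m = A.*-congˡ (A.^-congˡ m (A.trans (A.+-congʳ (A.sym A.fromℚ-1)) (A.sym (A.nat-+ 1 N))))

      -- Writing i + j = N - l splits the Abel sum into two binomial sums, one of order n and, after
      -- absorbing l, one of order n - 1.
      term : ∀ j l → j ℕ.+ l ≡ n →
        A.nat N A.* (A.e j A.* K (i ℕ.+ j) l) A.≈ A.nat N A.* h j l A.+ A.- A.1# A.* (A.nat l A.* h j l)
      term j l j+l≡n = begin
        A.nat N A.* (A.e j A.* K (i ℕ.+ j) l)
          ≈⟨ A.solve 3 (λ a b c → a A.:* (b A.:* c) A.:= b A.:* (a A.:* c)) A.refl _ _ _ ⟩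
        A.e j A.* (A.nat N A.* K (i ℕ.+ j) l)
          ≈⟨ A.*-cong (e≈expo-1 j) (go N (i ℕ.+ j) l total) ⟩
        expo A.1# j A.* (A.nat (i ℕ.+ j) A.* expo (A.nat N) l)
          ≈⟨ A.*-congˡ (A.*-congʳ (A.trans (nat-∸ (i ℕ.+ j) l) (A.+-congʳ (A.fromℚ-cong (cong ι total))))) ⟩
        expo A.1# j A.* ((A.nat N A.- A.nat l) A.* expo (A.nat N) l)
          ≈⟨ A.solve 4 (λ a N l b → a A.:* ((N A.:- l) A.:* b) A.:= N A.:* (a A.:* b) A.:+ A.con (ℚ.- 1ℚ) A.:* (l A.:* (a A.:* b))) A.refl _ _ _ _ ⟩
        A.nat N A.* h j l A.+ A.fromℚ (ℚ.- 1ℚ) A.* (A.nat l A.* h j l)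
          ≈⟨ A.+-congˡ (A.*-congʳ (A.trans (A.fromℚ-neg 1ℚ) (A.-‿cong A.fromℚ-1))) ⟩
        A.nat N A.* h j l A.+ A.- A.1# A.* (A.nat l A.* h j l) ∎
        where
        total : i ℕ.+ j ℕ.+ l ≡ N
        total = ≡.trans (ℕP.+-assoc i j l) (≡.trans (cong (i ℕ.+_) j+l≡n) (ℕP.suc-injective eq))

      N*K : A.nat N A.* K (suc i) n A.≈ A.nat N A.* (expo M n A.- expo M m)
      N*K = begin
        A.nat N A.* K (suc i) n
          ≈⟨ A.trans (A.*-congˡ (K-split i n)) (A.sym (∑₊-*ˡ n (A.nat N) (λ j l → A.e j A.* K (i ℕ.+ j) l))) ⟩
        ∑₊ n (λ j l → A.nat N A.* (A.e j A.* K (i ℕ.+ j) l))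
          ≈⟨ A.trans (∑₊-cong′ n term) (∑₊-+ n (λ j l → A.nat N A.* h j l) (λ j l → A.- A.1# A.* (A.nat l A.* h j l))) ⟩
        ∑₊ n (λ j l → A.nat N A.* h j l) A.+ ∑₊ n (λ j l → A.- A.1# A.* (A.nat l A.* h j l))
          ≈⟨ A.+-cong (∑₊-*ˡ n (A.nat N) h) (A.trans (∑₊-*ˡ n (A.- A.1#) (λ j l → A.nat l A.* h j l)) (A.*-congˡ (∑₊-natʳ m h))) ⟩
        A.nat N A.* ∑₊ n h A.+ A.- A.1# A.* ∑₊ m (λ j l → A.nat (suc l) A.* h j (suc l))
          ≈⟨ A.+-cong (A.*-congˡ (A.trans (expo-+ A.1# (A.nat N) n) (expo-suc n))) (A.*-congˡ (A.trans
               (∑₊-cong m λ j l → A.trans (A.solve 3 (λ a b c → a A.:* (b A.:* c) A.:= b A.:* (a A.:* c)) A.refl _ _ _)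
                 (A.trans (A.*-congˡ (nat-suc-*-expo (A.nat N) l)) (A.solve 3 (λ a b c → b A.:* (a A.:* c) A.:= a A.:* (b A.:* c)) A.refl _ _ _)))
               (A.trans (∑₊-*ˡ m _ h) (A.*-congˡ (A.trans (expo-+ A.1# (A.nat N) m) (expo-suc m)))))) ⟩
        A.nat N A.* expo M n A.+ A.- A.1# A.* (A.nat N A.* expo M m)
          ≈⟨ A.+-congˡ (A.*-congʳ (A.sym (A.trans (A.fromℚ-neg 1ℚ) (A.-‿cong A.fromℚ-1)))) ⟩
        A.nat N A.* expo M n A.+ A.fromℚ (ℚ.- 1ℚ) A.* (A.nat N A.* expo M m)
          ≈⟨ A.solve 3 (λ N a b → N A.:* a A.:+ A.con (ℚ.- 1ℚ) A.:* (N A.:* b) A.:= N A.:* (a A.:- b)) A.refl _ _ _ ⟩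
        A.nat N A.* (expo M n A.- expo M m) ∎

  -- In terms of the tree function T: K s = exp (s T) = (T / z)^s, B s = exp (s T) / (1 - T), and z B (s + 1) = T B s.
  B : ℕ → Carrier
  B s n = expo (A.nat (s ℕ.+ n)) n

  B-unfold : ∀ s → B s ≈ K s + var * B (suc s)
  B-unfold s zero    = A.trans (A.*-cong A.fromℚ-1 A.refl) (A.trans (A.*-identityˡ _)
    (A.sym (A.trans (A.+-cong (K-zeroʳ s) (var-*-zero (B (suc s)))) (A.+-identityʳ _))))
  B-unfold s (suc m) = A.nat-cancel (s ℕ.+ m) (begin
    A.nat (suc (s ℕ.+ m)) A.* B s n
      ≈⟨ A.*-cong eqM A.refl ⟨
    M A.* B s n
      ≈⟨ A.*-congʳ (A.nat-+ s n) ⟩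
    (A.nat s A.+ A.nat n) A.* B s n
      ≈⟨ A.distribʳ _ _ _ ⟩
    A.nat s A.* expo M n A.+ A.nat n A.* expo M n
      ≈⟨ A.+-cong (A.sym (K-closed s n)) (nat-suc-*-expo M m) ⟩
    M A.* K s n A.+ M A.* expo M m
      ≈⟨ A.distribˡ _ _ _ ⟨
    M A.* (K s n A.+ expo M m)
      ≈⟨ A.*-cong eqM (A.+-congˡ (A.trans (A.*-congˡ (A.^-congˡ m eqM)) (A.sym (var-*-suc (B (suc s)) m)))) ⟩
    A.nat (suc (s ℕ.+ m)) A.* (K s n A.+ (var * B (suc s)) n) ∎)
    where
    open ≈A
    n = suc m
    M = A.nat (s ℕ.+ n)
    eqM : M A.≈ A.nat (suc (s ℕ.+ m))
    eqM = A.fromℚ-cong (cong ι (ℕP.+-suc s m))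

  θK : ∀ s → θ (K s) ≈ nat s * (var * B (suc s))
  θK s zero    = A.trans (nat-0-* _) (A.sym (A.trans (fromℚ-*-coeff (ι s) (var * B (suc s)) 0) (A.trans (A.*-congˡ (var-*-zero (B (suc s)))) (A.zeroʳ _))))
  θK s (suc m) = A.nat-cancel (s ℕ.+ m) (begin
    A.nat (suc (s ℕ.+ m)) A.* (A.nat n A.* K s n)
      ≈⟨ A.*-congʳ eqM ⟨
    M A.* (A.nat n A.* K s n)
      ≈⟨ A.solve 3 (λ a b c → a A.:* (b A.:* c) A.:= b A.:* (a A.:* c)) A.refl _ _ _ ⟩
    A.nat n A.* (M A.* K s n)
      ≈⟨ A.*-congˡ (K-closed s n) ⟩
    A.nat n A.* (A.nat s A.* expo M n)
      ≈⟨ A.solve 3 (λ a b c → a A.:* (b A.:* c) A.:= b A.:* (a A.:* c)) A.refl _ _ _ ⟩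
    A.nat s A.* (A.nat n A.* expo M n)
      ≈⟨ A.*-congˡ (nat-suc-*-expo M m) ⟩
    A.nat s A.* (M A.* expo M m)
      ≈⟨ A.solve 3 (λ a b c → a A.:* (b A.:* c) A.:= b A.:* (a A.:* c)) A.refl _ _ _ ⟩
    M A.* (A.nat s A.* expo M m)
      ≈⟨ A.*-cong eqM (A.*-congˡ (A.trans (A.*-congˡ (A.^-congˡ m eqM)) (A.sym (var-*-suc (B (suc s)) m)))) ⟩
    A.nat (suc (s ℕ.+ m)) A.* (A.nat s A.* (var * B (suc s)) n)
      ≈⟨ A.*-congˡ (fromℚ-*-coeff (ι s) (var * B (suc s)) n) ⟨
    A.nat (suc (s ℕ.+ m)) A.* (nat s * (var * B (suc s))) n ∎)
    where
    open ≈A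
    n = suc m
    M = A.nat (s ℕ.+ n)
    eqM : M A.≈ A.nat (suc (s ℕ.+ m))
    eqM = A.fromℚ-cong (cong ι (ℕP.+-suc s m))

  private module ≈R = SetoidReasoning setoid

  K-0 : K 0 ≈ 1#
  K-0 zero    = K-zeroʳ 0
  K-0 (suc n) = g-zeroˡ n 0

  -- Apply θ to K (s + 2) = K 1 K (s + 1) and use `θK`. The indices start at 2 because `θK` shows B
  -- (s + 1) only with the factor s, which hides B 1; `B-unfold` descends to the indices 1 and 0
  -- afterwards.
  B-2+ : ∀ s → B (2 ℕ.+ s) ≈ K s * B 2
  B-2+ zero    = sym (trans (*-congʳ K-0) (*-identityˡ (B 2)))
  B-2+ (suc s) = nat-cancel (suc s) (var-cancel (begin
    var * (nat (2 ℕ.+ s) * B (3 ℕ.+ s))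
      ≈⟨ solve 3 (λ a b c → a :* (b :* c) := b :* (a :* c)) refl var (nat (2 ℕ.+ s)) (B (3 ℕ.+ s)) ⟩
    nat (2 ℕ.+ s) * (var * B (3 ℕ.+ s))
      ≈⟨ θK (2 ℕ.+ s) ⟨
    θ (K (2 ℕ.+ s))
      ≈⟨ θ-cong (K-+ 1 (suc s)) ⟩
    θ (K 1 * K (suc s))
      ≈⟨ θ-* (K 1) (K (suc s)) ⟩
    θ (K 1) * K (suc s) + K 1 * θ (K (suc s))
      ≈⟨ +-cong (*-congʳ (θK 1)) (*-congˡ {K 1} (trans (θK (suc s)) (*-congˡ {nat (suc s)} (*-congˡ {var} (B-2+ s))))) ⟩
    nat 1 * (var * B 2) * K (suc s) + K 1 * (nat (suc s) * (var * (K s * B 2)))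
      ≈⟨ solve 7 (λ o z b k k₁ c k₀ → o :* (z :* b) :* k :+ k₁ :* (c :* (z :* (k₀ :* b))) := z :* (o :* (k :* b) :+ c :* ((k₁ :* k₀) :* b)))
           refl (nat 1) var (B 2) (K (suc s)) (K 1) (nat (suc s)) (K s) ⟩
    var * (nat 1 * (K (suc s) * B 2) + nat (suc s) * (K 1 * K s * B 2))
      ≈⟨ *-congˡ {var} (+-congˡ {nat 1 * (K (suc s) * B 2)} (*-congˡ {nat (suc s)} (*-congʳ (sym (K-+ 1 s))))) ⟩
    var * (nat 1 * (K (suc s) * B 2) + nat (suc s) * (K (suc s) * B 2))
      ≈⟨ *-congˡ {var} (trans (sym (distribʳ (K (suc s) * B 2) (nat 1) (nat (suc s)))) (*-congʳ (sym (nat-+ 1 (suc s))))) ⟩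
    var * (nat (2 ℕ.+ s) * (K (suc s) * B 2)) ∎))
    where open ≈R

  B-2 : B 2 ≈ K 1 * B 1
  B-2 = begin
    B 2                               ≈⟨ B-unfold 2 ⟩
    K 2 + var * B 3                   ≈⟨ +-cong (K-+ 1 1) (*-congˡ {var} (B-2+ 1)) ⟩
    K 1 * K 1 + var * (K 1 * B 2)     ≈⟨ solve 3 (λ k z b → k :* k :+ z :* (k :* b) := k :* (k :+ z :* b)) refl (K 1) var (B 2) ⟩
    K 1 * (K 1 + var * B 2)           ≈⟨ *-congˡ {K 1} (B-unfold 1) ⟨
    K 1 * B 1                         ∎
    where open ≈R

  B-1 : B 1 ≈ K 1 * B 0
  B-1 = begin
    B 1                               ≈⟨ B-unfold 1 ⟩
    K 1 + var * B 2                   ≈⟨ +-congˡ {K 1} (*-congˡ {var} B-2) ⟩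
    K 1 + var * (K 1 * B 1)           ≈⟨ +-congʳ (*-identityʳ (K 1)) ⟨
    K 1 * 1# + var * (K 1 * B 1)      ≈⟨ solve 4 (λ k o z b → k :* o :+ z :* (k :* b) := k :* (o :+ z :* b)) refl (K 1) 1# var (B 1) ⟩
    K 1 * (1# + var * B 1)            ≈⟨ *-congˡ {K 1} (+-congʳ (sym K-0)) ⟩
    K 1 * (K 0 + var * B 1)           ≈⟨ *-congˡ {K 1} (B-unfold 0) ⟨
    K 1 * B 0                         ∎
    where open ≈R

  B-suc : ∀ s → B (suc s) ≈ K 1 * B s
  B-suc zero          = B-1
  B-suc (suc zero)    = B-2
  B-suc (suc (suc s)) = begin
    B (3 ℕ.+ s)               ≈⟨ B-2+ (suc s) ⟩
    K (suc s) * B 2           ≈⟨ *-congʳ (K-+ 1 s) ⟩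
    K 1 * K s * B 2           ≈⟨ *-assoc (K 1) (K s) (B 2) ⟩
    K 1 * (K s * B 2)         ≈⟨ *-congˡ {K 1} (B-2+ s) ⟨
    K 1 * B (2 ℕ.+ s)         ∎
    where open ≈R

  T X W : Carrier
  T = var * K 1
  X = B 0
  W = 1# - T

  var-*-B : ∀ s → var * B (suc s) ≈ T * B s
  var-*-B s = trans (*-congˡ {var} (B-suc s)) (sym (*-assoc var (K 1) (B s)))

  X-unfold : X ≈ 1# + T * X
  X-unfold = trans (B-unfold 0) (+-cong K-0 (var-*-B 0))

  WX : W * X ≈ 1#
  WX = begin
    (1# - T) * X            ≈⟨ solve 3 (λ o t x → (o :- t) :* x := o :* x :- t :* x) refl 1# T X ⟩
    1# * X - T * X          ≈⟨ +-congʳ (trans (*-identityˡ X) X-unfold) ⟩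
    1# + T * X - T * X      ≈⟨ solve 2 (λ o t → o :+ t :- t := o) refl 1# (T * X) ⟩
    1#                      ∎
    where open ≈R

  T≈ : T ≈ W * (X - 1#)
  T≈ = begin
    T                          ≈⟨ solve 2 (λ o t → t := o :- (o :- t)) refl 1# T ⟩
    1# - W                     ≈⟨ +-cong (sym WX) (-‿cong (sym (*-identityʳ W))) ⟩
    W * X - W * 1#             ≈⟨ solve 3 (λ w x o → w :* x :- w :* o := w :* (x :- o)) refl W X 1# ⟩
    W * (X - 1#)               ∎
    where open ≈R

  θT : θ T ≈ T * X
  θT = begin
    θ (var * K 1)                       ≈⟨ θ-* var (K 1) ⟩
    θ var * K 1 + var * θ (K 1)         ≈⟨ +-cong (*-congʳ θ-var) (*-congˡ {var} (trans (θK 1) (trans (*-congʳ fromℚ-1) (*-identityˡ (var * B 2))))) ⟩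
    var * K 1 + var * (var * B 2)       ≈⟨ distribˡ var (K 1) (var * B 2) ⟨
    var * (K 1 + var * B 2)             ≈⟨ *-congˡ {var} (B-unfold 1) ⟨
    var * B 1                           ≈⟨ var-*-B 0 ⟩
    T * X                               ∎
    where open ≈R

  θX : θ X ≈ X * X * X - X * X
  θX = begin
    θ X                                 ≈⟨ trans (sym (*-identityˡ (θ X))) (*-congʳ (trans (sym WX) (*-comm W X))) ⟩
    X * W * θ X                         ≈⟨ solve 4 (λ o t x x′ → x :* (o :- t) :* x′ := x :* (o :* x′ :- t :* x′)) refl 1# T X (θ X) ⟩
    X * (1# * θ X - T * θ X)            ≈⟨ *-congˡ {X} (+-congʳ (trans (*-identityˡ (θ X)) θX-unfold)) ⟩
    X * (T * X * X + T * θ X - T * θ X) ≈⟨ solve 3 (λ t x x′ → x :* (t :* x :* x :+ t :* x′ :- t :* x′) := t :* x :* x :* x) refl T X (θ X) ⟩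
    T * X * X * X                       ≈⟨ *-congʳ (*-congʳ TX) ⟩
    (X - 1#) * X * X                    ≈⟨ solve 2 (λ x o → (x :- o) :* x :* x := x :* x :* x :- o :* (x :* x)) refl X 1# ⟩
    X * X * X - 1# * (X * X)            ≈⟨ +-congˡ {X * X * X} (-‿cong (*-identityˡ (X * X))) ⟩
    X * X * X - X * X                   ∎
    where
    open ≈R
    TX : T * X ≈ X - 1#
    TX = trans (solve 2 (λ o t → t := o :+ t :- o) refl 1# (T * X)) (+-congʳ (sym X-unfold))

    θX-unfold : θ X ≈ T * X * X + T * θ X
    θX-unfold = begin
      θ X                       ≈⟨ θ-cong X-unfold ⟩
      θ (1# + T * X)            ≈⟨ trans (θ-+ 1# (T * X)) (+-cong (θ-const A.1#) (θ-* T X)) ⟩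
      0# + (θ T * X + T * θ X)  ≈⟨ trans (+-identityˡ (θ T * X + T * θ X)) (+-congʳ (*-congʳ θT)) ⟩
      T * X * X + T * θ X       ∎

  θW : θ W ≈ - (X - 1#)
  θW = begin
    θ (1# - T)          ≈⟨ trans (θ-− 1# T) (+-cong (θ-const A.1#) (-‿cong θT)) ⟩
    0# - T * X          ≈⟨ +-identityˡ (- (T * X)) ⟩
    - (T * X)           ≈⟨ -‿cong (trans (solve 2 (λ o t → t := o :+ t :- o) refl 1# (T * X)) (+-congʳ (sym X-unfold))) ⟩
    - (X - 1#)          ∎
    where open ≈R

  expSum : A.Carrier → ℕ → A.Carrier
  expSum x zero    = expo x 0
  expSum x (suc n) = expo x (suc n) A.+ expSum x n

  -- Each use of X B s = B s + z X B (s + 1) lowers the degree and raises s, so s + n stays fixed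
  -- and the terms collected are those of one truncated exponential series. The case s = 0 gives X².
  XB-coeff : ∀ s n → (X * B s) n A.≈ expSum (A.nat (s ℕ.+ n)) n
  XB-coeff s n = A.trans (XB-unfold s n) (lemma n)
    where
    XB-unfold : ∀ s → X * B s ≈ B s + var * (X * B (suc s))
    XB-unfold s = begin
      X * B s                         ≈⟨ *-congʳ X-unfold ⟩
      (1# + T * X) * B s              ≈⟨ solve 4 (λ o t x b → (o :+ t :* x) :* b := o :* b :+ x :* (t :* b)) refl 1# T X (B s) ⟩
      1# * B s + X * (T * B s)        ≈⟨ +-cong (*-identityˡ (B s)) (*-congˡ {X} (sym (var-*-B s))) ⟩
      B s + X * (var * B (suc s))     ≈⟨ +-congˡ {B s} (solve 3 (λ x z b → x :* (z :* b) := z :* (x :* b)) refl X var (B (suc s))) ⟩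
      B s + var * (X * B (suc s))     ∎
      where open ≈R

    lemma : ∀ n → (B s + var * (X * B (suc s))) n A.≈ expSum (A.nat (s ℕ.+ n)) n
    lemma zero    = A.trans (A.+-congˡ (var-*-zero (X * B (suc s)))) (A.+-identityʳ _)
    lemma (suc n) = A.+-congˡ (A.trans (var-*-suc (X * B (suc s)) n) (A.trans (XB-coeff (suc s) n)
      (A.reflexive (cong (λ k → expSum (A.nat k) n) (≡.sym (ℕP.+-suc s n))))))

-- Solution of Wright's recurrence

Poly : Set
Poly = List ℚ

infixl 6 _⊕_ _⊖_
infixl 7 _⊗_ _·_

_⊕_ : Poly → Poly → Poly
[]      ⊕ p       = p
(c ∷ p) ⊕ []      = c ∷ p
(c ∷ p) ⊕ (d ∷ r) = (c ℚ.+ d) ∷ (p ⊕ r)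

_·_ : ℚ → Poly → Poly
c · p = map (c ℚ.*_) p

_⊖_ : Poly → Poly → Poly
p ⊖ r = p ⊕ (ℚ.- 1ℚ) · r

_⊗_ : Poly → Poly → Poly
[]      ⊗ r = []
(c ∷ p) ⊗ r = c · r ⊕ (0ℚ ∷ (p ⊗ r))

deriv : Poly → Poly
deriv []      = []
deriv (c ∷ p) = p ⊕ (0ℚ ∷ deriv p)

-- Coefficient lists, lowest degree first, may end in zeros, so identities are tested on differences
-- instead of by equality of lists.
isZero : Poly → Bool
isZero []      = true
isZero (c ∷ p) = ⌊ c ℚP.≟ 0ℚ ⌋ ∧ isZero p

convolve : ℕ → (ℕ → ℕ → Poly) → Poly
convolve zero    h = h 0 0
convolve (suc n) h = h 0 (suc n) ⊕ convolve n (λ i j → h (suc i) j)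

-- θ (W p(X)) = W (ϑ p)(X) and θ (W² p(X)) = W² (ϑ₂ p)(X), where X = 1/(1 - T) and W = 1/X.
ϑ ϑ₂ : Poly → Poly
ϑ  p = (0ℚ ∷ 0ℚ ∷ ℚ.- 1ℚ ∷ 1ℚ ∷ []) ⊗ deriv p ⊖ (0ℚ ∷ ℚ.- 1ℚ ∷ 1ℚ ∷ []) ⊗ p
ϑ₂ p = ϑ p ⊖ (0ℚ ∷ ℚ.- 1ℚ ∷ 1ℚ ∷ []) ⊗ p

-- V k = W (wrightPoly k)(X); the coefficients come from solving Wright's recurrence, a linear system for each k.
wrightPoly : ℕ → Poly
wrightPoly 0 = (-[1+ 0 ] / 1) ∷ (+ 1 / 1) ∷ []
wrightPoly 1 = (-[1+ 0 ] / 2) ∷ (+ 3 / 2) ∷ (-[1+ 2 ] / 2) ∷ (+ 1 / 2) ∷ []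
wrightPoly 2 = (+ 1 / 12) ∷ (-[1+ 0 ] / 24) ∷ (-[1+ 0 ] / 24) ∷ (-[1+ 12 ] / 12) ∷ (+ 8 / 3) ∷ (-[1+ 52 ] / 24) ∷ (+ 5 / 8) ∷ []
wrightPoly 3 = (-[1+ 0 ] / 24) ∷ (+ 1 / 48) ∷ (+ 1 / 48) ∷ (+ 23 / 48) ∷ (-[1+ 106 ] / 48) ∷ (+ 115 / 16) ∷ (-[1+ 230 ] / 16) ∷ (+ 757 / 48) ∷ (-[1+ 414 ] / 48) ∷ (+ 15 / 8) ∷ []
wrightPoly 4 = (+ 19 / 720) ∷ (-[1+ 36 ] / 2880) ∷ (-[1+ 12 ] / 960) ∷ (-[1+ 114 ] / 384) ∷ (+ 217 / 128) ∷ (-[1+ 590 ] / 80) ∷ (+ 6001 / 240) ∷ (-[1+ 62896 ] / 960) ∷ (+ 7947 / 64) ∷ (-[1+ 89206 ] / 576) ∷ (+ 67811 / 576) ∷ (-[1+ 18874 ] / 384) ∷ (+ 1105 / 128) ∷ []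
wrightPoly 5 = (-[1+ 2 ] / 160) ∷ (+ 17 / 1920) ∷ (+ 19 / 1920) ∷ (+ 827 / 3840) ∷ (-[1+ 3126 ] / 2304) ∷ (+ 15817 / 2304) ∷ (-[1+ 333786 ] / 11520) ∷ (+ 598393 / 5760) ∷ (-[1+ 1789042 ] / 5760) ∷ (+ 54209 / 72) ∷ (-[1+ 4060440 ] / 2880) ∷ (+ 4411441 / 2304) ∷ (-[1+ 4091314 ] / 2304) ∷ (+ 2426105 / 2304) ∷ (-[1+ 274924 ] / 768) ∷ (+ 1695 / 32) ∷ []
wrightPoly 6 = (+ 863 / 60480) ∷ (-[1+ 948 ] / 145152) ∷ (-[1+ 5610 ] / 725760) ∷ (-[1+ 360 ] / 2160) ∷ (+ 46907 / 41472) ∷ (-[1+ 2605786 ] / 414720) ∷ (+ 4172023 / 138240) ∷ (-[1+ 12425292 ] / 96768) ∷ (+ 29137693 / 60480) ∷ (-[1+ 305374248 ] / 193536) ∷ (+ 367130407 / 82944) ∷ (-[1+ 1074489190 ] / 103680) ∷ (+ 1349548817 / 69120) ∷ (-[1+ 2345987064 ] / 82944) ∷ (+ 2495149375 / 82944) ∷ (-[1+ 309617682 ] / 13824) ∷ (+ 8419885 / 768) ∷ (-[1+ 9697884 ] / 3072) ∷ (+ 414125 / 1024) ∷ []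
wrightPoly _ = []

-- The difference of the two sides of Wright's recurrence, divided by W².
residual : ℕ → Poly
residual k = (0ℚ ∷ 1ℚ ∷ []) ⊗ ((ϑ r′ ⊕ ι (suc k) · r′ ⊖ r′) ⊕ (ϑ r ⊕ ι k · r ⊖ r) ⊖ ½ · ϑ (ϑ r ⊖ r))
  ⊖ ½ · ϑ₂ (convolve (suc k) (λ b c → wrightPoly b ⊗ wrightPoly c))
  where
  r  = wrightPoly k
  r′ = wrightPoly (suc k)

value : Poly → ℚ → ℚ
value []      x = 0ℚ
value (c ∷ p) x = c ℚ.+ x ℚ.* value p x

module Evaluation (A : ℚ-Algebra) where
  open ℚ-Algebra A
  open Antidiagonal A
  open SetoidReasoning setoid

  eval : Poly → Carrier → Carrier
  eval []      x = fromℚ 0ℚ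
  eval (c ∷ p) x = fromℚ c + x * eval p x

  eval-⊕ : ∀ p r x → eval (p ⊕ r) x ≈ eval p x + eval r x
  eval-⊕ []      r       x = sym (trans (+-congʳ fromℚ-0) (+-identityˡ _))
  eval-⊕ (c ∷ p) []      x = sym (trans (+-congˡ fromℚ-0) (+-identityʳ _))
  eval-⊕ (c ∷ p) (d ∷ r) x = begin
    fromℚ (c ℚ.+ d) + x * eval (p ⊕ r) x                      ≈⟨ +-cong (fromℚ-+ c d) (*-congˡ (eval-⊕ p r x)) ⟩
    fromℚ c + fromℚ d + x * (eval p x + eval r x)             ≈⟨ solve 5 (λ c d x p r → c :+ d :+ x :* (p :+ r) := c :+ x :* p :+ (d :+ x :* r)) refl _ _ _ _ _ ⟩
    fromℚ c + x * eval p x + (fromℚ d + x * eval r x)         ∎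

  eval-· : ∀ c p x → eval (c · p) x ≈ fromℚ c * eval p x
  eval-· c []      x = solve 1 (λ c → con 0ℚ := c :* con 0ℚ) refl (fromℚ c)
  eval-· c (d ∷ p) x = begin
    fromℚ (c ℚ.* d) + x * eval (c · p) x          ≈⟨ +-cong (fromℚ-* c d) (*-congˡ (eval-· c p x)) ⟩
    fromℚ c * fromℚ d + x * (fromℚ c * eval p x)  ≈⟨ solve 4 (λ c d x p → c :* d :+ x :* (c :* p) := c :* (d :+ x :* p)) refl _ _ _ _ ⟩
    fromℚ c * (fromℚ d + x * eval p x)            ∎

  eval-⊖ : ∀ p r x → eval (p ⊖ r) x ≈ eval p x - eval r x
  eval-⊖ p r x = trans (eval-⊕ p _ x) (+-congˡ (trans (eval-· (ℚ.- 1ℚ) r x) (solve 1 (λ a → con (ℚ.- 1ℚ) :* a := :- a) refl _)))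

  eval-⊗ : ∀ p r x → eval (p ⊗ r) x ≈ eval p x * eval r x
  eval-⊗ []      r x = solve 1 (λ r → con 0ℚ := con 0ℚ :* r) refl _
  eval-⊗ (c ∷ p) r x = begin
    eval (c · r ⊕ (0ℚ ∷ (p ⊗ r))) x                              ≈⟨ eval-⊕ (c · r) _ x ⟩
    eval (c · r) x + (fromℚ 0ℚ + x * eval (p ⊗ r) x)             ≈⟨ +-cong (eval-· c r x) (+-congˡ (*-congˡ (eval-⊗ p r x))) ⟩
    fromℚ c * eval r x + (fromℚ 0ℚ + x * (eval p x * eval r x))  ≈⟨ solve 4 (λ c r x p → c :* r :+ (con 0ℚ :+ x :* (p :* r)) := (c :+ x :* p) :* r) refl _ _ _ _ ⟩
    (fromℚ c + x * eval p x) * eval r x                          ∎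

  eval-isZero : ∀ p x → isZero p ≡ true → eval p x ≈ fromℚ 0ℚ
  eval-isZero []      x eq = refl
  eval-isZero (c ∷ p) x eq with c ℚP.≟ 0ℚ | eq
  ... | yes ≡.refl | eq′ = trans (+-congˡ (*-congˡ (eval-isZero p x eq′))) (solve 1 (λ x → con 0ℚ :+ x :* con 0ℚ := con 0ℚ) refl x)
  ... | no _       | ()

  eval-≡ : ∀ p r x → isZero (p ⊖ r) ≡ true → eval p x ≈ eval r x
  eval-≡ p r x eq = begin
    eval p x                              ≈⟨ solve 2 (λ p r → p := (p :- r) :+ r) refl _ _ ⟩
    eval p x - eval r x + eval r x        ≈⟨ +-congʳ (trans (sym (eval-⊖ p r x)) (eval-isZero (p ⊖ r) x eq)) ⟩
    fromℚ 0ℚ + eval r x                   ≈⟨ solve 1 (λ r → con 0ℚ :+ r := r) refl _ ⟩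
    eval r x                              ∎

  eval-convolve : ∀ n h x → eval (convolve n h) x ≈ ∑₊ n (λ i j → eval (h i j) x)
  eval-convolve zero    h x = refl
  eval-convolve (suc n) h x = trans (eval-⊕ (h 0 (suc n)) _ x) (+-congˡ (eval-convolve n _ x))

  eval-fromℚ : ∀ p {x} c → x ≈ fromℚ c → eval p x ≈ fromℚ (value p c)
  eval-fromℚ []      c eq = refl
  eval-fromℚ (d ∷ p) c eq = trans (+-congˡ (trans (*-cong eq (eval-fromℚ p c eq)) (sym (fromℚ-* c _)))) (sym (fromℚ-+ d _))

  module _ (d : Derivation A) where
    open Derivation d

    D-eval : ∀ p x → D (eval p x) ≈ eval (deriv p) x * D x
    D-eval []      x = trans (D-fromℚ 0ℚ) (sym (trans (*-congʳ fromℚ-0) (zeroˡ _)))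
    D-eval (c ∷ p) x = begin
      D (fromℚ c + x * eval p x)                                  ≈⟨ trans (D-+ _ _) (+-cong (trans (D-fromℚ c) (sym fromℚ-0)) (D-* x _)) ⟩
      fromℚ 0ℚ + (D x * eval p x + x * D (eval p x))              ≈⟨ +-congˡ (+-congˡ (*-congˡ (D-eval p x))) ⟩
      fromℚ 0ℚ + (D x * eval p x + x * (eval (deriv p) x * D x))  ≈⟨ solve 4 (λ x x′ p p′ → con 0ℚ :+ (x′ :* p :+ x :* (p′ :* x′)) := (p :+ (con 0ℚ :+ x :* p′)) :* x′) refl _ _ _ _ ⟩
      (eval p x + (fromℚ 0ℚ + x * eval (deriv p) x)) * D x        ≈⟨ *-congʳ (sym (eval-⊕ p _ x)) ⟩
      eval (p ⊕ (0ℚ ∷ deriv p)) x * D x                           ∎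

module WrightSolution (A : ℚ-Algebra) where
  private module A = ℚ-Algebra A
  open Antidiagonal A
  open SeriesOperators A
  open PowerSeries A using (const; const-*; seriesAlgebra)
  open ℚ-Algebra seriesAlgebra
  open ParkingArea A using (V; wright; ∑₊-coeff; K)
  open TreeSeries A
  open Evaluation seriesAlgebra
  private
    module ∑R = Antidiagonal seriesAlgebra
    module EA = Evaluation A
    module ≈A = SetoidReasoning A.setoid
    module ≈R = SetoidReasoning setoid

  Wright : (ℕ → Carrier) → ℕ → Set
  Wright F k = ∀ n →
    (A.nat n A.* F (suc k) n A.+ A.nat (suc k) A.* F (suc k) n A.- F (suc k) n)
      A.+ (A.nat n A.* F k n A.+ A.nat k A.* F k n A.- F k n) A.≈
    A.fromℚ ½ A.* (A.nat n A.* (A.nat n A.* F k n A.+ ∑₊ (suc k) (λ b c → (F b * F c) n) A.- F k n))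

  -- The unknown coefficient has the factor n + (k + 1) - 1 = n + k, positive for n ≥ 1; at n = 0
  -- the value is an assumption, since k may be 0. On the right the unknown occurs only in products
  -- with F 0, and as F 0 has no constant term these involve coefficients below n.
  Wright-unique : ∀ F G k → Wright F k → Wright G k → F 0 0 A.≈ A.0# → F (suc k) 0 A.≈ G (suc k) 0 →
    (∀ j → j ℕ.≤ k → F j ≈ G j) → F (suc k) ≈ G (suc k)
  Wright-unique F G k wF wG F₀₀ F′₀ below j = upTo j j ℕP.≤-refl
    where
    upTo : ∀ n j → j ℕ.≤ n → F (suc k) j A.≈ G (suc k) j
    upTo zero    zero _ = F′₀
    upTo (suc m) j p with ℕP.m≤n⇒m<n∨m≡n p
    ... | inj₁ (s≤s q) = upTo m j q
    ... | inj₂ ≡.refl  = A.nat-cancel (m ℕ.+ k) (begin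
      A.nat (suc (m ℕ.+ k)) A.* F (suc k) n      ≈⟨ isolate F wF ⟩
      rest F                                     ≈⟨ A.+-cong (A.*-congˡ (A.*-congˡ (A.+-cong (A.+-cong (A.*-congˡ Fk) (∑₊-cong′ (suc k) products)) (A.-‿cong Fk))))
                                                      (A.-‿cong (A.+-cong (A.+-cong (A.*-congˡ Fk) (A.*-congˡ Fk)) (A.-‿cong Fk))) ⟩
      rest G                                     ≈⟨ isolate G wG ⟨
      A.nat (suc (m ℕ.+ k)) A.* G (suc k) n      ∎)
      where
      open ≈A
      n = suc m
      Fk = below k ℕP.≤-refl n

      rest : (ℕ → Carrier) → A.Carrier
      rest F = A.fromℚ ½ A.* (A.nat n A.* (A.nat n A.* F k n A.+ ∑₊ (suc k) (λ b c → (F b * F c) n) A.- F k n))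
        A.- (A.nat n A.* F k n A.+ A.nat k A.* F k n A.- F k n)

      isolate : ∀ F → Wright F k → A.nat (suc (m ℕ.+ k)) A.* F (suc k) n A.≈ rest F
      isolate F w = begin
        A.nat (n ℕ.+ k) A.* F (suc k) n
          ≈⟨ A.*-congʳ (A.nat-+ n k) ⟩
        (A.nat n A.+ A.nat k) A.* F (suc k) n
          ≈⟨ A.solve 4 (λ n k f g → (n A.:+ k) A.:* f A.:= n A.:* f A.:+ (A.con 1ℚ A.:+ k) A.:* f A.:- f A.:+ g A.:- g) A.refl (A.nat n) (A.nat k) (F (suc k) n) (A.nat n A.* F k n A.+ A.nat k A.* F k n A.- F k n) ⟩
        A.nat n A.* F (suc k) n A.+ (A.fromℚ 1ℚ A.+ A.nat k) A.* F (suc k) n A.- F (suc k) n A.+ (A.nat n A.* F k n A.+ A.nat k A.* F k n A.- F k n) A.- (A.nat n A.* F k n A.+ A.nat k A.* F k n A.- F k n)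
          ≈⟨ A.+-congʳ (A.trans (A.+-congʳ (A.+-congʳ (A.+-congˡ (A.*-congʳ (A.sym (A.nat-+ 1 k)))))) (w n)) ⟩
        rest F ∎

      leading : ∀ {F₀ F′ G₀ G′ : Carrier} → F₀ ≈ G₀ → F₀ 0 A.≈ A.0# → (∀ j → j ℕ.≤ m → F′ j A.≈ G′ j) → (F₀ * F′) n A.≈ (G₀ * G′) n
      leading {F₀} {F′} {G₀} {G′} eq z eq′ = A.+-cong
        (A.trans (A.trans (A.*-congʳ z) (A.zeroˡ _)) (A.sym (A.trans (A.*-congʳ (A.trans (A.sym (eq 0)) z)) (A.zeroˡ _))))
        (∑₊-cong′ m λ i j i+j≡m → A.*-cong (eq (suc i)) (eq′ j (ℕP.≤-trans (ℕP.m≤n+m j i) (ℕP.≤-reflexive i+j≡m))))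

      products : ∀ b c → b ℕ.+ c ≡ suc k → (F b * F c) n A.≈ (G b * G c) n
      products zero    c       ≡.refl = leading {F 0} {F c} {G 0} {G c} (below 0 z≤n) F₀₀ (upTo m)
      products (suc b) zero    eq with ≡.trans (≡.sym (ℕP.+-identityʳ (suc b))) eq
      ... | ≡.refl = A.trans (*-comm (F (suc b)) (F 0) n) (A.trans
            (leading {F 0} {F (suc b)} {G 0} {G (suc b)} (below 0 z≤n) F₀₀ (upTo m)) (*-comm (G 0) (G (suc b)) n))
      products (suc b) (suc c) eq = *-cong {F (suc b)} {G (suc b)} {F (suc c)} {G (suc c)}
        (below (suc b) (ℕP.≤-trans (ℕP.≤-trans (s≤s (ℕP.m≤m+n b c)) (ℕP.≤-reflexive (≡.sym (ℕP.+-suc b c)))) (ℕP.≤-reflexive (ℕP.suc-injective eq))))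
        (below (suc c) (ℕP.≤-trans (ℕP.m≤n+m (suc c) b) (ℕP.≤-reflexive (ℕP.suc-injective eq)))) n

  U : ℕ → Carrier
  U k = W * eval (wrightPoly k) X

  private
    one : Carrier
    one = fromℚ 1ℚ

    θW′ : θ W ≈ - (X - one)
    θW′ = trans θW (-‿cong (+-congˡ {X} (-‿cong (sym fromℚ-1))))

    WX′ : W * X ≈ one
    WX′ = trans WX (sym fromℚ-1)

    square : eval (0ℚ ∷ ℚ.- 1ℚ ∷ 1ℚ ∷ []) X ≈ X * X - X
    square = solve 1 (λ x → con 0ℚ :+ x :* (con (ℚ.- 1ℚ) :+ x :* (con 1ℚ :+ x :* con 0ℚ)) := x :* x :- x) refl X

    cube : eval (0ℚ ∷ 0ℚ ∷ ℚ.- 1ℚ ∷ 1ℚ ∷ []) X ≈ X * X * X - X * X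
    cube = solve 1 (λ x → con 0ℚ :+ x :* (con 0ℚ :+ x :* (con (ℚ.- 1ℚ) :+ x :* (con 1ℚ :+ x :* con 0ℚ))) := x :* x :* x :- x :* x) refl X

  θW*eval : ∀ p → θ (W * eval p X) ≈ W * eval (ϑ p) X
  θW*eval p = begin
    θ (W * P)
      ≈⟨ trans (θ-* W P) (+-cong (*-congʳ θW′) (*-congˡ {W} (trans (D-eval θ-derivation p X) (*-congˡ {P′} θX)))) ⟩
    - (X - one) * P + W * (P′ * (X * X * X - X * X))
      ≈⟨ solve 4 (λ x w p p′ → :- (x :- con 1ℚ) :* p :+ w :* (p′ :* (x :* x :* x :- x :* x)) := con 1ℚ :* (:- (x :- con 1ℚ) :* p) :+ w :* (p′ :* (x :* x :* x :- x :* x))) refl X W P P′ ⟩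
    one * (- (X - one) * P) + W * (P′ * (X * X * X - X * X))
      ≈⟨ +-congʳ (*-congʳ WX′) ⟨
    W * X * (- (X - one) * P) + W * (P′ * (X * X * X - X * X))
      ≈⟨ solve 4 (λ x w p p′ → w :* x :* (:- (x :- con 1ℚ) :* p) :+ w :* (p′ :* (x :* x :* x :- x :* x)) := w :* ((x :* x :* x :- x :* x) :* p′ :- (x :* x :- x) :* p)) refl X W P P′ ⟩
    W * ((X * X * X - X * X) * P′ - (X * X - X) * P)
      ≈⟨ *-congˡ {W} (+-cong (*-congʳ cube) (-‿cong (*-congʳ square))) ⟨
    W * (eval (0ℚ ∷ 0ℚ ∷ ℚ.- 1ℚ ∷ 1ℚ ∷ []) X * P′ - eval (0ℚ ∷ ℚ.- 1ℚ ∷ 1ℚ ∷ []) X * P)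
      ≈⟨ *-congˡ {W} (+-cong (eval-⊗ (0ℚ ∷ 0ℚ ∷ ℚ.- 1ℚ ∷ 1ℚ ∷ []) (deriv p) X) (-‿cong (eval-⊗ (0ℚ ∷ ℚ.- 1ℚ ∷ 1ℚ ∷ []) p X))) ⟨
    W * (eval ((0ℚ ∷ 0ℚ ∷ ℚ.- 1ℚ ∷ 1ℚ ∷ []) ⊗ deriv p) X - eval ((0ℚ ∷ ℚ.- 1ℚ ∷ 1ℚ ∷ []) ⊗ p) X)
      ≈⟨ *-congˡ {W} (eval-⊖ ((0ℚ ∷ 0ℚ ∷ ℚ.- 1ℚ ∷ 1ℚ ∷ []) ⊗ deriv p) ((0ℚ ∷ ℚ.- 1ℚ ∷ 1ℚ ∷ []) ⊗ p) X) ⟨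
    W * eval (ϑ p) X ∎
    where
    open ≈R
    P  = eval p X
    P′ = eval (deriv p) X

  θWW*eval : ∀ p → θ (W * (W * eval p X)) ≈ W * (W * eval (ϑ₂ p) X)
  θWW*eval p = begin
    θ (W * (W * P))
      ≈⟨ trans (θ-* W (W * P)) (+-cong (*-congʳ θW′) (*-congˡ {W} (θW*eval p))) ⟩
    - (X - one) * (W * P) + W * (W * Q)
      ≈⟨ solve 4 (λ x w p q → :- (x :- con 1ℚ) :* (w :* p) :+ w :* (w :* q) := w :* (w :* q) :- con 1ℚ :* ((x :- con 1ℚ) :* (w :* p))) refl X W P Q ⟩
    W * (W * Q) - one * ((X - one) * (W * P))
      ≈⟨ +-congˡ {W * (W * Q)} (-‿cong (*-congʳ WX′)) ⟨
    W * (W * Q) - W * X * ((X - one) * (W * P))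
      ≈⟨ solve 4 (λ x w p q → w :* (w :* q) :- w :* x :* ((x :- con 1ℚ) :* (w :* p)) := w :* (w :* (q :- (x :* x :- x) :* p))) refl X W P Q ⟩
    W * (W * (Q - (X * X - X) * P))
      ≈⟨ *-congˡ {W} (*-congˡ {W} (+-congˡ {Q} (-‿cong (trans (eval-⊗ (0ℚ ∷ ℚ.- 1ℚ ∷ 1ℚ ∷ []) p X) (*-congʳ square))))) ⟨
    W * (W * (Q - eval ((0ℚ ∷ ℚ.- 1ℚ ∷ 1ℚ ∷ []) ⊗ p) X))
      ≈⟨ *-congˡ {W} (*-congˡ {W} (eval-⊖ (ϑ p) ((0ℚ ∷ ℚ.- 1ℚ ∷ 1ℚ ∷ []) ⊗ p) X)) ⟨
    W * (W * eval (ϑ₂ p) X) ∎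
    where
    open ≈R
    P = eval p X
    Q = eval (ϑ p) X

  -- The linear terms carry one factor W and the convolution two. Inserting W X = 1 into the linear
  -- terms makes W² common, and what remains is a polynomial in X that can be tested
  -- coefficientwise.
  U-wright : ∀ k → isZero (residual k) ≡ true → Wright U k
  U-wright k check n = A.trans
    (A.+-cong (A.+-congʳ (A.+-congˡ (A.sym (fromℚ-*-coeff (ι (suc k)) U′ n)))) (A.+-congʳ (A.+-congˡ (A.sym (fromℚ-*-coeff (ι k) U₀ n)))))
    (A.trans (series n)
      (A.trans (fromℚ-*-coeff ½ (θ (θ U₀ + ΣU - U₀)) n)
        (A.*-congˡ (A.*-congˡ (A.+-congʳ (A.+-congˡ (∑₊-coeff (suc k) (λ b c → U b * U c) n)))))))
    where
    U′ U₀ ΣU P P′ L E₁′ E₂ : Carrier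
    U′ = U (suc k)
    U₀ = U k
    ΣU = ∑R.∑₊ (suc k) (λ b c → U b * U c)
    r  = wrightPoly k
    r′ = wrightPoly (suc k)
    s  = convolve (suc k) (λ b c → wrightPoly b ⊗ wrightPoly c)
    l  = (ϑ r′ ⊕ ι (suc k) · r′ ⊖ r′) ⊕ (ϑ r ⊕ ι k · r ⊖ r)
    P  = eval r X
    P′ = eval r′ X
    L  = eval l X
    E₁′ = eval (ϑ (ϑ r ⊖ r)) X
    E₂ = eval (ϑ₂ s) X

    module _ where
      open ≈R

      side : ∀ c p → θ (W * eval p X) + fromℚ c * (W * eval p X) - W * eval p X ≈ W * eval (ϑ p ⊕ c · p ⊖ p) X
      side c p = begin
        θ (W * eval p X) + fromℚ c * (W * eval p X) - W * eval p X
          ≈⟨ +-congʳ (+-congʳ (θW*eval p)) ⟩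
        W * eval (ϑ p) X + fromℚ c * (W * eval p X) - W * eval p X
          ≈⟨ solve 4 (λ w q c p → w :* q :+ c :* (w :* p) :- w :* p := w :* (q :+ c :* p :- p)) refl W (eval (ϑ p) X) (fromℚ c) (eval p X) ⟩
        W * (eval (ϑ p) X + fromℚ c * eval p X - eval p X)
          ≈⟨ *-congˡ {W} (+-congʳ (+-congˡ {eval (ϑ p) X} (sym (eval-· c p X)))) ⟩
        W * (eval (ϑ p) X + eval (c · p) X - eval p X)
          ≈⟨ *-congˡ {W} (trans (eval-⊖ (ϑ p ⊕ c · p) p X) (+-congʳ (eval-⊕ (ϑ p) (c · p) X))) ⟨
        W * eval (ϑ p ⊕ c · p ⊖ p) X ∎

      ΣU≈ : ΣU ≈ W * (W * eval s X)
      ΣU≈ = begin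
        ∑R.∑₊ (suc k) (λ b c → U b * U c)
          ≈⟨ ∑R.∑₊-cong (suc k) {λ b c → U b * U c} {λ b c → W * W * eval (wrightPoly b ⊗ wrightPoly c) X} (λ b c → trans
               (solve 3 (λ w a b → w :* a :* (w :* b) := w :* w :* (a :* b)) refl W (eval (wrightPoly b) X) (eval (wrightPoly c) X))
               (*-congˡ {W * W} (sym (eval-⊗ (wrightPoly b) (wrightPoly c) X)))) ⟩
        ∑R.∑₊ (suc k) (λ b c → W * W * eval (wrightPoly b ⊗ wrightPoly c) X)
          ≈⟨ ∑R.∑₊-*ˡ (suc k) (W * W) (λ b c → eval (wrightPoly b ⊗ wrightPoly c) X) ⟩
        W * W * ∑R.∑₊ (suc k) (λ b c → eval (wrightPoly b ⊗ wrightPoly c) X)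
          ≈⟨ *-congˡ {W * W} (sym (eval-convolve (suc k) (λ b c → wrightPoly b ⊗ wrightPoly c) X)) ⟩
        W * W * eval s X
          ≈⟨ *-assoc W W (eval s X) ⟩
        W * (W * eval s X) ∎

      quadratic : θ (θ U₀ + ΣU - U₀) ≈ W * E₁′ + W * (W * E₂)
      quadratic = begin
        θ (θ U₀ + ΣU - U₀)
          ≈⟨ θ-cong (+-congʳ (+-cong (θW*eval r) ΣU≈)) ⟩
        θ (W * eval (ϑ r) X + W * (W * eval s X) - W * P)
          ≈⟨ θ-cong (solve 4 (λ w q s p → w :* q :+ w :* (w :* s) :- w :* p := w :* (q :- p) :+ w :* (w :* s)) refl W (eval (ϑ r) X) (eval s X) P) ⟩
        θ (W * (eval (ϑ r) X - P) + W * (W * eval s X))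
          ≈⟨ θ-cong (+-congʳ (*-congˡ {W} (sym (eval-⊖ (ϑ r) r X)))) ⟩
        θ (W * eval (ϑ r ⊖ r) X + W * (W * eval s X))
          ≈⟨ trans (θ-+ (W * eval (ϑ r ⊖ r) X) (W * (W * eval s X))) (+-cong (θW*eval (ϑ r ⊖ r)) (θWW*eval s)) ⟩
        W * E₁′ + W * (W * E₂) ∎

      residual≈0 : X * (L - fromℚ ½ * E₁′) - fromℚ ½ * E₂ ≈ fromℚ 0ℚ
      residual≈0 = begin
        X * (L - fromℚ ½ * E₁′) - fromℚ ½ * E₂
          ≈⟨ +-cong (*-cong (solve 1 (λ x → x := con 0ℚ :+ x :* (con 1ℚ :+ x :* con 0ℚ)) refl X) (+-congˡ {L} (-‿cong (sym (eval-· ½ (ϑ (ϑ r ⊖ r)) X))))) (-‿cong (sym (eval-· ½ (ϑ₂ s) X))) ⟩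
        eval (0ℚ ∷ 1ℚ ∷ []) X * (L - eval (½ · ϑ (ϑ r ⊖ r)) X) - eval (½ · ϑ₂ s) X
          ≈⟨ +-congʳ (trans (eval-⊗ (0ℚ ∷ 1ℚ ∷ []) (l ⊖ ½ · ϑ (ϑ r ⊖ r)) X) (*-congˡ {eval (0ℚ ∷ 1ℚ ∷ []) X} (eval-⊖ l (½ · ϑ (ϑ r ⊖ r)) X))) ⟨
        eval ((0ℚ ∷ 1ℚ ∷ []) ⊗ (l ⊖ ½ · ϑ (ϑ r ⊖ r))) X - eval (½ · ϑ₂ s) X
          ≈⟨ eval-⊖ ((0ℚ ∷ 1ℚ ∷ []) ⊗ (l ⊖ ½ · ϑ (ϑ r ⊖ r))) (½ · ϑ₂ s) X ⟨
        eval (residual k) X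
          ≈⟨ eval-isZero (residual k) X check ⟩
        fromℚ 0ℚ ∎

      series : (θ U′ + fromℚ (ι (suc k)) * U′ - U′) + (θ U₀ + fromℚ (ι k) * U₀ - U₀) ≈ fromℚ ½ * θ (θ U₀ + ΣU - U₀)
      series = begin
        (θ U′ + fromℚ (ι (suc k)) * U′ - U′) + (θ U₀ + fromℚ (ι k) * U₀ - U₀)
          ≈⟨ +-cong (side (ι (suc k)) r′) (side (ι k) r) ⟩
        W * eval (ϑ r′ ⊕ ι (suc k) · r′ ⊖ r′) X + W * eval (ϑ r ⊕ ι k · r ⊖ r) X
          ≈⟨ trans (*-congˡ {W} (eval-⊕ (ϑ r′ ⊕ ι (suc k) · r′ ⊖ r′) (ϑ r ⊕ ι k · r ⊖ r) X)) (distribˡ W (eval (ϑ r′ ⊕ ι (suc k) · r′ ⊖ r′) X) (eval (ϑ r ⊕ ι k · r ⊖ r) X)) ⟨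
        W * L
          ≈⟨ solve 3 (λ w l e → w :* l := w :* (con 1ℚ :* (l :- con ½ :* e)) :+ con ½ :* (w :* e)) refl W L E₁′ ⟩
        W * (one * (L - fromℚ ½ * E₁′)) + fromℚ ½ * (W * E₁′)
          ≈⟨ +-congʳ (*-congˡ {W} (*-congʳ (sym WX′))) ⟩
        W * (W * X * (L - fromℚ ½ * E₁′)) + fromℚ ½ * (W * E₁′)
          ≈⟨ solve 5 (λ w x l e f → w :* (w :* x :* (l :- con ½ :* e)) :+ con ½ :* (w :* e) := w :* (w :* (x :* (l :- con ½ :* e) :- con ½ :* f)) :+ con ½ :* (w :* e :+ w :* (w :* f))) refl W X L E₁′ E₂ ⟩
        W * (W * (X * (L - fromℚ ½ * E₁′) - fromℚ ½ * E₂)) + fromℚ ½ * (W * E₁′ + W * (W * E₂))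
          ≈⟨ +-congʳ (*-congˡ {W} (*-congˡ {W} residual≈0)) ⟩
        W * (W * fromℚ 0ℚ) + fromℚ ½ * (W * E₁′ + W * (W * E₂))
          ≈⟨ solve 2 (λ w z → w :* (w :* con 0ℚ) :+ z := z) refl W (fromℚ ½ * (W * E₁′ + W * (W * E₂))) ⟩
        fromℚ ½ * (W * E₁′ + W * (W * E₂))
          ≈⟨ *-congˡ {fromℚ ½} quadratic ⟨
        fromℚ ½ * θ (θ U₀ + ΣU - U₀) ∎

  eval-coeff-0 : ∀ p f → eval p f 0 A.≈ EA.eval p (f 0)
  eval-coeff-0 []      f = A.refl
  eval-coeff-0 (c ∷ p) f = A.+-congˡ (A.*-congˡ (eval-coeff-0 p f))

  X-coeff-0 : X 0 A.≈ A.fromℚ 1ℚ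
  X-coeff-0 = A.*-identityʳ _

  -- X has constant term 1, so a vanishing coefficient sum yields the initial value asked for by
  -- `Wright-unique`.
  U-coeff-0 : ∀ k → value (wrightPoly k) 1ℚ ≡ 0ℚ → U k 0 A.≈ A.0#
  U-coeff-0 k eq = A.trans (A.*-congˡ (A.trans (eval-coeff-0 (wrightPoly k) X)
    (A.trans (EA.eval-fromℚ (wrightPoly k) 1ℚ X-coeff-0) (A.trans (A.fromℚ-cong eq) A.fromℚ-0)))) (A.zeroʳ _)

  V≈U-0 : V 0 ≈ U 0
  V≈U-0 = begin
    V 0                      ≈⟨ (λ { zero → A.sym (var-*-zero (K 1)) ; (suc n) → A.sym (var-*-suc (K 1) n) }) ⟩
    T                        ≈⟨ T≈ ⟩
    W * (X - 1#)             ≈⟨ *-congˡ {W} (trans (+-congˡ {X} (-‿cong (sym fromℚ-1))) (solve 1 (λ x → x :- con 1ℚ := con (ℚ.- 1ℚ) :+ x :* (con 1ℚ :+ x :* con 0ℚ)) refl X)) ⟩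
    U 0                      ∎
    where open ≈R

  V≈U-≤ : ∀ k → (∀ j → j ℕ.< k → isZero (residual j) ≡ true) → (∀ j → j ℕ.≤ k → value (wrightPoly j) 1ℚ ≡ 0ℚ) → ∀ j → j ℕ.≤ k → V j ≈ U j
  V≈U-≤ zero    res val zero z≤n = V≈U-0
  V≈U-≤ (suc k) res val j j≤k+1 with ℕP.m≤n⇒m<n∨m≡n j≤k+1
  ... | inj₁ (s≤s j≤k) = V≈U-≤ k (λ i i<k → res i (ℕP.m≤n⇒m≤1+n i<k)) (λ i i≤k → val i (ℕP.m≤n⇒m≤1+n i≤k)) j j≤k
  ... | inj₂ ≡.refl    = Wright-unique V U k (wright k) (U-wright k (res k ℕP.≤-refl)) A.refl (A.sym (U-coeff-0 (suc k) (val (suc k) ℕP.≤-refl)))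
        (V≈U-≤ k (λ i i<k → res i (ℕP.m≤n⇒m≤1+n i<k)) (λ i i≤k → val i (ℕP.m≤n⇒m≤1+n i≤k)))

  V≈U-6 : V 6 ≈ U 6
  V≈U-6 = V≈U-≤ 6
    -- Each `refl` is a finite computation in ℚ: the residuals for k = 0, ..., 5 vanish, and below,
    -- the coefficient sums for k = 0, ..., 6.
    (λ { 0 _ → ≡.refl ; 1 _ → ≡.refl ; 2 _ → ≡.refl ; 3 _ → ≡.refl ; 4 _ → ≡.refl ; 5 _ → ≡.refl
       ; (suc (suc (suc (suc (suc (suc _)))))) (s≤s (s≤s (s≤s (s≤s (s≤s (s≤s ())))))) })
    (λ { 0 _ → ≡.refl ; 1 _ → ≡.refl ; 2 _ → ≡.refl ; 3 _ → ≡.refl ; 4 _ → ≡.refl ; 5 _ → ≡.refl ; 6 _ → ≡.refl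
       ; (suc (suc (suc (suc (suc (suc (suc _))))))) (s≤s (s≤s (s≤s (s≤s (s≤s (s≤s ())))))) })
    6 ℕP.≤-refl

-- Extraction of coefficients

-- A pair (α , β) stands for α(x) + β(x) E with two unknowns x and E.
LinearPoly : Set
LinearPoly = Poly × Poly

infixl 6 _⊞_
infixl 7 _⊡_

_⊞_ : LinearPoly → LinearPoly → LinearPoly
(α , β) ⊞ (α′ , β′) = (α ⊕ α′) , (β ⊕ β′)

_⊡_ : ℚ → LinearPoly → LinearPoly
c ⊡ (α , β) = (c · α) , (c · β)

timesN : LinearPoly → LinearPoly
timesN (α , β) = (1ℚ ∷ 1ℚ ∷ []) ⊗ α , (1ℚ ∷ 1ℚ ∷ []) ⊗ β

-- Represents the (scaled) coefficient of X^(j+1) p(X) at z^N, N = x + 1, if s₁ and s₂ represent those of X^(j+1) and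
-- X^(j+2); the recursion is N [z^N] X^j = j ([z^N] X^(j+2) - [z^N] X^(j+1)), which is θ X = X³ - X² read off at z^N.
extractFrom : ℕ → Poly → LinearPoly → LinearPoly → LinearPoly
extractFrom j []      s₁ s₂ = [] , []
extractFrom j (c ∷ p) s₁ s₂ = c ⊡ s₁ ⊞ extractFrom (suc j) p s₂ (s₂ ⊞ 1/suc j ⊡ timesN s₁)

tail : Poly → Poly
tail []      = []
tail (_ ∷ p) = p

-- Represents the coefficient of W (r + r₁ X + X² p(X)) for every r₁, because W X = 1 has no coefficient at z^N.
extract : ℚ → Poly → LinearPoly
extract r p = (((ℚ.- 1ℚ) ℚ.* r ∷ []) , []) ⊞ extractFrom 0 p ((1ℚ ∷ 1ℚ ∷ []) , []) ((ι 2 ∷ ι 3 ∷ []) , (ι 2 ∷ []))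

infixl 6 _⟨+⟩_ _⟨-⟩_

-- Syntax for the stated formula: `⟦_⟧ₑ` unfolds to it literally, hence the separate `linear` and
-- the leading constant 0 in `β-expr`, while `toPoly` yields a coefficient list that can be compared
-- with the extracted one.
data PolyExpr : Set where
  constant    : ℚ → PolyExpr
  linear      : ℚ → PolyExpr
  power       : ℚ → ℕ → PolyExpr
  _⟨+⟩_ _⟨-⟩_ : PolyExpr → PolyExpr → PolyExpr

⟦_⟧ₑ : PolyExpr → ℚ → ℚ
⟦ constant c ⟧ₑ x = c
⟦ linear c ⟧ₑ   x = c ℚ.* x
⟦ power c k ⟧ₑ  x = c ℚ.* (x ^ℚ k)
⟦ p ⟨+⟩ r ⟧ₑ    x = ⟦ p ⟧ₑ x ℚ.+ ⟦ r ⟧ₑ x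
⟦ p ⟨-⟩ r ⟧ₑ    x = ⟦ p ⟧ₑ x ℚ.- ⟦ r ⟧ₑ x

monomial : ℚ → ℕ → Poly
monomial c k = replicate k 0ℚ ++ c ∷ []

toPoly : PolyExpr → Poly
toPoly (constant c) = c ∷ []
toPoly (linear c)   = 0ℚ ∷ c ∷ []
toPoly (power c k)  = monomial c k
toPoly (p ⟨+⟩ r)    = toPoly p ⊕ toPoly r
toPoly (p ⟨-⟩ r)    = toPoly p ⊖ toPoly r

α-expr β-expr : PolyExpr
α-expr = power (+ 82825 ℚ./ 576576) 9
  ⟨+⟩ power (+ 373340075 ℚ./ 110702592) 8
  ⟨+⟩ power (+ 9401544029 ℚ./ 332107776) 7
  ⟨+⟩ power (+ 14473244813 ℚ./ 127733760) 6
  ⟨+⟩ power (+ 414139396709 ℚ./ 1660538880) 5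
  ⟨+⟩ power (+ 88215445651 ℚ./ 332107776) 4
  ⟨-⟩ power (+ 18783816473 ℚ./ 332107776) 3
  ⟨-⟩ power (+ 643359542029 ℚ./ 1660538880) 2
  ⟨-⟩ linear (+ 358936540409 ℚ./ 1660538880)
β-expr = constant (+ 0 ℚ./ 1)
  ⟨-⟩ power (+ 3955 ℚ./ 2048) 7
  ⟨-⟩ power (+ 186349 ℚ./ 6144) 6
  ⟨-⟩ power (+ 259283273 ℚ./ 1161216) 5
  ⟨-⟩ power (+ 119912501 ℚ./ 129024) 4
  ⟨-⟩ power (+ 149860633081 ℚ./ 63866880) 3
  ⟨-⟩ power (+ 601794266581 ℚ./ 166053888) 2
  ⟨-⟩ linear (+ 864000570107 ℚ./ 276756480)
  ⟨-⟩ constant (+ 921390308389 ℚ./ 830269440)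

module Extraction (A : ℚ-Algebra) where
  private module A = ℚ-Algebra A
  open SeriesOperators A
  open PowerSeries A using (seriesAlgebra)
  open ℚ-Algebra seriesAlgebra
  open ParkingArea A using (K; V)
  open TreeSeries A
  open WrightSolution A using (V≈U-6)
  open Evaluation seriesAlgebra
  private
    module EA = Evaluation A
    module ≈R = SetoidReasoning setoid

  interpret : A.Carrier → A.Carrier → LinearPoly → A.Carrier
  interpret x E (α , β) = EA.eval α x A.+ EA.eval β x A.* E

  -- `c` is to be the reciprocal of [z^(n + 1)] T, which is [z^n] K 1. With this scaling the powers
  -- X and X² contribute n + 1 and 2 + 3n + 2E, the two starting values of the extraction.
  module _ (n : ℕ) (c E : A.Carrier)
    (c*K≈1 : c A.* K 1 n A.≈ A.fromℚ 1ℚ)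
    (c*X²≈ : c A.* (X * X) (suc n) A.≈ (A.fromℚ (ι 2) A.+ A.fromℚ (ι 3) A.* A.nat n) A.+ A.fromℚ (ι 2) A.* E)
    where
    open SetoidReasoning A.setoid

    private
      x : A.Carrier
      x = A.nat n

      ⟦_⟧ : LinearPoly → A.Carrier
      ⟦_⟧ = interpret x E

    L : Carrier → A.Carrier
    L f = c A.* f (suc n)

    L-cong : ∀ {f g} → f ≈ g → L f A.≈ L g
    L-cong eq = A.*-congˡ (eq (suc n))

    L-+ : ∀ f g → L (f + g) A.≈ L f A.+ L g
    L-+ f g = A.distribˡ c _ _

    L-scale : ∀ r f → L (fromℚ r * f) A.≈ A.fromℚ r A.* L f
    L-scale r f = A.trans (A.*-congˡ (fromℚ-*-coeff r f (suc n))) (A.solve 3 (λ c r f → c A.:* (r A.:* f) A.:= r A.:* (c A.:* f)) A.refl c (A.fromℚ r) (f (suc n)))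

    L-θ : ∀ f → L (θ f) A.≈ A.nat (suc n) A.* L f
    L-θ f = A.solve 3 (λ c r f → c A.:* (r A.:* f) A.:= r A.:* (c A.:* f)) A.refl c (A.nat (suc n)) (f (suc n))

    nat-N : A.nat (suc n) A.≈ A.fromℚ 1ℚ A.+ x
    nat-N = A.nat-+ 1 n

    L-1 : L (fromℚ 1ℚ) A.≈ A.0#
    L-1 = A.zeroʳ c

    L-T : L T A.≈ A.fromℚ 1ℚ
    L-T = A.trans (A.*-congˡ (var-*-suc (K 1) n)) c*K≈1

    L-W : L W A.≈ A.fromℚ (ℚ.- 1ℚ)
    L-W = begin
      L (1# - T)                          ≈⟨ L-cong {1# - T} {fromℚ 1ℚ + fromℚ (ℚ.- 1ℚ) * T} (trans (+-congʳ (sym fromℚ-1)) (solve 1 (λ t → con 1ℚ :- t := con 1ℚ :+ con (ℚ.- 1ℚ) :* t) refl T)) ⟩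
      L (fromℚ 1ℚ + fromℚ (ℚ.- 1ℚ) * T)   ≈⟨ A.trans (L-+ (fromℚ 1ℚ) (fromℚ (ℚ.- 1ℚ) * T)) (A.+-cong (A.trans L-1 (A.sym A.fromℚ-0)) (A.trans (L-scale (ℚ.- 1ℚ) T) (A.*-congˡ L-T))) ⟩
      A.fromℚ 0ℚ A.+ A.fromℚ (ℚ.- 1ℚ) A.* A.fromℚ 1ℚ  ≈⟨ A.solve 0 (A.con 0ℚ A.:+ A.con (ℚ.- 1ℚ) A.:* A.con 1ℚ A.:= A.con (ℚ.- 1ℚ)) A.refl ⟩
      A.fromℚ (ℚ.- 1ℚ)                    ∎

    L-X : L X A.≈ A.nat (suc n)
    L-X = begin
      L X                       ≈⟨ L-cong {X} {fromℚ 1ℚ + θ T} (trans X-unfold (+-cong (sym fromℚ-1) (sym θT))) ⟩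
      L (fromℚ 1ℚ + θ T)        ≈⟨ A.trans (L-+ (fromℚ 1ℚ) (θ T)) (A.trans (A.+-cong L-1 (A.trans (L-θ T) (A.*-congˡ L-T))) (A.+-identityˡ _)) ⟩
      A.nat (suc n) A.* A.fromℚ 1ℚ  ≈⟨ A.solve 1 (λ a → a A.:* A.con 1ℚ A.:= a) A.refl (A.nat (suc n)) ⟩
      A.nat (suc n)             ∎

    L-X^ : ∀ j → L (X ^ (3 ℕ.+ j)) A.≈ L (X ^ (2 ℕ.+ j)) A.+ A.fromℚ (1/suc j) A.* (A.nat (suc n) A.* L (X ^ suc j))
    L-X^ j = begin
      L (X ^ (3 ℕ.+ j))
        ≈⟨ L-cong {X ^ (3 ℕ.+ j)} {X ^ (2 ℕ.+ j) + fromℚ (1/suc j) * (nat (suc j) * ((X * X - X) * X ^ suc j))} step ⟩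
      L (X ^ (2 ℕ.+ j) + fromℚ (1/suc j) * (nat (suc j) * ((X * X - X) * X ^ suc j)))
        ≈⟨ A.trans (L-+ (X ^ (2 ℕ.+ j)) (fromℚ (1/suc j) * (nat (suc j) * ((X * X - X) * X ^ suc j)))) (A.+-congˡ (L-scale (1/suc j) (nat (suc j) * ((X * X - X) * X ^ suc j)))) ⟩
      L (X ^ (2 ℕ.+ j)) A.+ A.fromℚ (1/suc j) A.* L (nat (suc j) * ((X * X - X) * X ^ suc j))
        ≈⟨ A.+-congˡ (A.*-congˡ (A.trans (L-cong {nat (suc j) * ((X * X - X) * X ^ suc j)} {θ (X ^ suc j)} (sym (Derivation.D-^ θ-derivation θX′ (suc j)))) (L-θ (X ^ suc j)))) ⟩
      L (X ^ (2 ℕ.+ j)) A.+ A.fromℚ (1/suc j) A.* (A.nat (suc n) A.* L (X ^ suc j)) ∎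
      where
      θX′ : θ X ≈ (X * X - X) * X
      θX′ = trans θX (solve 1 (λ x → x :* x :* x :- x :* x := (x :* x :- x) :* x) refl X)

      step : X ^ (3 ℕ.+ j) ≈ X ^ (2 ℕ.+ j) + fromℚ (1/suc j) * (nat (suc j) * ((X * X - X) * X ^ suc j))
      step = ≈R.begin
        X * (X * X ^ suc j)
          ≈R.≈⟨ solve 2 (λ x p → x :* (x :* p) := x :* p :+ con 1ℚ :* ((x :* x :- x) :* p)) refl X (X ^ suc j) ⟩
        X * X ^ suc j + fromℚ 1ℚ * ((X * X - X) * X ^ suc j)
          ≈R.≈⟨ +-congˡ {X * X ^ suc j} (trans (*-congʳ (trans (fromℚ-cong (≡.sym (≡.trans (ℚP.*-comm (1/suc j) (ι (suc j))) (ι-suc-* j)))) (fromℚ-* (1/suc j) (ι (suc j))))) (*-assoc (fromℚ (1/suc j)) (nat (suc j)) ((X * X - X) * X ^ suc j))) ⟩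
        X * X ^ suc j + fromℚ (1/suc j) * (nat (suc j) * ((X * X - X) * X ^ suc j)) ≈R.∎

    ⊞-sound : ∀ s t → ⟦ s ⊞ t ⟧ A.≈ ⟦ s ⟧ A.+ ⟦ t ⟧
    ⊞-sound (α , β) (α′ , β′) = A.trans (A.+-cong (EA.eval-⊕ α α′ x) (A.*-congʳ (EA.eval-⊕ β β′ x)))
      (A.solve 5 (λ a b a′ b′ E → a A.:+ a′ A.:+ (b A.:+ b′) A.:* E A.:= a A.:+ b A.:* E A.:+ (a′ A.:+ b′ A.:* E)) A.refl _ _ _ _ _)

    ⊡-sound : ∀ r s → ⟦ r ⊡ s ⟧ A.≈ A.fromℚ r A.* ⟦ s ⟧
    ⊡-sound r (α , β) = A.trans (A.+-cong (EA.eval-· r α x) (A.*-congʳ (EA.eval-· r β x)))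
      (A.solve 4 (λ r a b E → r A.:* a A.:+ r A.:* b A.:* E A.:= r A.:* (a A.:+ b A.:* E)) A.refl _ _ _ _)

    timesN-sound : ∀ s → ⟦ timesN s ⟧ A.≈ A.nat (suc n) A.* ⟦ s ⟧
    timesN-sound (α , β) = A.trans (A.+-cong (EA.eval-⊗ (1ℚ ∷ 1ℚ ∷ []) α x) (A.*-congʳ (EA.eval-⊗ (1ℚ ∷ 1ℚ ∷ []) β x)))
      (A.trans (A.solve 4 (λ x a b E → (A.con 1ℚ A.:+ x A.:* (A.con 1ℚ A.:+ x A.:* A.con 0ℚ)) A.:* a A.:+ (A.con 1ℚ A.:+ x A.:* (A.con 1ℚ A.:+ x A.:* A.con 0ℚ)) A.:* b A.:* E
          A.:= (A.con 1ℚ A.:+ x) A.:* (a A.:+ b A.:* E)) A.refl x (EA.eval α x) (EA.eval β x) E) (A.*-congʳ (A.sym nat-N)))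

    extractFrom-sound : ∀ j p s₁ s₂ → L (X ^ suc j) A.≈ ⟦ s₁ ⟧ → L (X ^ (2 ℕ.+ j)) A.≈ ⟦ s₂ ⟧ →
      L (X ^ suc j * eval p X) A.≈ ⟦ extractFrom j p s₁ s₂ ⟧
    extractFrom-sound j []      s₁ s₂ eq₁ eq₂ = begin
      L (X ^ suc j * fromℚ 0ℚ)              ≈⟨ L-cong {X ^ suc j * fromℚ 0ℚ} {fromℚ 0ℚ * fromℚ 0ℚ} (solve 1 (λ a → a :* con 0ℚ := con 0ℚ :* con 0ℚ) refl (X ^ suc j)) ⟩
      L (fromℚ 0ℚ * fromℚ 0ℚ)               ≈⟨ L-scale 0ℚ (fromℚ 0ℚ) ⟩
      A.fromℚ 0ℚ A.* L (fromℚ 0ℚ)           ≈⟨ A.solve 2 (λ l E → A.con 0ℚ A.:* l A.:= A.con 0ℚ A.:+ A.con 0ℚ A.:* E) A.refl (L (fromℚ 0ℚ)) E ⟩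
      ⟦ [] , [] ⟧                           ∎
    extractFrom-sound j (r ∷ p) s₁ s₂ eq₁ eq₂ = begin
      L (X ^ suc j * (fromℚ r + X * eval p X))
        ≈⟨ L-cong {X ^ suc j * (fromℚ r + X * eval p X)} {fromℚ r * X ^ suc j + X ^ (2 ℕ.+ j) * eval p X}
             (solve 4 (λ a r x p → a :* (r :+ x :* p) := r :* a :+ x :* a :* p) refl (X ^ suc j) (fromℚ r) X (eval p X)) ⟩
      L (fromℚ r * X ^ suc j + X ^ (2 ℕ.+ j) * eval p X)
        ≈⟨ A.trans (L-+ (fromℚ r * X ^ suc j) (X ^ (2 ℕ.+ j) * eval p X)) (A.+-cong (A.trans (L-scale r (X ^ suc j)) (A.*-congˡ eq₁))
             (extractFrom-sound (suc j) p s₂ (s₂ ⊞ 1/suc j ⊡ timesN s₁) eq₂ eq₃)) ⟩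
      A.fromℚ r A.* ⟦ s₁ ⟧ A.+ ⟦ extractFrom (suc j) p s₂ (s₂ ⊞ 1/suc j ⊡ timesN s₁) ⟧
        ≈⟨ A.+-congʳ (⊡-sound r s₁) ⟨
      ⟦ r ⊡ s₁ ⟧ A.+ ⟦ extractFrom (suc j) p s₂ (s₂ ⊞ 1/suc j ⊡ timesN s₁) ⟧
        ≈⟨ ⊞-sound (r ⊡ s₁) (extractFrom (suc j) p s₂ (s₂ ⊞ 1/suc j ⊡ timesN s₁)) ⟨
      ⟦ r ⊡ s₁ ⊞ extractFrom (suc j) p s₂ (s₂ ⊞ 1/suc j ⊡ timesN s₁) ⟧ ∎
      where
      eq₃ : L (X ^ (3 ℕ.+ j)) A.≈ ⟦ s₂ ⊞ 1/suc j ⊡ timesN s₁ ⟧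
      eq₃ = A.trans (L-X^ j) (A.sym (A.trans (⊞-sound s₂ (1/suc j ⊡ timesN s₁)) (A.+-cong (A.sym eq₂)
        (A.trans (⊡-sound (1/suc j) (timesN s₁)) (A.*-congˡ (A.trans (timesN-sound s₁) (A.*-congˡ (A.sym eq₁))))))))

    extract-sound : ∀ r₀ r₁ p → L (W * eval (r₀ ∷ r₁ ∷ p) X) A.≈ ⟦ extract r₀ p ⟧
    extract-sound r₀ r₁ p = begin
      L (W * (fromℚ r₀ + X * (fromℚ r₁ + X * eval p X)))
        ≈⟨ L-cong {W * (fromℚ r₀ + X * (fromℚ r₁ + X * eval p X))} {fromℚ r₀ * W + (fromℚ r₁ * fromℚ 1ℚ + X ^ 1 * eval p X)} split ⟩
      L (fromℚ r₀ * W + (fromℚ r₁ * fromℚ 1ℚ + X ^ 1 * eval p X))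
        ≈⟨ A.trans (L-+ (fromℚ r₀ * W) (fromℚ r₁ * fromℚ 1ℚ + X ^ 1 * eval p X)) (A.+-cong (A.trans (L-scale r₀ W) (A.*-congˡ L-W))
             (A.trans (L-+ (fromℚ r₁ * fromℚ 1ℚ) (X ^ 1 * eval p X)) (A.+-cong (A.trans (L-scale r₁ (fromℚ 1ℚ)) (A.*-congˡ (A.trans L-1 (A.sym A.fromℚ-0))))
               (extractFrom-sound 0 p ((1ℚ ∷ 1ℚ ∷ []) , []) ((ι 2 ∷ ι 3 ∷ []) , (ι 2 ∷ [])) first second)))) ⟩
      A.fromℚ r₀ A.* A.fromℚ (ℚ.- 1ℚ) A.+ (A.fromℚ r₁ A.* A.fromℚ 0ℚ A.+ ⟦ rest ⟧)
        ≈⟨ A.solve 5 (λ r₀ r₁ s x E → r₀ A.:* A.con (ℚ.- 1ℚ) A.:+ (r₁ A.:* A.con 0ℚ A.:+ s) A.:= A.con (ℚ.- 1ℚ) A.:* r₀ A.:+ x A.:* A.con 0ℚ A.:+ A.con 0ℚ A.:* E A.:+ s) A.refl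
             (A.fromℚ r₀) (A.fromℚ r₁) ⟦ rest ⟧ x E ⟩
      A.fromℚ (ℚ.- 1ℚ) A.* A.fromℚ r₀ A.+ x A.* A.fromℚ 0ℚ A.+ A.fromℚ 0ℚ A.* E A.+ ⟦ rest ⟧
        ≈⟨ A.+-congʳ (A.+-congʳ (A.+-congʳ (A.fromℚ-* (ℚ.- 1ℚ) r₀))) ⟨
      ⟦ ((ℚ.- 1ℚ) ℚ.* r₀ ∷ []) , [] ⟧ A.+ ⟦ rest ⟧
        ≈⟨ ⊞-sound (((ℚ.- 1ℚ) ℚ.* r₀ ∷ []) , []) rest ⟨
      ⟦ extract r₀ p ⟧ ∎
      where
      rest : LinearPoly
      rest = extractFrom 0 p ((1ℚ ∷ 1ℚ ∷ []) , []) ((ι 2 ∷ ι 3 ∷ []) , (ι 2 ∷ []))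

      split : W * (fromℚ r₀ + X * (fromℚ r₁ + X * eval p X)) ≈ fromℚ r₀ * W + (fromℚ r₁ * fromℚ 1ℚ + X ^ 1 * eval p X)
      split = ≈R.begin
        W * (fromℚ r₀ + X * (fromℚ r₁ + X * eval p X))
          ≈R.≈⟨ solve 5 (λ w r₀ x r₁ p → w :* (r₀ :+ x :* (r₁ :+ x :* p)) := r₀ :* w :+ (r₁ :* (w :* x) :+ (w :* x) :* x :* p)) refl W (fromℚ r₀) X (fromℚ r₁) (eval p X) ⟩
        fromℚ r₀ * W + (fromℚ r₁ * (W * X) + W * X * X * eval p X)
          ≈R.≈⟨ +-congˡ {fromℚ r₀ * W} (+-cong (*-congˡ {fromℚ r₁} (trans WX (sym fromℚ-1))) (*-congʳ (trans (*-congʳ WX) (*-comm 1# X)))) ⟩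
        fromℚ r₀ * W + (fromℚ r₁ * fromℚ 1ℚ + X ^ 1 * eval p X) ≈R.∎

      first : L (X ^ 1) A.≈ ⟦ (1ℚ ∷ 1ℚ ∷ []) , [] ⟧
      first = A.trans (L-cong {X ^ 1} {X} (*-identityʳ X)) (A.trans L-X (A.trans nat-N
        (A.solve 2 (λ x E → A.con 1ℚ A.:+ x A.:= A.con 1ℚ A.:+ x A.:* (A.con 1ℚ A.:+ x A.:* A.con 0ℚ) A.:+ A.con 0ℚ A.:* E) A.refl x E)))

      second : L (X ^ 2) A.≈ ⟦ (ι 2 ∷ ι 3 ∷ []) , (ι 2 ∷ []) ⟧
      second = A.trans (L-cong {X ^ 2} {X * X} (*-congˡ {X} (*-identityʳ X))) (A.trans c*X²≈
        (A.solve 2 (λ x E → A.con (ι 2) A.:+ A.con (ι 3) A.:* x A.:+ A.con (ι 2) A.:* E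
           A.:= A.con (ι 2) A.:+ x A.:* (A.con (ι 3) A.:+ x A.:* A.con 0ℚ) A.:+ (A.con (ι 2) A.:+ x A.:* A.con 0ℚ) A.:* E) A.refl x E))

    V₆-sound : A.fromℚ (ι 720) A.* L (V 6) A.≈ EA.eval (toPoly α-expr) x A.+ EA.eval (toPoly β-expr) x A.* E
    V₆-sound = begin
      A.fromℚ (ι 720) A.* L (V 6)
        ≈⟨ A.*-congˡ (A.trans (L-cong {V 6} {W * eval (r₀ ∷ r₁ ∷ p) X} V≈U-6) (extract-sound r₀ r₁ p)) ⟩
      A.fromℚ (ι 720) A.* ⟦ extract r₀ p ⟧
        ≈⟨ ⊡-sound (ι 720) (extract r₀ p) ⟨
      ⟦ ι 720 ⊡ extract r₀ p ⟧
        ≈⟨ A.+-cong (EA.eval-≡ (proj₁ (ι 720 ⊡ extract r₀ p)) (toPoly α-expr) x ≡.refl)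
             (A.*-congʳ (EA.eval-≡ (proj₂ (ι 720 ⊡ extract r₀ p)) (toPoly β-expr) x ≡.refl)) ⟩
      EA.eval (toPoly α-expr) x A.+ EA.eval (toPoly β-expr) x A.* E ∎
      where
      -- The two lowest coefficients of `wrightPoly 6`, belonging to W and to W X = 1. The factor
      -- 720 = 6! turns binomial moments into factorial ones.
      r₀ = (+ 863) ℚ./ 60480
      r₁ = -[1+ 948 ] ℚ./ 145152
      p  = tail (tail (wrightPoly 6))

open ≡ using (refl; sym; trans)
open ℚ-Algebra ℚ-algebra using (solve; _:=_; _:+_; _:*_; _:-_; :-_; con; _^_)
open WordSums ℚ-algebra using (∑<; ∑<-cong; ∑words; ∑words-*ˡ)
open Exponential ℚ-algebra using (expo; nat-suc-*-expo)
open PowerSeries ℚ-algebra using (seriesAlgebra)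
open SeriesOperators ℚ-algebra using (var; var-*-suc; fromℚ-*-coeff)
open ParkingArea ℚ-algebra using (q; V; K)
open TreeSeries ℚ-algebra using (K-closed; expSum; XB-coeff)
open Evaluation ℚ-algebra using (eval; eval-⊕; eval-⊖; eval-≡)


-- Moments of the area statistic

private
  module R = ℚ-Algebra seriesAlgebra
  module PS = ParkingSeries seriesAlgebra q
  module WR = WordSums seriesAlgebra

sumℚ-++ : ∀ xs ys → sumℚ (xs ++ ys) ≡ sumℚ xs ℚ.+ sumℚ ys
sumℚ-++ []       ys = sym (ℚP.+-identityˡ _)
sumℚ-++ (x ∷ xs) ys = trans (cong (x ℚ.+_) (sumℚ-++ xs ys)) (sym (ℚP.+-assoc x _ _))

sumℚ-applyUpTo : ∀ {B : Set} m (f : ℕ → ℕ) (k : ℕ → List B) (h : B → ℚ) →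
  sumℚ (map h (concatMap k (map suc (applyUpTo f m)))) ≡ ∑< m (λ x → sumℚ (map h (k (suc (f x)))))
sumℚ-applyUpTo zero    f k h = refl
sumℚ-applyUpTo (suc m) f k h = begin
  sumℚ (map h (k (suc (f 0)) ++ rest))                        ≡⟨ cong sumℚ (ListP.map-++ h (k (suc (f 0))) rest) ⟩
  sumℚ (map h (k (suc (f 0))) ++ map h rest)                  ≡⟨ sumℚ-++ (map h (k (suc (f 0)))) (map h rest) ⟩
  sumℚ (map h (k (suc (f 0)))) ℚ.+ sumℚ (map h rest)          ≡⟨ cong (sumℚ (map h (k (suc (f 0)))) ℚ.+_) (sumℚ-applyUpTo m (λ x → f (suc x)) k h) ⟩
  ∑< (suc m) (λ x → sumℚ (map h (k (suc (f x)))))             ∎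
  where
  open ≡.≡-Reasoning
  rest = concatMap k (map suc (applyUpTo (λ x → f (suc x)) m))

sumℚ-allVecs : ∀ n m (h : List ℕ → ℚ) → sumℚ (map (λ p → h (toList p)) (allVecs n m)) ≡ ∑words n m h
sumℚ-allVecs zero    m h = ℚP.+-identityʳ (h [])
sumℚ-allVecs (suc n) m h = trans
  (sumℚ-applyUpTo m (λ x → x) (λ x → map (x ∷ᵛ_) (allVecs n m)) (λ p → h (toList p)))
  (∑<-cong m λ x → trans (cong sumℚ (sym (ListP.map-∘ (allVecs n m)))) (sumℚ-allVecs n m (λ w → h (suc x ∷ w))))

sumℚ-filter : ∀ {B : Set} (b : B → Bool) (f : B → ℚ) xs →
  sumℚ (map f (filter (λ x → b x Bool.≟ true) xs)) ≡ sumℚ (map (λ x → if b x then f x else 0ℚ) xs)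
sumℚ-filter b f []       = refl
sumℚ-filter b f (x ∷ xs) with b x
... | true  = cong (f x ℚ.+_) (sumℚ-filter b f xs)
... | false = trans (sumℚ-filter b f xs) (sym (ℚP.+-identityˡ _))

ι-length : ∀ {B : Set} (xs : List B) → ι (length xs) ≡ sumℚ (map (λ _ → 1ℚ) xs)
ι-length []       = refl
ι-length (x ∷ xs) = trans (ι-+ 1 (length xs)) (cong (1ℚ ℚ.+_) (ι-length xs))

falling-suc : ∀ x k → falling (x ℚ.+ 1ℚ) (suc k) ≡ falling x (suc k) ℚ.+ ι (suc k) ℚ.* falling x k
falling-suc x zero    = solve 1 (λ x → con 1ℚ :* (x :+ con 1ℚ :- con 0ℚ) := con 1ℚ :* (x :- con 0ℚ) :+ con 1ℚ :* con 1ℚ) refl x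
falling-suc x (suc k) = begin
  falling (x ℚ.+ 1ℚ) (suc k) ℚ.* (x ℚ.+ 1ℚ ℚ.- ι (suc k))
    ≡⟨ cong₂ (λ a b → a ℚ.* (x ℚ.+ 1ℚ ℚ.- b)) (falling-suc x k) (ι-+ 1 k) ⟩
  (falling x k ℚ.* (x ℚ.- ι k) ℚ.+ ι (suc k) ℚ.* falling x k) ℚ.* (x ℚ.+ 1ℚ ℚ.- (1ℚ ℚ.+ ι k))
    ≡⟨ cong (λ a → (falling x k ℚ.* (x ℚ.- ι k) ℚ.+ a ℚ.* falling x k) ℚ.* (x ℚ.+ 1ℚ ℚ.- (1ℚ ℚ.+ ι k))) (ι-+ 1 k) ⟩
  (falling x k ℚ.* (x ℚ.- ι k) ℚ.+ (1ℚ ℚ.+ ι k) ℚ.* falling x k) ℚ.* (x ℚ.+ 1ℚ ℚ.- (1ℚ ℚ.+ ι k))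
    ≡⟨ solve 3 (λ f x k → (f :* (x :- k) :+ (con 1ℚ :+ k) :* f) :* (x :+ con 1ℚ :- (con 1ℚ :+ k)) :=
                          f :* (x :- k) :* (x :- (con 1ℚ :+ k)) :+ (con 1ℚ :+ (con 1ℚ :+ k)) :* (f :* (x :- k))) refl (falling x k) x (ι k) ⟩
  falling x k ℚ.* (x ℚ.- ι k) ℚ.* (x ℚ.- (1ℚ ℚ.+ ι k)) ℚ.+ (1ℚ ℚ.+ (1ℚ ℚ.+ ι k)) ℚ.* (falling x k ℚ.* (x ℚ.- ι k))
    ≡⟨ cong₂ (λ a b → falling x k ℚ.* (x ℚ.- ι k) ℚ.* (x ℚ.- a) ℚ.+ b ℚ.* (falling x k ℚ.* (x ℚ.- ι k))) (sym (ι-+ 1 k)) (sym (trans (ι-+ 1 (suc k)) (cong (1ℚ ℚ.+_) (ι-+ 1 k)))) ⟩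
  falling x (suc (suc k)) ℚ.+ ι (suc (suc k)) ℚ.* falling x (suc k) ∎
  where open ≡.≡-Reasoning

falling-0 : ∀ k → falling 0ℚ (suc k) ≡ 0ℚ
falling-0 zero    = refl
falling-0 (suc k) = trans (cong (ℚ._* (0ℚ ℚ.- ι (suc k))) (falling-0 k)) (ℚP.*-zeroˡ (0ℚ ℚ.- ι (suc k)))

-- The coefficient of y^k in (1 + y)^a is a binomial coefficient: Pascal's rule on the left is
-- `falling-suc` on the right. Expanding q^area at q = 1 therefore produces factorial moments.
q^-coeff : ∀ a k → ι (k !) ℚ.* (q R.^ a) k ≡ falling (ι a) k
q^-coeff zero    zero    = refl
q^-coeff zero    (suc k) = trans (ℚP.*-zeroʳ (ι (suc k !))) (sym (falling-0 k))
q^-coeff (suc a) zero    = trans (cong (1ℚ ℚ.*_) (ℚP.*-identityˡ ((q R.^ a) 0))) (q^-coeff a zero)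
q^-coeff (suc a) (suc k) = begin
  ι (suc k !) ℚ.* (q R.* q R.^ a) (suc k)
    ≡⟨ cong (ι (suc k !) ℚ.*_) (trans (R.distribʳ (q R.^ a) R.1# var (suc k)) (cong₂ ℚ._+_ (R.*-identityˡ (q R.^ a) (suc k)) (var-*-suc (q R.^ a) k))) ⟩
  ι (suc k !) ℚ.* ((q R.^ a) (suc k) ℚ.+ (q R.^ a) k)
    ≡⟨ ℚP.*-distribˡ-+ (ι (suc k !)) ((q R.^ a) (suc k)) ((q R.^ a) k) ⟩
  ι (suc k !) ℚ.* (q R.^ a) (suc k) ℚ.+ ι (suc k !) ℚ.* (q R.^ a) k
    ≡⟨ cong₂ ℚ._+_ (q^-coeff a (suc k)) (trans (cong (ℚ._* (q R.^ a) k) (ι-* (suc k) (k !))) (trans (ℚP.*-assoc (ι (suc k)) (ι (k !)) ((q R.^ a) k)) (cong (ι (suc k) ℚ.*_) (q^-coeff a k)))) ⟩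
  falling (ι a) (suc k) ℚ.+ ι (suc k) ℚ.* falling (ι a) k
    ≡⟨ falling-suc (ι a) k ⟨
  falling (ι a ℚ.+ 1ℚ) (suc k)
    ≡⟨ cong (λ x → falling x (suc k)) (trans (ℚP.+-comm (ι a) 1ℚ) (sym (ι-+ 1 a))) ⟩
  falling (ι (suc a)) (suc k) ∎
  where open ≡.≡-Reasoning

-- The area `a` is the sum of the gaps i ∸ x, which are exact differences because each x is at most
-- its height. The relation to the letter sum is additive, the right side being the sum of the
-- heights.
staircaseWeight-bounded : ∀ i xs → boundedFrom i xs ≡ true →
  Σ ℕ λ a → (PS.staircaseWeight i xs R.≈ q R.^ a) × (a ℕ.+ sum xs ≡ i ℕ.* length xs ℕ.+ tri (length xs))
staircaseWeight-bounded i []       eq = 0 , R.refl , sym (trans (ℕP.+-identityʳ _) (ℕP.*-zeroʳ i))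
staircaseWeight-bounded i (x ∷ xs) eq with x ≤ᵇ i in x≤ᵇi
... | true =
  let a , weight≈ , total = staircaseWeight-bounded (suc i) xs eq
  in i ∸ x ℕ.+ a
   , R.trans (R.*-congˡ {q R.^ (i ∸ x)} weight≈) (R.sym (R.^-homo-* q (i ∸ x) a))
   , trans (arith (i ∸ x) a x (sum xs)) (trans (cong₂ ℕ._+_ (ℕP.m∸n+n≡m (ℕP.≤ᵇ⇒≤ x i (≡.subst Bool.T (sym x≤ᵇi) _))) total) (arith′ i (length xs) (tri (length xs))))
  where
  arith : ∀ d a x s → d ℕ.+ a ℕ.+ (x ℕ.+ s) ≡ d ℕ.+ x ℕ.+ (a ℕ.+ s)
  arith = solve-∀
  arith′ : ∀ i m t → i ℕ.+ (suc i ℕ.* m ℕ.+ t) ≡ i ℕ.* suc m ℕ.+ (m ℕ.+ t)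
  arith′ = solve-∀
... | false with eq
... | ()

staircaseWeight-unbounded : ∀ i xs → boundedFrom i xs ≡ false → PS.staircaseWeight i xs R.≈ R.0#
staircaseWeight-unbounded i (x ∷ xs) eq with x ≤ᵇ i
... | true  = R.trans (R.*-congˡ {q R.^ (i ∸ x)} (staircaseWeight-unbounded (suc i) xs eq)) (R.zeroʳ (q R.^ (i ∸ x)))
... | false = R.refl

area-ι : ∀ n (p : Vec ℕ n) a → a ℕ.+ sum (toList p) ≡ 1 ℕ.* n ℕ.+ tri n → area n p ≡ ι a
area-ι n p a eq = begin
  ((+ (n ℕ.* suc n)) ℚ./ 2) ℚ.- ι (sum (toList p))
    ≡⟨ cong (ℚ._- ι (sum (toList p))) (ι-cancel 1 {(+ (n ℕ.* suc n)) ℚ./ 2} {ι (a ℕ.+ sum (toList p))} (trans (ι-suc-*-/ 1 (n ℕ.* suc n)) (trans (cong ι double) (ι-* 2 (a ℕ.+ sum (toList p)))))) ⟩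
  ι (a ℕ.+ sum (toList p)) ℚ.- ι (sum (toList p))
    ≡⟨ cong (ℚ._- ι (sum (toList p))) (ι-+ a (sum (toList p))) ⟩
  ι a ℚ.+ ι (sum (toList p)) ℚ.- ι (sum (toList p))
    ≡⟨ solve 2 (λ a s → a :+ s :- s := a) refl (ι a) (ι (sum (toList p))) ⟩
  ι a ∎
  where
  open ≡.≡-Reasoning
  double : n ℕ.* suc n ≡ 2 ℕ.* (a ℕ.+ sum (toList p))
  double = trans (ℕP.*-suc n n) (trans (cong (n ℕ.+_) (sym (tri-double n))) (trans (arith n (tri n)) (cong (2 ℕ.*_) (sym eq))))
    where
    arith : ∀ n t → n ℕ.+ (t ℕ.+ t ℕ.+ n) ≡ 2 ℕ.* (1 ℕ.* n ℕ.+ t)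
    arith = solve-∀

weight-coeff : ∀ n (p : Vec ℕ n) k →
  (if isParking p then falling (area n p) k else 0ℚ) ≡ ι (k !) ℚ.* PS.weight 1 (toList p) k
weight-coeff n p k with isParking p in parking
... | true =
  let a , weight≈ , total = staircaseWeight-bounded 1 (sort (toList p)) parking
      len = trans (↭P.↭-length (sort-↭ (toList p))) (VecP.length-toList p)
      eq = trans (cong (a ℕ.+_) (sym (sum-↭ (sort-↭ (toList p))))) (trans total (cong (λ m → 1 ℕ.* m ℕ.+ tri m) len))
  in trans (cong (λ x → falling x k) (area-ι n p a eq)) (trans (sym (q^-coeff a k)) (cong (ι (k !) ℚ.*_) (sym (weight≈ k))))
... | false = sym (trans (cong (ι (k !) ℚ.*_) (staircaseWeight-unbounded 1 (sort (toList p)) parking k)) (ℚP.*-zeroʳ (ι (k !))))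

∑words-coeff : ∀ m M (f : List ℕ → R.Carrier) k → WR.∑words m M f k ≡ ∑words m M (λ w → f w k)
∑words-coeff zero    M f k = refl
∑words-coeff (suc m) M f k = trans (go M (λ x → WR.∑words m M (λ w → f (suc x ∷ w)))) (∑<-cong M λ x → ∑words-coeff m M (λ w → f (suc x ∷ w)) k)
  where
  go : ∀ M (h : ℕ → R.Carrier) → WR.∑< M h k ≡ ∑< M (λ x → h x k)
  go zero    h = refl
  go (suc M) h = cong (h 0 k ℚ.+_) (go M (λ x → h (suc x)))

sum-falling : ∀ n k → sumℚ (map (λ p → falling (area n p) k) (parkingFunctions n)) ≡ ι (k !) ℚ.* (ι (n !) ℚ.* V k (suc n))
sum-falling n k = begin
  sumℚ (map (λ p → falling (area n p) k) (parkingFunctions n))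
    ≡⟨ sumℚ-filter isParking (λ p → falling (area n p) k) (allVecs n n) ⟩
  sumℚ (map (λ p → if isParking p then falling (area n p) k else 0ℚ) (allVecs n n))
    ≡⟨ cong sumℚ (ListP.map-cong (λ p → weight-coeff n p k) (allVecs n n)) ⟩
  sumℚ (map (λ p → ι (k !) ℚ.* PS.weight 1 (toList p) k) (allVecs n n))
    ≡⟨ sumℚ-allVecs n n (λ w → ι (k !) ℚ.* PS.weight 1 w k) ⟩
  ∑words n n (λ w → ι (k !) ℚ.* PS.weight 1 w k)
    ≡⟨ ∑words-*ˡ n n (ι (k !)) (λ w → PS.weight 1 w k) ⟩
  ι (k !) ℚ.* ∑words n n (λ w → PS.weight 1 w k)
    ≡⟨ cong (ι (k !) ℚ.*_) (sym V-words) ⟩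
  ι (k !) ℚ.* (ι (n !) ℚ.* V k (suc n)) ∎
  where
  open ≡.≡-Reasoning
  V-words : ι (n !) ℚ.* V k (suc n) ≡ ∑words n n (λ w → PS.weight 1 w k)
  V-words = begin
    -- `g 1 n` uses the letters 1, ..., n + 1, whereas `parkingFunctions n` enumerates vectors over
    -- 1, ..., n.
    ι (n !) ℚ.* PS.truncated (suc n) 1 n k
      ≡⟨ cong (ι (n !) ℚ.*_) (sym (PS.truncated-stable n 1 n (ℕP.≤-reflexive (ℕP.+-comm n 1)) k)) ⟩
    ι (n !) ℚ.* (R.e n R.* WR.∑words n n (PS.weight 1)) k
      ≡⟨ cong (ι (n !) ℚ.*_) (fromℚ-*-coeff (invFact n) (WR.∑words n n (PS.weight 1)) k) ⟩
    ι (n !) ℚ.* (invFact n ℚ.* WR.∑words n n (PS.weight 1) k)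
      ≡⟨ ℚP.*-assoc (ι (n !)) (invFact n) _ ⟨
    ι (n !) ℚ.* invFact n ℚ.* WR.∑words n n (PS.weight 1) k
      ≡⟨ cong₂ ℚ._*_ (ι-!-*-invFact n) (∑words-coeff n n (PS.weight 1) k) ⟩
    1ℚ ℚ.* ∑words n n (λ w → PS.weight 1 w k)
      ≡⟨ ℚP.*-identityˡ _ ⟩
    ∑words n n (λ w → PS.weight 1 w k) ∎

length-parking : ∀ n → ι (length (parkingFunctions n)) ≡ ι (n !) ℚ.* V 0 (suc n)
length-parking n = trans (ι-length (parkingFunctions n)) (trans (sum-falling n 0) (ℚP.*-identityˡ _))

-- Normalisation and the truncated exponential sum in `E₁`

/ℕ-unique : ∀ {x r} m → m ≢ 0 → ι m ℚ.* r ≡ x → x /ℕ m ≡ r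
/ℕ-unique         zero    m≢0 eq = ⊥-elim (m≢0 refl)
/ℕ-unique {x} {r} (suc m) m≢0 eq = ι-cancel m (trans (solve 3 (λ a b c → a :* (b :* c) := a :* c :* b) refl (ι (suc m)) x (1/suc m))
  (trans (cong (ℚ._* x) (ι-suc-* m)) (trans (ℚP.*-identityˡ x) (sym eq))))

/ℕ-* : ∀ x m → m ≢ 0 → ι m ℚ.* (x /ℕ m) ≡ x
/ℕ-* x zero    m≢0 = ⊥-elim (m≢0 refl)
/ℕ-* x (suc m) m≢0 = trans (solve 3 (λ a b c → a :* (b :* c) := a :* c :* b) refl (ι (suc m)) x (1/suc m))
  (trans (cong (ℚ._* x) (ι-suc-* m)) (ℚP.*-identityˡ x))

ι-^ : ∀ m k → ι (m ℕ.^ k) ≡ ι m ^ k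
ι-^ m zero    = refl
ι-^ m (suc k) = trans (ι-* m (m ℕ.^ k)) (cong (ι m ℚ.*_) (ι-^ m k))

suc^≢0 : ∀ n k → suc n ℕ.^ k ≢ 0
suc^≢0 n k eq with ℕP.m^n≡0⇒m≡0 (suc n) k eq
... | ()

!≢0 : ∀ k → k ! ≢ 0
!≢0 k eq = ℕP.<⇒≢ (ℕP.1≤n! k) (sym eq)

/ℕ-! : ∀ x k → x /ℕ (k !) ≡ invFact k ℚ.* x
/ℕ-! x k = /ℕ-unique (k !) (!≢0 k) (trans (sym (ℚP.*-assoc (ι (k !)) (invFact k) x))
  (trans (cong (ℚ._* x) (ι-!-*-invFact k)) (ℚP.*-identityˡ x)))

Σ<-suc : ∀ n f → Σ< (suc n) f ≡ Σ< n f ℚ.+ f n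
Σ<-suc n f = go n (λ x → x)
  where
  go : ∀ n (h : ℕ → ℕ) → sumℚ (map f (applyUpTo h (suc n))) ≡ sumℚ (map f (applyUpTo h n)) ℚ.+ f (h n)
  go zero    h = trans (ℚP.+-identityʳ (f (h 0))) (sym (ℚP.+-identityˡ (f (h 0))))
  go (suc n) h = trans (cong (f (h 0) ℚ.+_) (go n (λ x → h (suc x)))) (sym (ℚP.+-assoc (f (h 0)) _ _))

-- Since n! K 1 n = (n + 1)^(n - 1), this is the reciprocal of K 1 n. It is also the prefactor in
-- `E₁`, so normalised coefficients of X² are expressed through `E₁`.
scale : ℕ → ℚ
scale n = ι (suc n !) /ℕ (suc n ℕ.^ n)

partialSum : ℕ → ℕ → ℚ
partialSum n k = Σ< k (λ j → ι (suc n ℕ.^ j) /ℕ (j !))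

partialSum-suc : ∀ n k → partialSum n (suc k) ≡ partialSum n k ℚ.+ expo (ι (suc n)) k
partialSum-suc n k = trans (Σ<-suc k (λ j → ι (suc n ℕ.^ j) /ℕ (j !))) (cong (partialSum n k ℚ.+_)
  (trans (/ℕ-! (ι (suc n ℕ.^ k)) k) (cong (invFact k ℚ.*_) (ι-^ (suc n) k))))

expSum-partialSum : ∀ n k → expSum (ι (suc n)) k ≡ partialSum n (suc k)
expSum-partialSum n zero    = trans (sym (ℚP.+-identityˡ (expo (ι (suc n)) 0))) (sym (partialSum-suc n 0))
expSum-partialSum n (suc k) = trans (ℚP.+-comm (expo (ι (suc n)) (suc k)) (expSum (ι (suc n)) k))
  (trans (cong (ℚ._+ expo (ι (suc n)) (suc k)) (expSum-partialSum n k)) (sym (partialSum-suc n (suc k))))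

scale-expo : ∀ n → scale n ℚ.* expo (ι (suc n)) n ≡ ι (suc n)
scale-expo n = begin
  scale n ℚ.* (invFact n ℚ.* ι (suc n) ^ n)        ≡⟨ cong (λ a → scale n ℚ.* (invFact n ℚ.* a)) (sym (ι-^ (suc n) n)) ⟩
  scale n ℚ.* (invFact n ℚ.* ι (suc n ℕ.^ n))      ≡⟨ solve 3 (λ a b c → a :* (b :* c) := c :* a :* b) refl (scale n) (invFact n) (ι (suc n ℕ.^ n)) ⟩
  ι (suc n ℕ.^ n) ℚ.* scale n ℚ.* invFact n        ≡⟨ cong (ℚ._* invFact n) (/ℕ-* (ι (suc n !)) (suc n ℕ.^ n) (suc^≢0 n n)) ⟩
  ι (suc n !) ℚ.* invFact n                        ≡⟨ cong (ℚ._* invFact n) (ι-* (suc n) (n !)) ⟩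
  ι (suc n) ℚ.* ι (n !) ℚ.* invFact n              ≡⟨ ℚP.*-assoc (ι (suc n)) (ι (n !)) (invFact n) ⟩
  ι (suc n) ℚ.* (ι (n !) ℚ.* invFact n)            ≡⟨ cong (ι (suc n) ℚ.*_) (ι-!-*-invFact n) ⟩
  ι (suc n) ℚ.* 1ℚ                                 ≡⟨ ℚP.*-identityʳ (ι (suc n)) ⟩
  ι (suc n)                                        ∎
  where open ≡.≡-Reasoning

scale-K : ∀ n → scale n ℚ.* K 1 n ≡ 1ℚ
scale-K n = ι-cancel n {scale n ℚ.* K 1 n} {1ℚ} (begin
  ι (suc n) ℚ.* (scale n ℚ.* K 1 n)            ≡⟨ solve 3 (λ a b c → a :* (b :* c) := b :* (a :* c)) refl (ι (suc n)) (scale n) (K 1 n) ⟩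
  scale n ℚ.* (ι (suc n) ℚ.* K 1 n)            ≡⟨ cong (scale n ℚ.*_) (trans (K-closed 1 n) (ℚP.*-identityˡ (expo (ι (suc n)) n))) ⟩
  scale n ℚ.* expo (ι (suc n)) n               ≡⟨ scale-expo n ⟩
  ι (suc n)                                    ≡⟨ ℚP.*-identityʳ (ι (suc n)) ⟨
  ι (suc n) ℚ.* 1ℚ                             ∎)
  where open ≡.≡-Reasoning

E₁-partialSum : ∀ n → E₁ n ≡ ½ ℚ.* (scale n ℚ.* partialSum n n ℚ.- ι n)
E₁-partialSum n = solve 3 (λ x c s → con 0ℚ :- x :* con ½ :+ c :* con ½ :* s := con ½ :* (c :* s :- x)) refl (ι n) (scale n) (partialSum n n)

-- For N = n + 1 the terms N^n/n! and N^(n + 1)/(n + 1)! coincide.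
scale-expo-suc : ∀ n → scale n ℚ.* expo (ι (suc n)) (suc n) ≡ ι (suc n)
scale-expo-suc n = trans (cong (scale n ℚ.*_) (ι-cancel n {expo (ι (suc n)) (suc n)} {expo (ι (suc n)) n} (nat-suc-*-expo (ι (suc n)) n))) (scale-expo n)

-- The sum up to n + 1 exceeds the one in `E₁`, which stops at n - 1, by two equal terms that scale
-- to n + 1 each. The scaled sum in `E₁` is 2 E₁ + n, and together this is 2 + 3n + 2 E₁.
scale-X² : ∀ n → scale n ℚ.* expSum (ι (suc n)) (suc n) ≡ ι 2 ℚ.+ ι 3 ℚ.* ι n ℚ.+ ι 2 ℚ.* E₁ n
scale-X² n = begin
  c ℚ.* expSum N (suc n)
    ≡⟨ cong (c ℚ.*_) (trans (expSum-partialSum n (suc n)) (trans (partialSum-suc n (suc n)) (cong (ℚ._+ expo N (suc n)) (partialSum-suc n n)))) ⟩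
  c ℚ.* (s ℚ.+ expo N n ℚ.+ expo N (suc n))
    ≡⟨ solve 4 (λ c s a b → c :* (s :+ a :+ b) := c :* s :+ c :* a :+ c :* b) refl c s (expo N n) (expo N (suc n)) ⟩
  c ℚ.* s ℚ.+ c ℚ.* expo N n ℚ.+ c ℚ.* expo N (suc n)
    ≡⟨ cong₂ (λ a b → c ℚ.* s ℚ.+ a ℚ.+ b) (scale-expo n) (scale-expo-suc n) ⟩
  c ℚ.* s ℚ.+ N ℚ.+ N
    ≡⟨ cong (λ a → c ℚ.* s ℚ.+ a ℚ.+ a) (ι-+ 1 n) ⟩
  c ℚ.* s ℚ.+ (1ℚ ℚ.+ ι n) ℚ.+ (1ℚ ℚ.+ ι n)
    ≡⟨ solve 2 (λ s x → s :+ (con 1ℚ :+ x) :+ (con 1ℚ :+ x) := con (ι 2) :+ con (ι 3) :* x :+ con (ι 2) :* (con ½ :* (s :- x))) refl (c ℚ.* s) (ι n) ⟩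
  ι 2 ℚ.+ ι 3 ℚ.* ι n ℚ.+ ι 2 ℚ.* (½ ℚ.* (c ℚ.* s ℚ.- ι n))
    ≡⟨ cong (λ a → ι 2 ℚ.+ ι 3 ℚ.* ι n ℚ.+ ι 2 ℚ.* a) (sym (E₁-partialSum n)) ⟩
  ι 2 ℚ.+ ι 3 ℚ.* ι n ℚ.+ ι 2 ℚ.* E₁ n ∎
  where
  open ≡.≡-Reasoning
  c = scale n
  s = partialSum n n
  N = ι (suc n)

factorialMoment-V : ∀ n k → factorialMoment k n ≡ ι (k !) ℚ.* (scale n ℚ.* V k (suc n))
factorialMoment-V n k = /ℕ-unique (length (parkingFunctions n)) nonzero (begin
  ι (length (parkingFunctions n)) ℚ.* (ι (k !) ℚ.* (scale n ℚ.* V k (suc n)))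
    ≡⟨ cong (ℚ._* (ι (k !) ℚ.* (scale n ℚ.* V k (suc n)))) (length-parking n) ⟩
  ι (n !) ℚ.* K 1 n ℚ.* (ι (k !) ℚ.* (scale n ℚ.* V k (suc n)))
    ≡⟨ solve 5 (λ f a b c v → f :* a :* (b :* (c :* v)) := c :* a :* (b :* (f :* v))) refl (ι (n !)) (K 1 n) (ι (k !)) (scale n) (V k (suc n)) ⟩
  scale n ℚ.* K 1 n ℚ.* (ι (k !) ℚ.* (ι (n !) ℚ.* V k (suc n)))
    ≡⟨ trans (cong (ℚ._* (ι (k !) ℚ.* (ι (n !) ℚ.* V k (suc n)))) (scale-K n)) (ℚP.*-identityˡ _) ⟩
  ι (k !) ℚ.* (ι (n !) ℚ.* V k (suc n))
    ≡⟨ sum-falling n k ⟨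
  sumℚ (map (λ p → falling (area n p) k) (parkingFunctions n)) ∎)
  where
  open ≡.≡-Reasoning
  -- An empty list would force n! K 1 n = 0, against `scale-K`.
  nonzero : length (parkingFunctions n) ≢ 0
  nonzero eq = ⊥-elim (0≢1 (begin
    0ℚ                                             ≡⟨ solve 2 (λ c f → con 0ℚ := c :* (con 0ℚ :* f)) refl (scale n) (invFact n) ⟩
    scale n ℚ.* (0ℚ ℚ.* invFact n)                 ≡⟨ cong (λ a → scale n ℚ.* (a ℚ.* invFact n)) (trans (cong ι (sym eq)) (length-parking n)) ⟩
    scale n ℚ.* (ι (n !) ℚ.* K 1 n ℚ.* invFact n)  ≡⟨ solve 4 (λ c f a g → c :* (f :* a :* g) := c :* a :* (f :* g)) refl (scale n) (ι (n !)) (K 1 n) (invFact n) ⟩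
    scale n ℚ.* K 1 n ℚ.* (ι (n !) ℚ.* invFact n)  ≡⟨ cong₂ ℚ._*_ (scale-K n) (ι-!-*-invFact n) ⟩
    1ℚ                                             ∎))
    where
    0≢1 : 0ℚ ≢ 1ℚ
    0≢1 ()

eval-monomial : ∀ c k x → eval (monomial c k) x ≡ c ℚ.* (x ^ℚ k)
eval-monomial c zero    x = solve 2 (λ c x → c :+ x :* con 0ℚ := c :* con 1ℚ) refl c x
eval-monomial c (suc k) x = trans (cong (λ a → 0ℚ ℚ.+ x ℚ.* a) (eval-monomial c k x))
  (solve 3 (λ c x p → con 0ℚ :+ x :* (c :* p) := c :* (x :* p)) refl c x (x ^ℚ k))

eval-toPoly : ∀ p x → eval (toPoly p) x ≡ ⟦ p ⟧ₑ x
eval-toPoly (constant c) x = solve 2 (λ c x → c :+ x :* con 0ℚ := c) refl c x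
eval-toPoly (linear c)   x = solve 2 (λ c x → con 0ℚ :+ x :* (c :+ x :* con 0ℚ) := c :* x) refl c x
eval-toPoly (power c k)  x = eval-monomial c k x
eval-toPoly (p ⟨+⟩ r)    x = trans (eval-⊕ (toPoly p) (toPoly r) x) (cong₂ ℚ._+_ (eval-toPoly p x) (eval-toPoly r x))
eval-toPoly (p ⟨-⟩ r)    x = trans (eval-⊖ (toPoly p) (toPoly r) x) (cong₂ ℚ._-_ (eval-toPoly p x) (eval-toPoly r x))

factorialMoment₆-formula : ∀ n → factorialMoment 6 n ≡ ⟦ α-expr ⟧ₑ (ι n) ℚ.+ ⟦ β-expr ⟧ₑ (ι n) ℚ.* E₁ n
factorialMoment₆-formula n = trans (factorialMoment-V n 6) (trans
  (Extraction.V₆-sound ℚ-algebra n (scale n) (E₁ n) (scale-K n) (trans (cong (scale n ℚ.*_) (XB-coeff 0 (suc n))) (scale-X² n)))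
  (cong₂ (λ a b → a ℚ.+ b ℚ.* E₁ n) (eval-toPoly α-expr (ι n)) (eval-toPoly β-expr (ι n))))

-- Asymptotics

0≤-+ : ∀ {a b} → 0ℚ ℚ.≤ a → 0ℚ ℚ.≤ b → 0ℚ ℚ.≤ a ℚ.+ b
0≤-+ {a} {b} p r = subst (ℚ._≤ a ℚ.+ b) (ℚP.+-identityʳ 0ℚ) (ℚP.+-mono-≤ p r)

0≤-* : ∀ {a b} → 0ℚ ℚ.≤ a → 0ℚ ℚ.≤ b → 0ℚ ℚ.≤ a ℚ.* b
0≤-* {a} {b} p r = subst (ℚ._≤ a ℚ.* b) (ℚP.*-zeroʳ a) (ℚP.*-monoˡ-≤-nonNeg a {{ℚ.nonNegative p}} r)

-- Bounds are carried as 0 ≤ b - a: such a bound follows from an identity, left to the ring solver,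
-- that writes b - a through sums and products of nonnegative terms.
≤⇒0≤- : ∀ {a b} → a ℚ.≤ b → 0ℚ ℚ.≤ b ℚ.- a
≤⇒0≤- {a} {b} p = subst (ℚ._≤ b ℚ.- a) (ℚP.+-inverseʳ a) (ℚP.+-mono-≤ p (ℚP.≤-refl {ℚ.- a}))

0≤-⇒≤ : ∀ {a b} → 0ℚ ℚ.≤ b ℚ.- a → a ℚ.≤ b
0≤-⇒≤ {a} {b} p = ≡.subst₂ ℚ._≤_ (ℚP.+-identityʳ a) (solve 2 (λ a b → a :+ (b :- a) := b) refl a b) (ℚP.+-mono-≤ (ℚP.≤-refl {a}) p)

∣∣-square : ∀ a → ∣ a ∣ ℚ.* ∣ a ∣ ≡ a ℚ.* a
∣∣-square a with ℚP.∣p∣≡p∨∣p∣≡-p a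
... | inj₁ eq = cong₂ ℚ._*_ eq eq
... | inj₂ eq = trans (cong₂ ℚ._*_ eq eq) (solve 1 (λ a → :- a :* :- a := a :* a) refl a)

0≤-square : ∀ a → 0ℚ ℚ.≤ a ℚ.* a
0≤-square a = subst (0ℚ ℚ.≤_) (∣∣-square a) (0≤-* (ℚP.0≤∣p∣ a) (ℚP.0≤∣p∣ a))

0≤-cancel : ∀ k {a} → 0ℚ ℚ.≤ ι (suc k) ℚ.* a → 0ℚ ℚ.≤ a
0≤-cancel k {a} p = subst (0ℚ ℚ.≤_) (trans (sym (ℚP.*-assoc (1/suc k) (ι (suc k)) a)) (trans (cong (ℚ._* a) (trans (ℚP.*-comm (1/suc k) (ι (suc k))) (ι-suc-* k))) (ℚP.*-identityˡ a)))
  (0≤-* (ℚP.nonNegative⁻¹ (1/suc k) {{ℚP.normalize-nonNeg 1 (suc k)}}) p)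

0≤ι : ∀ n → 0ℚ ℚ.≤ ι n
0≤ι n = ℚP.nonNegative⁻¹ (ι n) {{ℚP.normalize-nonNeg n 1}}

ι-mono : ∀ {m n} → m ℕ.≤ n → 0ℚ ℚ.≤ ι n ℚ.- ι m
ι-mono {m} {n} m≤n = subst (0ℚ ℚ.≤_)
  (trans (solve 2 (λ a b → a := b :+ a :- b) refl (ι (n ℕ.∸ m)) (ι m)) (cong (ℚ._- ι m) (trans (sym (ι-+ m (n ℕ.∸ m))) (cong ι (ℕP.m+[n∸m]≡n m≤n)))))
  (0≤ι (n ℕ.∸ m))

0≤/ℕ : ∀ {x} m → 0ℚ ℚ.≤ x → 0ℚ ℚ.≤ x /ℕ m
0≤/ℕ zero    p = ℚP.≤-refl
0≤/ℕ (suc m) p = 0≤-* p (ℚP.nonNegative⁻¹ (1/suc m) {{ℚP.normalize-nonNeg 1 (suc m)}})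

0≤invFact : ∀ k → 0ℚ ℚ.≤ invFact k
0≤invFact zero    = 0≤ι 1
0≤invFact (suc k) = 0≤-* (0≤invFact k) (ℚP.nonNegative⁻¹ (1/suc k) {{ℚP.normalize-nonNeg 1 (suc k)}})

0≤^ : ∀ {x} k → 0ℚ ℚ.≤ x → 0ℚ ℚ.≤ x ^ k
0≤^ zero    p = 0≤ι 1
0≤^ (suc k) p = 0≤-* p (0≤^ k p)

-- With t k = c N^k/k! and S k = t 0 + … + t (k - 1), where N = n + 1 and c N^n/n! = N, the bound S n = O(n^(3/2))
-- comes from (N - k) t k = N t k - N t (k - 1), which telescopes, and t k ≤ t n = N.
module PartialSums (n : ℕ) where
  N c : ℚ
  N = ι (suc n)
  c = scale n

  t S : ℕ → ℚ
  t k = c ℚ.* expo N k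
  S k = c ℚ.* partialSum n k

  S-suc : ∀ k → S (suc k) ≡ S k ℚ.+ t k
  S-suc k = trans (cong (c ℚ.*_) (partialSum-suc n k)) (ℚP.*-distribˡ-+ c (partialSum n k) (expo N k))

  t-suc : ∀ k → ι (suc k) ℚ.* t (suc k) ≡ N ℚ.* t k
  t-suc k = trans (solve 3 (λ a b c → a :* (b :* c) := b :* (a :* c)) refl (ι (suc k)) c (expo N (suc k)))
    (trans (cong (c ℚ.*_) (nat-suc-*-expo N k)) (solve 3 (λ a b c → b :* (a :* c) := a :* (b :* c)) refl N c (expo N k)))

  0≤t : ∀ k → 0ℚ ℚ.≤ t k
  0≤t k = 0≤-* (0≤/ℕ (suc n ℕ.^ n) (0≤ι (suc n !))) (0≤-* (0≤invFact k) (0≤^ k (0≤ι (suc n))))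

  0≤S : ∀ k → 0ℚ ℚ.≤ S k
  0≤S zero    = ℚP.≤-reflexive (sym (ℚP.*-zeroʳ c))
  0≤S (suc k) = subst (0ℚ ℚ.≤_) (sym (S-suc k)) (0≤-+ (0≤S k) (0≤t k))

  t-increasing : ∀ k → k ℕ.≤ n → 0ℚ ℚ.≤ t (suc k) ℚ.- t k
  t-increasing k k≤n = 0≤-cancel k (subst (0ℚ ℚ.≤_)
    (trans (solve 3 (λ N j t → (N :- j) :* t := N :* t :- j :* t) refl N (ι (suc k)) (t k))
      (trans (cong (ℚ._- ι (suc k) ℚ.* t k) (sym (t-suc k))) (solve 3 (λ j t′ t → j :* t′ :- j :* t := j :* (t′ :- t)) refl (ι (suc k)) (t (suc k)) (t k))))
    (0≤-* (ι-mono (s≤s k≤n)) (0≤t k)))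

  t≤N : ∀ j k → k ℕ.+ j ≡ n → 0ℚ ℚ.≤ N ℚ.- t k
  t≤N zero    k eq = ℚP.≤-reflexive (sym (trans (cong (λ m → N ℚ.- t m) (trans (sym (ℕP.+-identityʳ k)) eq))
    (trans (cong (λ a → N ℚ.- a) (scale-expo n)) (ℚP.+-inverseʳ N))))
  t≤N (suc j) k eq = subst (0ℚ ℚ.≤_) (solve 3 (λ N t′ t → N :- t′ :+ (t′ :- t) := N :- t) refl N (t (suc k)) (t k))
    (0≤-+ (t≤N j (suc k) (trans (sym (ℕP.+-suc k j)) eq)) (t-increasing k (ℕP.≤-trans (ℕP.m≤m+n k (suc j)) (ℕP.≤-reflexive eq))))

  -- Summation by parts gives k t k - (N - k) S k = S 1 + ... + S k, so this is 2N (S 1 + ... + S k)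
  -- - (S k)². It does not decrease: since t k ≤ N, the square grows by t k (S k + S (k + 1)) ≤ 2N S
  -- (k + 1).
  slack : ℕ → ℚ
  slack k = ι 2 ℚ.* N ℚ.* (ι k ℚ.* t k) ℚ.- S k ℚ.* S k ℚ.- ι 2 ℚ.* N ℚ.* ((N ℚ.- ι k) ℚ.* S k)

  0≤slack : ∀ k → k ℕ.≤ n → 0ℚ ℚ.≤ slack k
  0≤slack zero    _   = ℚP.≤-reflexive (sym (trans (cong (λ s → ι 2 ℚ.* N ℚ.* (0ℚ ℚ.* t 0) ℚ.- s ℚ.* s ℚ.- ι 2 ℚ.* N ℚ.* ((N ℚ.- 0ℚ) ℚ.* s)) (ℚP.*-zeroʳ c))
    (solve 2 (λ N t → con (ι 2) :* N :* (con 0ℚ :* t) :- con 0ℚ :* con 0ℚ :- con (ι 2) :* N :* ((N :- con 0ℚ) :* con 0ℚ) := con 0ℚ) refl N (t 0))))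
  0≤slack (suc k) k<n = subst (0ℚ ℚ.≤_) (sym step)
    (0≤-+ (0≤-+ (0≤slack k k≤n) (0≤-* (0≤ι 2) (0≤-* (0≤S k) gap))) (0≤-* (0≤t k) (0≤-+ (0≤ι (suc n)) gap)))
    where
    k≤n : k ℕ.≤ n
    k≤n = ℕP.<⇒≤ k<n

    gap : 0ℚ ℚ.≤ N ℚ.- t k
    gap = t≤N (n ℕ.∸ k) k (ℕP.m+[n∸m]≡n k≤n)

    step : slack (suc k) ≡ slack k ℚ.+ ι 2 ℚ.* (S k ℚ.* (N ℚ.- t k)) ℚ.+ t k ℚ.* (N ℚ.+ (N ℚ.- t k))
    step = trans (≡.cong₂ (λ a s → ι 2 ℚ.* N ℚ.* a ℚ.- s ℚ.* s ℚ.- ι 2 ℚ.* N ℚ.* ((N ℚ.- ι (suc k)) ℚ.* s)) (t-suc k) (S-suc k))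
      (trans (cong (λ j → ι 2 ℚ.* N ℚ.* (N ℚ.* t k) ℚ.- (S k ℚ.+ t k) ℚ.* (S k ℚ.+ t k) ℚ.- ι 2 ℚ.* N ℚ.* ((N ℚ.- j) ℚ.* (S k ℚ.+ t k))) (ι-+ 1 k))
        (solve 4 (λ N t S k →
           con (ι 2) :* N :* (N :* t) :- (S :+ t) :* (S :+ t) :- con (ι 2) :* N :* ((N :- (con 1ℚ :+ k)) :* (S :+ t)) :=
           con (ι 2) :* N :* (k :* t) :- S :* S :- con (ι 2) :* N :* ((N :- k) :* S) :+ con (ι 2) :* (S :* (N :- t)) :+ t :* (N :+ (N :- t)))
           refl N (t k) (S k) (ι k)))

  -- At k = n, where t n = N and N - n = 1, the slack gives (S n)² ≤ 2n (n + 1)². The distance of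
  -- this to 8n³ is 2n (n - 1)(3n + 1).
  S²-bound : 1 ℕ.≤ n → 0ℚ ℚ.≤ ι 8 ℚ.* (ι n ℚ.* ι n ℚ.* ι n) ℚ.- S n ℚ.* S n
  S²-bound 1≤n = subst (0ℚ ℚ.≤_) total
    (0≤-+ (0≤-+ (0≤slack n ℕP.≤-refl) (0≤-* (0≤-* (0≤ι 2) (0≤ι (suc n))) (0≤S n)))
      (0≤-* (0≤-* (0≤-* (0≤ι 2) (0≤ι n)) (ι-mono 1≤n)) (0≤-+ (0≤-* (0≤ι 3) (0≤ι n)) (0≤ι 1))))
    where
    x = ι n
    total : slack n ℚ.+ ι 2 ℚ.* N ℚ.* S n ℚ.+ ι 2 ℚ.* x ℚ.* (x ℚ.- 1ℚ) ℚ.* (ι 3 ℚ.* x ℚ.+ 1ℚ) ≡ ι 8 ℚ.* (x ℚ.* x ℚ.* x) ℚ.- S n ℚ.* S n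
    total = trans (cong₂ (λ T M → ι 2 ℚ.* M ℚ.* (x ℚ.* T) ℚ.- S n ℚ.* S n ℚ.- ι 2 ℚ.* M ℚ.* ((M ℚ.- x) ℚ.* S n) ℚ.+ ι 2 ℚ.* M ℚ.* S n ℚ.+ ι 2 ℚ.* x ℚ.* (x ℚ.- 1ℚ) ℚ.* (ι 3 ℚ.* x ℚ.+ 1ℚ))
        (trans (scale-expo n) (ι-+ 1 n)) (ι-+ 1 n))
      (solve 2 (λ x S → con (ι 2) :* (con 1ℚ :+ x) :* (x :* (con 1ℚ :+ x)) :- S :* S :- con (ι 2) :* (con 1ℚ :+ x) :* ((con 1ℚ :+ x :- x) :* S)
           :+ con (ι 2) :* (con 1ℚ :+ x) :* S :+ con (ι 2) :* x :* (x :- con 1ℚ) :* (con (ι 3) :* x :+ con 1ℚ)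
         := con (ι 8) :* (x :* x :* x) :- S :* S) refl x (S n))

  -- As 2 E₁ = S n - n and (S - n)² = 2S² + 2n² - (S + n)², four times the square is at most 16n³ +
  -- 2n² ≤ 18n³, rounded up to 20n³.
  E₁²-bound : 1 ℕ.≤ n → 0ℚ ℚ.≤ ι 5 ℚ.* (ι n ℚ.* ι n ℚ.* ι n) ℚ.- E₁ n ℚ.* E₁ n
  E₁²-bound 1≤n = subst (0ℚ ℚ.≤_) total
    (0≤-* (ℚP.nonNegative⁻¹ (½ ℚ.* ½)) (0≤-+ (0≤-+ (0≤-+ (0≤-* (0≤ι 2) (S²-bound 1≤n)) (0≤-* (0≤ι 2) (0≤-* (0≤-square x) (ι-mono 1≤n))))
      (0≤-* (0≤ι 2) (0≤-* (0≤-square x) (0≤ι n)))) (0≤-square (S n ℚ.+ x))))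
    where
    x = ι n
    total : ½ ℚ.* ½ ℚ.* (ι 2 ℚ.* (ι 8 ℚ.* (x ℚ.* x ℚ.* x) ℚ.- S n ℚ.* S n) ℚ.+ ι 2 ℚ.* (x ℚ.* x ℚ.* (x ℚ.- 1ℚ)) ℚ.+ ι 2 ℚ.* (x ℚ.* x ℚ.* x) ℚ.+ (S n ℚ.+ x) ℚ.* (S n ℚ.+ x))
      ≡ ι 5 ℚ.* (x ℚ.* x ℚ.* x) ℚ.- E₁ n ℚ.* E₁ n
    total = trans (solve 2 (λ x S → con (½ ℚ.* ½) :* (con (ι 2) :* (con (ι 8) :* (x :* x :* x) :- S :* S) :+ con (ι 2) :* (x :* x :* (x :- con 1ℚ)) :+ con (ι 2) :* (x :* x :* x) :+ (S :+ x) :* (S :+ x))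
         := con (ι 5) :* (x :* x :* x) :- con ½ :* (S :- x) :* (con ½ :* (S :- x))) refl x (S n))
      (cong (λ e → ι 5 ℚ.* (x ℚ.* x ℚ.* x) ℚ.- e ℚ.* e) (sym (E₁-partialSum n)))

norm₁ : Poly → ℚ
norm₁ []      = 0ℚ
norm₁ (c ∷ p) = ∣ c ∣ ℚ.+ norm₁ p

^ℚ-+ : ∀ x m n → x ^ℚ (m ℕ.+ n) ≡ (x ^ℚ m) ℚ.* (x ^ℚ n)
^ℚ-+ x zero    n = sym (ℚP.*-identityˡ (x ^ℚ n))
^ℚ-+ x (suc m) n = trans (cong (x ℚ.*_) (^ℚ-+ x m n)) (sym (ℚP.*-assoc x (x ^ℚ m) (x ^ℚ n)))

module _ {x : ℚ} (0≤x : 0ℚ ℚ.≤ x) (1≤x : 0ℚ ℚ.≤ x ℚ.- 1ℚ) where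

  1≤^ℚ : ∀ k → 0ℚ ℚ.≤ (x ^ℚ k) ℚ.- 1ℚ
  1≤^ℚ zero    = ℚP.≤-refl
  1≤^ℚ (suc k) = subst (0ℚ ℚ.≤_) (solve 2 (λ x p → x :* (p :- con 1ℚ) :+ (x :- con 1ℚ) := x :* p :- con 1ℚ) refl x (x ^ℚ k))
    (0≤-+ (0≤-* 0≤x (1≤^ℚ k)) 1≤x)

  eval-bound : ∀ p d → length p ℕ.≤ suc d → ∣ eval p x ∣ ℚ.≤ norm₁ p ℚ.* (x ^ℚ d)
  eval-bound []      d       _ = ℚP.≤-reflexive (sym (ℚP.*-zeroˡ (x ^ℚ d)))
  eval-bound (c ∷ []) zero   _ = ℚP.≤-reflexive (trans (cong ∣_∣ (solve 2 (λ c x → c :+ x :* con 0ℚ := c) refl c x))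
    (solve 1 (λ c → c := (c :+ con 0ℚ) :* con 1ℚ) refl ∣ c ∣))
  eval-bound (c ∷ p@(_ ∷ _)) zero (s≤s ())
  eval-bound (c ∷ p) (suc d) (s≤s len) = ℚP.≤-trans (ℚP.∣p+q∣≤∣p∣+∣q∣ c (x ℚ.* eval p x)) (0≤-⇒≤ (subst (0ℚ ℚ.≤_) total
    (0≤-+ (0≤-* (ℚP.0≤∣p∣ c) (1≤^ℚ (suc d))) (0≤-* 0≤x (≤⇒0≤- (eval-bound p d len))))))
    where
    total : ∣ c ∣ ℚ.* ((x ^ℚ suc d) ℚ.- 1ℚ) ℚ.+ x ℚ.* (norm₁ p ℚ.* (x ^ℚ d) ℚ.- ∣ eval p x ∣) ≡
      norm₁ (c ∷ p) ℚ.* (x ^ℚ suc d) ℚ.- (∣ c ∣ ℚ.+ ∣ x ℚ.* eval p x ∣)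
    total = trans (solve 5 (λ c x p n e → c :* (x :* p :- con 1ℚ) :+ x :* (n :* p :- e) := (c :+ n) :* (x :* p) :- (c :+ x :* e)) refl (∣ c ∣) x (x ^ℚ d) (norm₁ p) (∣ eval p x ∣))
      (cong (λ a → norm₁ (c ∷ p) ℚ.* (x ^ℚ suc d) ℚ.- (∣ c ∣ ℚ.+ a)) (sym (trans (ℚP.∣p*q∣≡∣p∣*∣q∣ x (eval p x)) (cong (ℚ._* ∣ eval p x ∣) (ℚP.0≤p⇒∣p∣≡p 0≤x)))))

square-mono : ∀ {a b} → ∣ a ∣ ℚ.≤ b → 0ℚ ℚ.≤ b ℚ.* b ℚ.- a ℚ.* a
square-mono {a} {b} p = subst (0ℚ ℚ.≤_)
  (trans (solve 2 (λ a b → (b :- a) :* ((b :- a) :+ a :+ a) := b :* b :- a :* a) refl ∣ a ∣ b) (cong (λ s → b ℚ.* b ℚ.- s) (∣∣-square a)))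
  (0≤-* (≤⇒0≤- p) (0≤-+ (0≤-+ (≤⇒0≤- p) (ℚP.0≤∣p∣ a)) (ℚP.0≤∣p∣ a)))

α-lower β-poly : Poly
α-lower = take 9 (toPoly α-expr)
β-poly  = toPoly β-expr

-- The part free of `E₁` has degree 8 after removal of the leading term, and its square n^16 is
-- absorbed by n^17. In the other part n^14 meets E₁² ≤ 5n³, so 10 = 2 · 5.
growth : ℚ
growth = ι 2 ℚ.* (norm₁ α-lower ℚ.* norm₁ α-lower) ℚ.+ ι 10 ℚ.* (norm₁ β-poly ℚ.* norm₁ β-poly)

-- By (a + b E)² = 2 a² + 2 b² E² - (a - b E)².
combine : ∀ {x a b E A B} → 0ℚ ℚ.≤ x ℚ.- 1ℚ →
  0ℚ ℚ.≤ (A ℚ.* (x ^ℚ 8)) ℚ.* (A ℚ.* (x ^ℚ 8)) ℚ.- a ℚ.* a →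
  0ℚ ℚ.≤ (B ℚ.* (x ^ℚ 7)) ℚ.* (B ℚ.* (x ^ℚ 7)) ℚ.- b ℚ.* b →
  0ℚ ℚ.≤ ι 5 ℚ.* (x ℚ.* x ℚ.* x) ℚ.- E ℚ.* E →
  0ℚ ℚ.≤ x →
  ((a ℚ.+ b ℚ.* E) ^ℚ 2) ℚ.≤ (ι 2 ℚ.* (A ℚ.* A) ℚ.+ ι 10 ℚ.* (B ℚ.* B)) ℚ.* (x ^ℚ 17)
combine {x} {a} {b} {E} {A} {B} 1≤x a²≤ b²≤ E²≤ 0≤x = 0≤-⇒≤ (subst (0ℚ ℚ.≤_) total
  (0≤-+ (0≤-+ (0≤-+ (0≤-* (0≤ι 2) a²≤) (0≤-* (0≤ι 2) (0≤-* (0≤-square (A ℚ.* P)) 1≤x)))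
    (0≤-* (0≤ι 2) (0≤-+ (0≤-* b²≤ (0≤-* (0≤ι 5) (0≤-* (0≤-square x) 0≤x))) (0≤-* (0≤-square b) E²≤))))
    (0≤-square (a ℚ.- b ℚ.* E))))
  where
  P = x ^ℚ 8
  Q = x ^ℚ 7

  total : ι 2 ℚ.* ((A ℚ.* P) ℚ.* (A ℚ.* P) ℚ.- a ℚ.* a) ℚ.+ ι 2 ℚ.* ((A ℚ.* P) ℚ.* (A ℚ.* P) ℚ.* (x ℚ.- 1ℚ))
      ℚ.+ ι 2 ℚ.* (((B ℚ.* Q) ℚ.* (B ℚ.* Q) ℚ.- b ℚ.* b) ℚ.* (ι 5 ℚ.* (x ℚ.* x ℚ.* x)) ℚ.+ b ℚ.* b ℚ.* (ι 5 ℚ.* (x ℚ.* x ℚ.* x) ℚ.- E ℚ.* E))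
      ℚ.+ (a ℚ.- b ℚ.* E) ℚ.* (a ℚ.- b ℚ.* E)
    ≡ (ι 2 ℚ.* (A ℚ.* A) ℚ.+ ι 10 ℚ.* (B ℚ.* B)) ℚ.* (x ^ℚ 17) ℚ.- (a ℚ.+ b ℚ.* E) ^ℚ 2
  total = trans
    (solve 8 (λ x a b E A B P Q →
        con (ι 2) :* ((A :* P) :* (A :* P) :- a :* a) :+ con (ι 2) :* ((A :* P) :* (A :* P) :* (x :- con 1ℚ))
          :+ con (ι 2) :* (((B :* Q) :* (B :* Q) :- b :* b) :* (con (ι 5) :* (x :* x :* x)) :+ b :* b :* (con (ι 5) :* (x :* x :* x) :- E :* E))
          :+ (a :- b :* E) :* (a :- b :* E)
        := con (ι 2) :* (A :* A) :* (P :* (x :* P)) :+ con (ι 10) :* (B :* B) :* (Q :* (x :* (x :* (x :* Q)))) :- (a :+ b :* E) :* ((a :+ b :* E) :* con 1ℚ))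
      refl x a b E A B P Q)
    (trans (cong₂ (λ p r → ι 2 ℚ.* (A ℚ.* A) ℚ.* p ℚ.+ ι 10 ℚ.* (B ℚ.* B) ℚ.* r ℚ.- (a ℚ.+ b ℚ.* E) ^ℚ 2) (sym (^ℚ-+ x 8 9)) (sym (^ℚ-+ x 7 10)))
      (cong (ℚ._- (a ℚ.+ b ℚ.* E) ^ℚ 2) (sym (ℚP.*-distribʳ-+ (x ^ℚ 17) (ι 2 ℚ.* (A ℚ.* A)) (ι 10 ℚ.* (B ℚ.* B))))))

-- The error n^(17/2) need not be rational, so both sides are squared; 17 = 2 · 7 + 3 combines the
-- degree 7 of the factor of `E₁` with the cubic bound on E₁².
factorialMoment₆-asymptotics : ∀ n → 1 ℕ.≤ n →
  ((factorialMoment 6 n ℚ.- (+ 82825 ℚ./ 576576) ℚ.* (ι n ^ℚ 9)) ^ℚ 2) ℚ.≤ growth ℚ.* (ι n ^ℚ 17)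
factorialMoment₆-asymptotics n 1≤n = subst (λ y → (y ^ℚ 2) ℚ.≤ growth ℚ.* (x ^ℚ 17)) (sym remainder)
  (combine {x} {eval α-lower x} {eval β-poly x} {E₁ n} {norm₁ α-lower} {norm₁ β-poly} 1≤x
    (square-mono (eval-bound (0≤ι n) 1≤x α-lower 8 (ℕP.≤ᵇ⇒≤ 9 9 _)))
    (square-mono (eval-bound (0≤ι n) 1≤x β-poly 7 (ℕP.≤ᵇ⇒≤ 8 8 _)))
    (PartialSums.E₁²-bound n 1≤n) (0≤ι n))
  where
  x : ℚ
  x = ι n

  1≤x : 0ℚ ℚ.≤ x ℚ.- 1ℚ
  1≤x = ι-mono 1≤n

  leading : ℚ
  leading = + 82825 ℚ./ 576576

  remainder : factorialMoment 6 n ℚ.- leading ℚ.* (x ^ℚ 9) ≡ eval α-lower x ℚ.+ eval β-poly x ℚ.* E₁ n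
  remainder = trans (cong (ℚ._- leading ℚ.* (x ^ℚ 9)) (trans (factorialMoment₆-formula n) (cong₂ (λ a b → a ℚ.+ b ℚ.* E₁ n)
      (trans (sym (eval-toPoly α-expr x)) (trans (eval-≡ (toPoly α-expr) (α-lower ⊕ monomial leading 9) x refl)
        (trans (eval-⊕ α-lower (monomial leading 9) x) (cong (eval α-lower x ℚ.+_) (eval-monomial leading 9 x)))))
      (sym (eval-toPoly β-expr x)))))
    (solve 3 (λ a l b → a :+ l :+ b :- l := a :+ b) refl (eval α-lower x) (leading ℚ.* (x ^ℚ 9)) (eval β-poly x ℚ.* E₁ n))

open import Data.Nat using (_≤_)
open import Data.Rational using (_+_; _*_; _-_) renaming (_≤_ to _≤ℚ_)

theorem6 : ((n : ℕ) → 1 ≤ n →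
    factorialMoment 6 n ≡
    ((+ 82825 / 576576) * (ι n ^ℚ 9)
    + (+ 373340075 / 110702592) * (ι n ^ℚ 8)
    + (+ 9401544029 / 332107776) * (ι n ^ℚ 7)
    + (+ 14473244813 / 127733760) * (ι n ^ℚ 6)
    + (+ 414139396709 / 1660538880) * (ι n ^ℚ 5)
    + (+ 88215445651 / 332107776) * (ι n ^ℚ 4)
    - (+ 18783816473 / 332107776) * (ι n ^ℚ 3)
    - (+ 643359542029 / 1660538880) * (ι n ^ℚ 2)
    - (+ 358936540409 / 1660538880) * ι n)
    + ((+ 0 / 1)
    - (+ 3955 / 2048) * (ι n ^ℚ 7)
    - (+ 186349 / 6144) * (ι n ^ℚ 6)
    - (+ 259283273 / 1161216) * (ι n ^ℚ 5)
    - (+ 119912501 / 129024) * (ι n ^ℚ 4)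
    - (+ 149860633081 / 63866880) * (ι n ^ℚ 3)
    - (+ 601794266581 / 166053888) * (ι n ^ℚ 2)
    - (+ 864000570107 / 276756480) * ι n
    - (+ 921390308389 / 830269440)) * E₁ n)
    × (∃[ C ] ∃[ N ] ((n : ℕ) → N ≤ n →
    ((factorialMoment 6 n - (+ 82825 / 576576) * (ι n ^ℚ 9)) ^ℚ 2)
    ≤ℚ C * (ι n ^ℚ 17)))
theorem6 = (λ n 1≤n → factorialMoment₆-formula n) , growth , 1 , factorialMoment₆-asymptotics
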